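{- Let $P$ be a minuscule poset. Then $\sum_{p\in P}T_p^-\equiv^q \frac{\sum_{p\in P}q^{\mathrm{rk}(p)}}{[\mathrm{rk}(P)+2]_q}$.
   Context: Minuscule posets are the posets attached to a Dynkin diagram with a minuscule node; up to isomorphism they are: rectangles $[a]\times[b]$ (product order); shifted staircases $\{(i,j)\colon1\le i\le j\le n\}$ with componentwise order; double-tailed diamonds $d_n(1)$ ($n\ge2$): a chain $x_1<\dots<x_{n-1}$, two incomparable $y_1,y_2$, a chain $z_{n-1}<\dots<z_1$, with $x_i<y_j<z_k$ for all $i,j,k$; and the exceptional minuscule posets $\Lambda_{E_6}$ and $\Lambda_{E_7}$ of types $E_6,E_7$. They are graded; $\mathrm{rk}$ is the rank function with minimal elements of rank $0$ and $\mathrm{rk}(P)$ is the maximum rank. $\mathcal{J}(P)$ is the set of order ideals. For $p\in P$, $I\in\mathcal{J}(P)$: $T_p^+(I)=1$ if $p$ is minimal in $P\setminus I$, else $0$; $T_p^-(I)=1$ if $p$ is maximal in $I$, else $0$; $T_p^q=T_p^+-qT_p^-$ with $q$ an indeterminate. $f\equiv^q g$ means $f-g=\sum_{p\in P}c_p(q)T_p^q$ for some $c_p(q)\in\mathbb{R}(q)$; an element of $\mathbb{R}(q)$ denotes a constant function. $[m]_q=1+q+\dots+q^{m-1}$. -}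

module Defs where

open import Algebra.Bundles using (CommutativeRing; Semiring)
import Algebra.Definitions.RawMonoid
import Algebra.Definitions.RawSemiring
open import Data.Bool.Base using (Bool; if_then_else_)
open import Data.Empty using (⊥; ⊥-elim)
open import Data.Fin.Base as Fin using (Fin; toℕ)
open import Data.Fin.Patterns
import Data.Fin.Properties as Fin
open import Data.Integer.Base as ℤ using (ℤ; 0ℤ; 1ℤ; -1ℤ)
import Data.Integer.Properties as ℤ
open import Data.List.Base using (List; []; _∷_; map)
import Data.List.Membership.DecPropositional
open import Data.Nat.Base as ℕ using (ℕ; zero; suc)
import Data.Nat.Properties as ℕ
open import Data.Product.Base using (_×_; _,_; ∃; ∃-syntax; Σ-syntax; proj₁; proj₂)
import Data.Product.Properties as Product
open import Data.Product.Relation.Binary.Pointwise.NonDependent using (×-poset)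
open import Data.Rational.Base as ℚ using (ℚ; 0ℚ; 1ℚ; ½)
import Data.Rational.Properties as ℚ
open import Data.Rational.Solver using (module +-*-Solver)
open import Data.Sum.Relation.Binary.LeftOrder using (⊎-<-poset)
open import Data.Vec.Base as Vec using (Vec; lookup; replicate; _[_]≔_; _[_]%=_)
import Data.Vec.Functional as Vector
import Data.Vec.Relation.Binary.Pointwise.Inductive as Pointwise
open import Function.Base using (_∘_)
open import Function.Bundles using (Inverse)
open import Level using (0ℓ)
open import Relation.Binary.Bundles using (DecPoset; Poset)
import Relation.Binary.Construct.Flip.EqAndOrd as Flip
import Relation.Binary.Construct.On as On
open import Relation.Binary.Definitions using (_Respects_)
open import Relation.Binary.Morphism.Structures using (IsOrderIsomorphism)
import Relation.Binary.Properties.Poset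
open import Relation.Binary.PropositionalEquality as ≡ using (_≡_)
open import Relation.Nullary.Decidable as Dec
  using (Dec; yes; no; does; _×-dec_; _→-dec_; _⊎-dec_; ¬?)
open import Relation.Nullary.Negation.Core using (¬_)
open import Relation.Unary using (Pred; Decidable; U; ∁)

-- Integral domains whose equality need not be decidable, only ¬¬-stable: classically this
-- is the usual notion, and constructively it still makes nonzero elements cancellable.
record IsStableDomain (R : CommutativeRing 0ℓ 0ℓ) : Set where
  open CommutativeRing R
  field
    1≉0             : ¬ 1# ≈ 0#
    noZeroDivisors  : ∀ {x y} → ¬ x ≈ 0# → ¬ y ≈ 0# → ¬ x * y ≈ 0#
    ≈0-stable       : ∀ {x} → ¬ ¬ x ≈ 0# → x ≈ 0#

-- Real numbers as Cauchy sequences of rationals under the equality that the difference tends to 0;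
-- bounds ≤ ε over all rational ε > 0.
module Real where
  open import Data.Rational.Base using (∣_∣; _≤_; _<_; _+_; _*_; _-_; -_)
  open +-*-Solver using (solve; _:=_; _:+_; _:-_; _:*_; :-_; con)

  Sequence = ℕ → ℚ

  Eventually : (ℕ → Set) → Set
  Eventually P = ∃[ N ] ∀ n → N ℕ.≤ n → P n

  Eventually₂ : (ℕ → ℕ → Set) → Set
  Eventually₂ P = ∃[ N ] ∀ m n → N ℕ.≤ m → N ℕ.≤ n → P m n

  IsCauchy : Sequence → Set
  IsCauchy s = ∀ ε → 0ℚ < ε → Eventually₂ λ m n → ∣ s m - s n ∣ ≤ ε

  Close : Sequence → Sequence → Set
  Close s t = ∀ ε → 0ℚ < ε → Eventually λ n → ∣ s n - t n ∣ ≤ ε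

  record ℝ : Set where
    constructor real
    field
      seq    : Sequence
      cauchy : IsCauchy seq
  open ℝ public

  infix 4 _≈_
  record _≈_ (x y : ℝ) : Set where
    constructor equal
    field
      close : Close (seq x) (seq y)
  open _≈_ public

  private
    half : ∀ ε → 0ℚ < ε → 0ℚ < ½ * ε
    half ε 0<ε =
      ℚ.positive⁻¹ (½ * ε) {{ℚ.pos*pos⇒pos ½ ε {{ℚ.positive 0<ε}}}}

    halves : ∀ ε → ½ * ε + ½ * ε ≡ ε
    halves ε = ≡.trans (≡.sym (ℚ.*-distribʳ-+ ε ½ ½)) (ℚ.*-identityˡ ε)

    shrink : ∀ B ε → 0ℚ < B → 0ℚ < ε → ∃[ δ ] 0ℚ < δ × B * δ ≡ ε
    shrink B ε 0<B 0<ε = δ , 0<δ , eq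
      where
      instance
        B>0 : ℚ.Positive B
        B>0 = ℚ.positive 0<B
        B≢0 : ℚ.NonZero B
        B≢0 = ℚ.pos⇒nonZero B
      δ = ℚ.1/ B * ε
      0<δ : 0ℚ < δ
      0<δ = ℚ.positive⁻¹ δ {{ℚ.pos*pos⇒pos (ℚ.1/ B) {{ℚ.1/pos⇒pos B}} ε {{ℚ.positive 0<ε}}}}
      eq : B * δ ≡ ε
      eq = ≡.trans (≡.sym (ℚ.*-assoc B (ℚ.1/ B) ε))
             (≡.trans (≡.cong (_* ε) (ℚ.*-inverseʳ B)) (ℚ.*-identityˡ ε))

    sum-bound : ∀ a b ε → ∣ a ∣ ≤ ½ * ε → ∣ b ∣ ≤ ½ * ε → ∣ a + b ∣ ≤ ε
    sum-bound a b ε a≤ b≤ = ℚ.≤-trans (ℚ.∣p+q∣≤∣p∣+∣q∣ a b)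
      (≡.subst (∣ a ∣ + ∣ b ∣ ≤_) (halves ε) (ℚ.+-mono-≤ a≤ b≤))

    product-bound : ∀ a b B δ ε → 0ℚ < B → B * δ ≡ ε →
                    ∣ a ∣ ≤ B → ∣ b ∣ ≤ δ → ∣ a * b ∣ ≤ ε
    product-bound a b B δ ε 0<B Bδ≡ε a≤ b≤ = begin
      ∣ a * b ∣     ≡⟨ ℚ.∣p*q∣≡∣p∣*∣q∣ a b ⟩
      ∣ a ∣ * ∣ b ∣ ≤⟨ ℚ.*-monoʳ-≤-nonNeg ∣ b ∣ {{ℚ.∣-∣-nonNeg b}} a≤ ⟩
      B * ∣ b ∣     ≤⟨ ℚ.*-monoˡ-≤-nonNeg B {{ℚ.nonNegative (ℚ.<⇒≤ 0<B)}} b≤ ⟩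
      B * δ         ≡⟨ Bδ≡ε ⟩
      ε             ∎
      where open ℚ.≤-Reasoning

    +-diff : ∀ a b c d → (a - c) + (b - d) ≡ (a + b) - (c + d)
    +-diff = solve 4 (λ a b c d → (a :- c) :+ (b :- d) := (a :+ b) :- (c :+ d)) ≡.refl

    *-diff : ∀ a b c d → a * (b - d) + d * (a - c) ≡ a * b - c * d
    *-diff = solve 4 (λ a b c d → a :* (b :- d) :+ d :* (a :- c) := a :* b :- c :* d) ≡.refl

    neg-diff : ∀ a b → b - a ≡ - a - (- b)
    neg-diff = solve 2 (λ a b → b :- a := :- a :- (:- b)) ≡.refl

    telescope : ∀ a b c → (a - b) + (b - c) ≡ a - c
    telescope = solve 3 (λ a b c → (a :- b) :+ (b :- c) := a :- c) ≡.refl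

    sub-add : ∀ a b → (a - b) + b ≡ a
    sub-add = solve 2 (λ a b → (a :- b) :+ b := a) ≡.refl

    sub-zero : ∀ a → a - 0ℚ ≡ a
    sub-zero = solve 1 (λ a → a :- con 0ℚ := a) ≡.refl

    +-close : ∀ a b c d ε → ∣ a - c ∣ ≤ ½ * ε → ∣ b - d ∣ ≤ ½ * ε →
              ∣ (a + b) - (c + d) ∣ ≤ ε
    +-close a b c d ε p q =
      ≡.subst (λ t → ∣ t ∣ ≤ ε) (+-diff a b c d) (sum-bound (a - c) (b - d) ε p q)

    *-close : ∀ a b c d A D α δ ε →
              0ℚ < A → A * δ ≡ ½ * ε → 0ℚ < D → D * α ≡ ½ * ε →
              ∣ a ∣ ≤ A → ∣ d ∣ ≤ D → ∣ a - c ∣ ≤ α → ∣ b - d ∣ ≤ δ →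
              ∣ a * b - c * d ∣ ≤ ε
    *-close a b c d A D α δ ε 0<A Aδ 0<D Dα a≤ d≤ ac bd =
      ≡.subst (λ t → ∣ t ∣ ≤ ε) (*-diff a b c d)
        (sum-bound (a * (b - d)) (d * (a - c)) ε
          (product-bound a (b - d) A δ (½ * ε) 0<A Aδ a≤ bd)
          (product-bound d (a - c) D α (½ * ε) 0<D Dα d≤ ac))

    swap-diff : ∀ a b → ∣ a - b ∣ ≡ ∣ b - a ∣
    swap-diff a b = ≡.trans (≡.sym (ℚ.∣-p∣≡∣p∣ (a - b)))
      (≡.cong ∣_∣ (solve 2 (λ x y → :- (x :- y) := y :- x) ≡.refl a b))

    neg-close : ∀ a b ε → ∣ a - b ∣ ≤ ε → ∣ - a - (- b) ∣ ≤ ε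
    neg-close a b ε p =
      ≡.subst (λ t → ∣ t ∣ ≤ ε) (neg-diff a b) (≡.subst (_≤ ε) (swap-diff a b) p)

    triangle : ∀ a b c ε → ∣ a - b ∣ ≤ ½ * ε → ∣ b - c ∣ ≤ ½ * ε → ∣ a - c ∣ ≤ ε
    triangle a b c ε p q =
      ≡.subst (λ t → ∣ t ∣ ≤ ε) (telescope a b c) (sum-bound (a - b) (b - c) ε p q)

    0<1 : 0ℚ < 1ℚ
    0<1 = ℚ.positive⁻¹ 1ℚ

    map₁ : ∀ {P R} → (∀ n → P n → R n) → Eventually P → Eventually R
    map₁ f (N , p) = N , λ n N≤n → f n (p n N≤n)

    both₁ : ∀ {P Q} → Eventually P → Eventually Q → Eventually λ n → P n × Q n
    both₁ (M , p) (N , q) = M ℕ.⊔ N , λ n k →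
      p n (ℕ.m⊔n≤o⇒m≤o M N k) , q n (ℕ.m⊔n≤o⇒n≤o M N k)

    zip₁ : ∀ {P Q R} → (∀ n → P n → Q n → R n) →
           Eventually P → Eventually Q → Eventually R
    zip₁ f p q = map₁ (λ n (a , b) → f n a b) (both₁ p q)

    map₂ : ∀ {P R} → (∀ m n → P m n → R m n) → Eventually₂ P → Eventually₂ R
    map₂ f (N , p) = N , λ m n k l → f m n (p m n k l)

    both₂ : ∀ {P Q} → Eventually₂ P → Eventually₂ Q → Eventually₂ λ m n → P m n × Q m n
    both₂ (M , p) (N , q) = M ℕ.⊔ N , λ m n k l →
      p m n (ℕ.m⊔n≤o⇒m≤o M N k) (ℕ.m⊔n≤o⇒m≤o M N l) ,
      q m n (ℕ.m⊔n≤o⇒n≤o M N k) (ℕ.m⊔n≤o⇒n≤o M N l)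

    zip₂ : ∀ {P Q R} → (∀ m n → P m n → Q m n → R m n) →
           Eventually₂ P → Eventually₂ Q → Eventually₂ R
    zip₂ f p q = map₂ (λ m n (a , b) → f m n a b) (both₂ p q)

    Bounded : Sequence → Set
    Bounded s = ∃[ B ] 0ℚ < B × Eventually λ n → ∣ s n ∣ ≤ B

    bounded : ∀ s → IsCauchy s → Bounded s
    bounded s c = conclude (c 1ℚ 0<1)
      where
      conclude : Eventually₂ (λ m n → ∣ s m - s n ∣ ≤ 1ℚ) → Bounded s
      conclude (N , near) = 1ℚ + ∣ s N ∣ , ℚ.+-mono-<-≤ 0<1 (ℚ.0≤∣p∣ (s N)) , N , bound
        where
        open ℚ.≤-Reasoning
        bound : ∀ n → N ℕ.≤ n → ∣ s n ∣ ≤ 1ℚ + ∣ s N ∣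
        bound n N≤n = begin
          ∣ s n ∣                 ≡⟨ ≡.cong ∣_∣ (sub-add (s n) (s N)) ⟨
          ∣ (s n - s N) + s N ∣   ≤⟨ ℚ.∣p+q∣≤∣p∣+∣q∣ (s n - s N) (s N) ⟩
          ∣ s n - s N ∣ + ∣ s N ∣ ≤⟨ ℚ.+-monoˡ-≤ ∣ s N ∣ (near n N N≤n ℕ.≤-refl) ⟩
          1ℚ + ∣ s N ∣            ∎

    const-cauchy : ∀ r → IsCauchy (λ _ → r)
    const-cauchy r ε 0<ε =
      0 , λ _ _ _ _ → ≡.subst (λ t → ∣ t ∣ ≤ ε) (≡.sym (ℚ.+-inverseʳ r)) (ℚ.<⇒≤ 0<ε)

    +-cauchy : ∀ s t → IsCauchy s → IsCauchy t → IsCauchy (λ n → s n + t n)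
    +-cauchy s t c d ε 0<ε =
      zip₂ (λ m n → +-close (s m) (t m) (s n) (t n) ε)
        (c (½ * ε) (half ε 0<ε)) (d (½ * ε) (half ε 0<ε))

    neg-cauchy : ∀ s → IsCauchy s → IsCauchy (λ n → - s n)
    neg-cauchy s c ε 0<ε = map₂ (λ m n → neg-close (s m) (s n) ε) (c ε 0<ε)

    *-cauchy : ∀ s t → IsCauchy s → IsCauchy t → IsCauchy (λ n → s n * t n)
    *-cauchy s t c d ε 0<ε = conclude (bounded s c) (bounded t d)
      where
      conclude : Bounded s → Bounded t → Eventually₂ λ m n → ∣ s m * t m - s n * t n ∣ ≤ ε
      conclude (A , 0<A , s≤A) (D , 0<D , t≤D) =
        step (shrink A (½ * ε) 0<A (half ε 0<ε)) (shrink D (½ * ε) 0<D (half ε 0<ε))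
        where
        step : ∃[ δ ] (0ℚ < δ × A * δ ≡ ½ * ε) → ∃[ α ] (0ℚ < α × D * α ≡ ½ * ε) →
               Eventually₂ λ m n → ∣ s m * t m - s n * t n ∣ ≤ ε
        step (δ , 0<δ , Aδ) (α , 0<α , Dα) =
          zip₂ (λ m n (a , d) (ac , bd) →
                 *-close (s m) (t m) (s n) (t n) A D α δ ε 0<A Aδ 0<D Dα a d ac bd)
            (both s≤A t≤D)
            (both₂ (c α 0<α) (d δ 0<δ))
          where
          both : Eventually (λ n → ∣ s n ∣ ≤ A) → Eventually (λ n → ∣ t n ∣ ≤ D) →
                 Eventually₂ λ m n → ∣ s m ∣ ≤ A × ∣ t n ∣ ≤ D
          both (M , p) (N , q) = M ℕ.⊔ N , λ m n k l →
            p m (ℕ.m⊔n≤o⇒m≤o M N k) , q n (ℕ.m⊔n≤o⇒n≤o M N l)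

    close-pointwise : ∀ s t → (∀ n → s n ≡ t n) → Close s t
    close-pointwise s t eq ε 0<ε = 0 , λ n _ →
      ≡.subst (λ u → ∣ u ∣ ≤ ε)
        (≡.sym (≡.trans (≡.cong (_- t n) (eq n)) (ℚ.+-inverseʳ (t n))))
        (ℚ.<⇒≤ 0<ε)

    close-sym : ∀ s t → Close s t → Close t s
    close-sym s t st ε 0<ε =
      map₁ (λ n → ≡.subst (_≤ ε) (swap-diff (s n) (t n))) (st ε 0<ε)

    close-trans : ∀ s t u → Close s t → Close t u → Close s u
    close-trans s t u st tu ε 0<ε = zip₁ (λ n → triangle (s n) (t n) (u n) ε)
      (st (½ * ε) (half ε 0<ε)) (tu (½ * ε) (half ε 0<ε))

    close-+ : ∀ s t u v → Close s u → Close t v → Close (λ n → s n + t n) (λ n → u n + v n)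
    close-+ s t u v su tv ε 0<ε = zip₁ (λ n → +-close (s n) (t n) (u n) (v n) ε)
      (su (½ * ε) (half ε 0<ε)) (tv (½ * ε) (half ε 0<ε))

    close-neg : ∀ s t → Close s t → Close (λ n → - s n) (λ n → - t n)
    close-neg s t st ε 0<ε =
      map₁ (λ n → neg-close (s n) (t n) ε) (st ε 0<ε)

    close-* : ∀ s t u v → IsCauchy s → IsCauchy v → Close s u → Close t v →
              Close (λ n → s n * t n) (λ n → u n * v n)
    close-* s t u v c d su tv ε 0<ε = conclude (bounded s c) (bounded v d)
      where
      conclude : Bounded s → Bounded v → Eventually λ n → ∣ s n * t n - u n * v n ∣ ≤ ε
      conclude (A , 0<A , s≤A) (D , 0<D , v≤D) =
        step (shrink A (½ * ε) 0<A (half ε 0<ε)) (shrink D (½ * ε) 0<D (half ε 0<ε))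
        where
        step : ∃[ δ ] (0ℚ < δ × A * δ ≡ ½ * ε) → ∃[ α ] (0ℚ < α × D * α ≡ ½ * ε) →
               Eventually λ n → ∣ s n * t n - u n * v n ∣ ≤ ε
        step (δ , 0<δ , Aδ) (α , 0<α , Dα) =
          zip₁ (λ n (a , d) (ac , bd) →
                 *-close (s n) (t n) (u n) (v n) A D α δ ε 0<A Aδ 0<D Dα a d ac bd)
            (both₁ s≤A v≤D)
            (both₁ (su α 0<α) (tv δ 0<δ))

  constant : ℚ → ℝ
  constant r = real (λ _ → r) (const-cauchy r)

  infixl 6 _⊕_
  infixl 7 _⊗_
  infix  8 ⊖_

  _⊕_ : ℝ → ℝ → ℝ
  x ⊕ y = real (λ n → seq x n + seq y n) (+-cauchy (seq x) (seq y) (cauchy x) (cauchy y))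

  ⊖_ : ℝ → ℝ
  ⊖ x = real (λ n → - seq x n) (neg-cauchy (seq x) (cauchy x))

  _⊗_ : ℝ → ℝ → ℝ
  x ⊗ y = real (λ n → seq x n * seq y n) (*-cauchy (seq x) (seq y) (cauchy x) (cauchy y))

  private
    pointwise : ∀ {x y} → (∀ n → seq x n ≡ seq y n) → x ≈ y
    pointwise {x} {y} eq = equal (close-pointwise (seq x) (seq y) eq)

  ℝ-commutativeRing : CommutativeRing 0ℓ 0ℓ
  ℝ-commutativeRing = record
    { Carrier = ℝ ; _≈_ = _≈_ ; _+_ = _⊕_ ; _*_ = _⊗_ ; -_ = ⊖_
    ; 0# = constant 0ℚ ; 1# = constant 1ℚ
    ; isCommutativeRing = record
      { isRing = record
        { +-isAbelianGroup = record
          { isGroup = record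
            { isMonoid = record
              { isSemigroup = record
                { isMagma = record
                  { isEquivalence = record
                    { refl  = pointwise (λ _ → ≡.refl)
                    ; sym   = λ {x} {y} e → equal (close-sym (seq x) (seq y) (close e))
                    ; trans = λ {x} {y} {z} e f →
                        equal (close-trans (seq x) (seq y) (seq z) (close e) (close f))
                    }
                  ; ∙-cong = λ {x} {y} {u} {v} e f →
                      equal (close-+ (seq x) (seq u) (seq y) (seq v) (close e) (close f))
                  }
                ; assoc = λ x y z → pointwise (λ n → ℚ.+-assoc (seq x n) (seq y n) (seq z n))
                }
              ; identity = (λ x → pointwise (λ n → ℚ.+-identityˡ (seq x n)))
                         , (λ x → pointwise (λ n → ℚ.+-identityʳ (seq x n)))
              }
            ; inverse = (λ x → pointwise (λ n → ℚ.+-inverseˡ (seq x n)))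
                      , (λ x → pointwise (λ n → ℚ.+-inverseʳ (seq x n)))
            ; ⁻¹-cong = λ {x} {y} e → equal (close-neg (seq x) (seq y) (close e))
            }
          ; comm = λ x y → pointwise (λ n → ℚ.+-comm (seq x n) (seq y n))
          }
        ; *-cong = λ {x} {y} {u} {v} e f →
            equal (close-* (seq x) (seq u) (seq y) (seq v) (cauchy x) (cauchy v) (close e) (close f))
        ; *-assoc = λ x y z → pointwise (λ n → ℚ.*-assoc (seq x n) (seq y n) (seq z n))
        ; *-identity = (λ x → pointwise (λ n → ℚ.*-identityˡ (seq x n)))
                     , (λ x → pointwise (λ n → ℚ.*-identityʳ (seq x n)))
        ; distrib = (λ x y z → pointwise (λ n → ℚ.*-distribˡ-+ (seq x n) (seq y n) (seq z n)))
                  , (λ x y z → pointwise (λ n → ℚ.*-distribʳ-+ (seq x n) (seq y n) (seq z n)))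
        }
      ; *-comm = λ x y → pointwise (λ n → ℚ.*-comm (seq x n) (seq y n))
      }
    }

  private
    module R = CommutativeRing ℝ-commutativeRing

    Apart₀ : Sequence → Set
    Apart₀ s = ∃[ ε ] 0ℚ < ε × Eventually λ n → ε ≤ ∣ s n ∣

    Null : Sequence → Set
    Null s = Close s (λ _ → 0ℚ)

    half-< : ∀ ε → 0ℚ < ε → ½ * ε < ε
    half-< ε 0<ε = ≡.subst₂ _<_ (ℚ.+-identityʳ (½ * ε)) (halves ε)
                       (ℚ.+-monoʳ-< (½ * ε) (half ε 0<ε))

    apart⇒¬null : ∀ s → Apart₀ s → ¬ Null s
    apart⇒¬null s (ε , 0<ε , away) s≈0 =
      conclude (both₁ away (s≈0 (½ * ε) (half ε 0<ε)))
      where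
      conclude : Eventually (λ n → ε ≤ ∣ s n ∣ × ∣ s n - 0ℚ ∣ ≤ ½ * ε) → ⊥
      conclude (N , p) = ℚ.<-irrefl ≡.refl (ℚ.<-≤-trans (half-< ε 0<ε)
        (ℚ.≤-trans (proj₁ (p N ℕ.≤-refl))
          (≡.subst (λ t → ∣ t ∣ ≤ ½ * ε) (sub-zero (s N)) (proj₂ (p N ℕ.≤-refl)))))

    ¬apart⇒null : ∀ s → IsCauchy s → ¬ Apart₀ s → Null s
    ¬apart⇒null s c ¬apart ε 0<ε = conclude (c η 0<η)
      where
      η = ½ * (½ * ε)
      0<η : 0ℚ < η
      0<η = half (½ * ε) (half ε 0<ε)
      conclude : Eventually₂ (λ m n → ∣ s m - s n ∣ ≤ η) → Eventually λ n → ∣ s n - 0ℚ ∣ ≤ ε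
      conclude (N , near) = decide (∣ s N ∣ ℚ.≤? ½ * ε)
        where
        lower : ¬ ∣ s N ∣ ≤ ½ * ε → ∀ n → N ℕ.≤ n → η ≤ ∣ s n ∣
        lower big n N≤n = ℚ.≮⇒≥ λ small → big
          (≡.subst (λ t → ∣ t ∣ ≤ ½ * ε) (sub-add (s N) (s n))
            (sum-bound (s N - s n) (s n) (½ * ε) (near N n ℕ.≤-refl N≤n) (ℚ.<⇒≤ small)))
        decide : Dec (∣ s N ∣ ≤ ½ * ε) → Eventually λ n → ∣ s n - 0ℚ ∣ ≤ ε
        decide (yes small) = N , λ n N≤n → triangle (s n) (s N) 0ℚ ε
          (ℚ.≤-trans (near n N N≤n ℕ.≤-refl) (ℚ.<⇒≤ (half-< (½ * ε) (half ε 0<ε))))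
          (≡.subst (λ t → ∣ t ∣ ≤ ½ * ε) (≡.sym (sub-zero (s N))) small)
        decide (no big) = ⊥-elim (¬apart (η , 0<η , N , lower big))

    apart-* : ∀ s t → Apart₀ s → Apart₀ t → Apart₀ (λ n → s n * t n)
    apart-* s t (ε , 0<ε , p) (δ , 0<δ , q) =
      ε * δ , ℚ.positive⁻¹ (ε * δ) {{ℚ.pos*pos⇒pos ε {{ℚ.positive 0<ε}} δ {{ℚ.positive 0<δ}}}} ,
      zip₁ away p q
      where
      open ℚ.≤-Reasoning
      away : ∀ n → ε ≤ ∣ s n ∣ → δ ≤ ∣ t n ∣ → ε * δ ≤ ∣ s n * t n ∣
      away n ε≤s δ≤t = begin
        ε * δ             ≤⟨ ℚ.*-monoˡ-≤-nonNeg ε {{ℚ.nonNegative (ℚ.<⇒≤ 0<ε)}} δ≤t ⟩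
        ε * ∣ t n ∣       ≤⟨ ℚ.*-monoʳ-≤-nonNeg ∣ t n ∣ {{ℚ.∣-∣-nonNeg (t n)}} ε≤s ⟩
        ∣ s n ∣ * ∣ t n ∣ ≡⟨ ℚ.∣p*q∣≡∣p∣*∣q∣ (s n) (t n) ⟨
        ∣ s n * t n ∣     ∎

    1-apart : Apart₀ (λ _ → 1ℚ)
    1-apart = 1ℚ , 0<1 , 0 , λ _ _ → ℚ.≤-refl {1ℚ}

    apart⇒≉0 : ∀ x → Apart₀ (seq x) → ¬ x ≈ R.0#
    apart⇒≉0 x a e = apart⇒¬null (seq x) a (close e)

    ¬apart⇒≈0 : ∀ x → ¬ Apart₀ (seq x) → x ≈ R.0#
    ¬apart⇒≈0 x ¬a = equal (¬apart⇒null (seq x) (cauchy x) ¬a)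

    ≈0-stable : ∀ x → ¬ ¬ x ≈ R.0# → x ≈ R.0#
    ≈0-stable x ¬¬p = ¬apart⇒≈0 x (λ a → ¬¬p (apart⇒≉0 x a))

    ⊗-nonzero : ∀ x y → ¬ x ≈ R.0# → ¬ y ≈ R.0# → ¬ x ⊗ y ≈ R.0#
    ⊗-nonzero x y x≉0 y≉0 xy≈0 =
      x≉0 (¬apart⇒≈0 x λ ax → y≉0 (¬apart⇒≈0 y λ ay →
        apart⇒≉0 (x ⊗ y) (apart-* (seq x) (seq y) ax ay) xy≈0))

  ℝ-isStableDomain : IsStableDomain ℝ-commutativeRing
  ℝ-isStableDomain = record
    { 1≉0            = apart⇒≉0 (constant 1ℚ) 1-apart
    ; noZeroDivisors = λ {x} {y} → ⊗-nonzero x y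
    ; ≈0-stable      = λ {x} → ≈0-stable x
    }

module Polynomial (R : CommutativeRing 0ℓ 0ℓ) where
  private module R = CommutativeRing R
  open import Relation.Binary.Reasoning.Setoid R.setoid
  open import Algebra.Properties.Ring R.ring using (-0#≈0#)
  open import Algebra.Properties.CommutativeSemigroup R.+-commutativeSemigroup
    using (interchange; x∙yz≈y∙xz)

  -- Constant coefficient first; trailing zeros are allowed.
  Poly : Set
  Poly = List R.Carrier

  coeff : Poly → ℕ → R.Carrier
  coeff []      _       = R.0#
  coeff (a ∷ p) zero    = a
  coeff (a ∷ p) (suc n) = coeff p n

  infix 4 _≈_
  record _≈_ (p r : Poly) : Set where
    constructor equal
    field at : ∀ n → coeff p n R.≈ coeff r n
  open _≈_ public

  infixl 6 _+_
  infixl 7 _*_ _·_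
  infix  8 -_

  _+_ : Poly → Poly → Poly
  []      + r       = r
  (a ∷ p) + []      = a ∷ p
  (a ∷ p) + (b ∷ r) = a R.+ b ∷ p + r

  -_ : Poly → Poly
  - p = map R.-_ p

  _·_ : R.Carrier → Poly → Poly
  a · p = map (a R.*_) p

  _*_ : Poly → Poly → Poly
  []      * r = []
  (a ∷ p) * r = a · r + (R.0# ∷ p * r)

  private
    coeff-+ : ∀ p r n → coeff (p + r) n R.≈ coeff p n R.+ coeff r n
    coeff-+ []      r       n       = R.sym (R.+-identityˡ (coeff r n))
    coeff-+ (a ∷ p) []      n       = R.sym (R.+-identityʳ (coeff (a ∷ p) n))
    coeff-+ (a ∷ p) (b ∷ r) zero    = R.refl
    coeff-+ (a ∷ p) (b ∷ r) (suc n) = coeff-+ p r n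

    coeff-· : ∀ a p n → coeff (a · p) n R.≈ a R.* coeff p n
    coeff-· a []      n       = R.sym (R.zeroʳ a)
    coeff-· a (b ∷ p) zero    = R.refl
    coeff-· a (b ∷ p) (suc n) = coeff-· a p n

    coeff-neg : ∀ p n → coeff (- p) n R.≈ R.- coeff p n
    coeff-neg []      n       = R.sym -0#≈0#
    coeff-neg (a ∷ p) zero    = R.refl
    coeff-neg (a ∷ p) (suc n) = coeff-neg p n

    ≈-refl : ∀ {p} → p ≈ p
    ≈-refl = equal λ _ → R.refl
    ≈-sym : ∀ {p r} → p ≈ r → r ≈ p
    ≈-sym e = equal λ n → R.sym (at e n)
    ≈-trans : ∀ {p r s} → p ≈ r → r ≈ s → p ≈ s
    ≈-trans e f = equal λ n → R.trans (at e n) (at f n)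

    infixr 5 _∷-cong_
    _∷-cong_ : ∀ {a b p r} → a R.≈ b → p ≈ r → a ∷ p ≈ b ∷ r
    a≈b ∷-cong p≈r = equal λ { zero → a≈b ; (suc n) → at p≈r n }

    tail-≈ : ∀ {a b p r} → a ∷ p ≈ b ∷ r → p ≈ r
    tail-≈ e = equal λ n → at e (suc n)

    +-cong : ∀ {p p′ r r′} → p ≈ p′ → r ≈ r′ → p + r ≈ p′ + r′
    +-cong {p} {p′} {r} {r′} e f = equal λ n → begin
      coeff (p + r) n            ≈⟨ coeff-+ p r n ⟩
      coeff p n R.+ coeff r n    ≈⟨ R.+-cong (at e n) (at f n) ⟩
      coeff p′ n R.+ coeff r′ n  ≈⟨ coeff-+ p′ r′ n ⟨
      coeff (p′ + r′) n          ∎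

    +-assoc : ∀ p r s → (p + r) + s ≈ p + (r + s)
    +-assoc p r s = equal λ n → begin
      coeff ((p + r) + s) n                     ≈⟨ coeff-+ (p + r) s n ⟩
      coeff (p + r) n R.+ coeff s n             ≈⟨ R.+-congʳ (coeff-+ p r n) ⟩
      (coeff p n R.+ coeff r n) R.+ coeff s n   ≈⟨ R.+-assoc _ _ _ ⟩
      coeff p n R.+ (coeff r n R.+ coeff s n)   ≈⟨ R.+-congˡ (coeff-+ r s n) ⟨
      coeff p n R.+ coeff (r + s) n             ≈⟨ coeff-+ p (r + s) n ⟨
      coeff (p + (r + s)) n                     ∎

    +-comm : ∀ p r → p + r ≈ r + p
    +-comm p r = equal λ n → begin
      coeff (p + r) n           ≈⟨ coeff-+ p r n ⟩
      coeff p n R.+ coeff r n   ≈⟨ R.+-comm _ _ ⟩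
      coeff r n R.+ coeff p n   ≈⟨ coeff-+ r p n ⟨
      coeff (r + p) n           ∎

    +-identityˡ : ∀ p → [] + p ≈ p
    +-identityˡ p = ≈-refl
    +-identityʳ : ∀ p → p + [] ≈ p
    +-identityʳ p = ≈-trans (+-comm p []) ≈-refl

    neg-cong : ∀ {p r} → p ≈ r → - p ≈ - r
    neg-cong {p} {r} e = equal λ n →
      R.trans (coeff-neg p n) (R.trans (R.-‿cong (at e n)) (R.sym (coeff-neg r n)))

    +-inverseˡ : ∀ p → - p + p ≈ []
    +-inverseˡ p = equal λ n → begin
      coeff (- p + p) n             ≈⟨ coeff-+ (- p) p n ⟩
      coeff (- p) n R.+ coeff p n   ≈⟨ R.+-congʳ (coeff-neg p n) ⟩
      R.- coeff p n R.+ coeff p n   ≈⟨ R.-‿inverseˡ _ ⟩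
      R.0#                          ∎

    +-inverseʳ : ∀ p → p + - p ≈ []
    +-inverseʳ p = ≈-trans (+-comm p (- p)) (+-inverseˡ p)

    +-interchange : ∀ p r s t → (p + r) + (s + t) ≈ (p + s) + (r + t)
    +-interchange p r s t = equal λ n → begin
      coeff ((p + r) + (s + t)) n   ≈⟨ coeff-+ (p + r) (s + t) n ⟩
      coeff (p + r) n R.+ coeff (s + t) n
        ≈⟨ R.+-cong (coeff-+ p r n) (coeff-+ s t n) ⟩
      (coeff p n R.+ coeff r n) R.+ (coeff s n R.+ coeff t n)
        ≈⟨ interchange _ _ _ _ ⟩
      (coeff p n R.+ coeff s n) R.+ (coeff r n R.+ coeff t n)
        ≈⟨ R.+-cong (coeff-+ p s n) (coeff-+ r t n) ⟨
      coeff (p + s) n R.+ coeff (r + t) n   ≈⟨ coeff-+ (p + s) (r + t) n ⟨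
      coeff ((p + s) + (r + t)) n   ∎

    ·-cong : ∀ {a b p r} → a R.≈ b → p ≈ r → a · p ≈ b · r
    ·-cong {a} {b} {p} {r} a≈b e = equal λ n →
      R.trans (coeff-· a p n) (R.trans (R.*-cong a≈b (at e n)) (R.sym (coeff-· b r n)))

    0·p : ∀ p → R.0# · p ≈ []
    0·p p = equal λ n → R.trans (coeff-· R.0# p n) (R.zeroˡ _)

    1·p : ∀ p → R.1# · p ≈ p
    1·p p = equal λ n → R.trans (coeff-· R.1# p n) (R.*-identityˡ _)

    ·-assoc : ∀ a b p → a · (b · p) ≈ (a R.* b) · p
    ·-assoc a b p = equal λ n → begin
      coeff (a · (b · p)) n       ≈⟨ coeff-· a (b · p) n ⟩
      a R.* coeff (b · p) n       ≈⟨ R.*-congˡ (coeff-· b p n) ⟩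
      a R.* (b R.* coeff p n)     ≈⟨ R.*-assoc _ _ _ ⟨
      (a R.* b) R.* coeff p n     ≈⟨ coeff-· (a R.* b) p n ⟨
      coeff ((a R.* b) · p) n     ∎

    ·-distribˡ : ∀ a p r → a · (p + r) ≈ a · p + a · r
    ·-distribˡ a p r = equal λ n → begin
      coeff (a · (p + r)) n                     ≈⟨ coeff-· a (p + r) n ⟩
      a R.* coeff (p + r) n                     ≈⟨ R.*-congˡ (coeff-+ p r n) ⟩
      a R.* (coeff p n R.+ coeff r n)           ≈⟨ R.distribˡ _ _ _ ⟩
      a R.* coeff p n R.+ a R.* coeff r n       ≈⟨ R.+-cong (coeff-· a p n) (coeff-· a r n) ⟨
      coeff (a · p) n R.+ coeff (a · r) n       ≈⟨ coeff-+ (a · p) (a · r) n ⟨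
      coeff (a · p + a · r) n                   ∎

    ·-distribʳ : ∀ a b p → (a R.+ b) · p ≈ a · p + b · p
    ·-distribʳ a b p = equal λ n → begin
      coeff ((a R.+ b) · p) n                   ≈⟨ coeff-· (a R.+ b) p n ⟩
      (a R.+ b) R.* coeff p n                   ≈⟨ R.distribʳ _ _ _ ⟩
      a R.* coeff p n R.+ b R.* coeff p n       ≈⟨ R.+-cong (coeff-· a p n) (coeff-· b p n) ⟨
      coeff (a · p) n R.+ coeff (b · p) n       ≈⟨ coeff-+ (a · p) (b · p) n ⟨
      coeff (a · p + b · p) n                   ∎

    shift-+ : ∀ p r → R.0# ∷ (p + r) ≈ (R.0# ∷ p) + (R.0# ∷ r)
    shift-+ p r = R.sym (R.+-identityˡ R.0#) ∷-cong ≈-refl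

    shift-[] : R.0# ∷ [] ≈ []
    shift-[] = equal λ { zero → R.refl ; (suc n) → R.refl }

    *-congˡ : ∀ p {r s} → r ≈ s → p * r ≈ p * s
    *-congˡ []      e = ≈-refl
    *-congˡ (a ∷ p) e = +-cong (·-cong R.refl e) (R.refl ∷-cong *-congˡ p e)

    *-zeroʳ : ∀ p → p * [] ≈ []
    *-zeroʳ []      = ≈-refl
    *-zeroʳ (a ∷ p) = ≈-trans (R.refl ∷-cong *-zeroʳ p) shift-[]

    *-∷ : ∀ p b r → p * (b ∷ r) ≈ b · p + (R.0# ∷ p * r)
    *-∷ []      b r = ≈-sym shift-[]
    *-∷ (a ∷ p) b r = R.+-congʳ (R.*-comm a b) ∷-cong
      ≈-trans (+-cong ≈-refl (*-∷ p b r))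
        (≈-trans (≈-sym (+-assoc (a · r) (b · p) (R.0# ∷ p * r)))
          (≈-trans (+-cong (+-comm (a · r) (b · p)) ≈-refl)
            (+-assoc (b · p) (a · r) (R.0# ∷ p * r))))

    *-comm : ∀ p r → p * r ≈ r * p
    *-comm []      r = ≈-sym (*-zeroʳ r)
    *-comm (a ∷ p) r = ≈-trans
      (+-cong ≈-refl (R.refl ∷-cong *-comm p r)) (≈-sym (*-∷ r a p))

    *-cong : ∀ {p p′ r r′} → p ≈ p′ → r ≈ r′ → p * r ≈ p′ * r′
    *-cong {p} {p′} {r} {r′} e f = ≈-trans (*-congˡ p f)
      (≈-trans (*-comm p r′) (≈-trans (*-congˡ r′ e) (*-comm r′ p′)))

    distribʳ : ∀ s p r → (p + r) * s ≈ p * s + r * s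
    distribʳ s []      r       = ≈-refl
    distribʳ s (a ∷ p) []      = ≈-sym (+-identityʳ ((a ∷ p) * s))
    distribʳ s (a ∷ p) (b ∷ r) = ≈-trans
      (+-cong (·-distribʳ a b s) (≈-trans (R.refl ∷-cong distribʳ s p r) (shift-+ (p * s) (r * s))))
      (+-interchange (a · s) (b · s) (R.0# ∷ p * s) (R.0# ∷ r * s))

    distribˡ : ∀ s p r → s * (p + r) ≈ s * p + s * r
    distribˡ s p r = ≈-trans (*-comm s (p + r))
      (≈-trans (distribʳ s p r) (+-cong (*-comm p s) (*-comm r s)))

    shift-* : ∀ p r → (R.0# ∷ p) * r ≈ R.0# ∷ p * r
    shift-* p r = +-cong (0·p r) ≈-refl

    ·-*-assoc : ∀ a p r → (a · p) * r ≈ a · (p * r)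
    ·-*-assoc a []      r = ≈-refl
    ·-*-assoc a (b ∷ p) r = ≈-trans
      (+-cong (≈-sym (·-assoc a b r)) (R.sym (R.zeroʳ a) ∷-cong ·-*-assoc a p r))
      (≈-sym (·-distribˡ a (b · r) (R.0# ∷ p * r)))

    *-assoc : ∀ p r s → (p * r) * s ≈ p * (r * s)
    *-assoc []      r s = ≈-refl
    *-assoc (a ∷ p) r s = ≈-trans (distribʳ s (a · r) (R.0# ∷ p * r))
      (+-cong (·-*-assoc a r s)
        (≈-trans (shift-* (p * r) s) (R.refl ∷-cong *-assoc p r s)))

    *-identityˡ : ∀ p → (R.1# ∷ []) * p ≈ p
    *-identityˡ p = ≈-trans (+-cong (1·p p) shift-[]) (+-identityʳ p)

    *-identityʳ : ∀ p → p * (R.1# ∷ []) ≈ p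
    *-identityʳ p = ≈-trans (*-comm p (R.1# ∷ [])) (*-identityˡ p)

  polynomialRing : CommutativeRing 0ℓ 0ℓ
  polynomialRing = record
    { Carrier = Poly ; _≈_ = _≈_ ; _+_ = _+_ ; _*_ = _*_ ; -_ = -_
    ; 0# = [] ; 1# = R.1# ∷ []
    ; isCommutativeRing = record
      { isRing = record
        { +-isAbelianGroup = record
          { isGroup = record
            { isMonoid = record
              { isSemigroup = record
                { isMagma = record
                  { isEquivalence = record { refl = ≈-refl ; sym = ≈-sym ; trans = ≈-trans }
                  ; ∙-cong = +-cong
                  }
                ; assoc = +-assoc
                }
              ; identity = +-identityˡ , +-identityʳ
              }
            ; inverse = +-inverseˡ , +-inverseʳ
            ; ⁻¹-cong = neg-cong
            }
          ; comm = +-comm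
          }
        ; *-cong = *-cong
        ; *-assoc = *-assoc
        ; *-identity = *-identityˡ , *-identityʳ
        ; distrib = distribˡ , distribʳ
        }
      ; *-comm = *-comm
      }
    }

  X : Poly
  X = R.0# ∷ R.1# ∷ []

  private
    coeff₀-+ : ∀ p r → coeff (p + r) 0 R.≈ coeff p 0 R.+ coeff r 0
    coeff₀-+ p r = coeff-+ p r 0

    coeff₀-X* : ∀ p → coeff (X * p) 0 R.≈ R.0#
    coeff₀-X* p = at (≈-trans (shift-* (R.1# ∷ []) p) ≈-refl) 0

  open CommutativeRing polynomialRing using (semiring; +-rawMonoid; 1#)
  open Semiring semiring using (rawSemiring)
  open Algebra.Definitions.RawSemiring rawSemiring public
    using (_^_)
  open Algebra.Definitions.RawMonoid +-rawMonoid using (sum)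

  -- 1 + X + … + X ^ (n - 1)
  [_]ₓ : ℕ → Poly
  [ n ]ₓ = sum {n} λ i → X ^ toℕ i

  private
    coeff₀-sum : ∀ {n} (f : Fin n → Poly) → (∀ i → coeff (f i) 0 R.≈ R.0#) →
                 coeff (sum f) 0 R.≈ R.0#
    coeff₀-sum {zero}  f f≈0 = R.refl
    coeff₀-sum {suc n} f f≈0 = R.trans (coeff₀-+ (f Fin.zero) (sum (f ∘ Fin.suc)))
      (R.trans (R.+-cong (f≈0 Fin.zero) (coeff₀-sum (f ∘ Fin.suc) (f≈0 ∘ Fin.suc)))
        (R.+-identityˡ R.0#))

    coeff₀-[suc]ₓ : ∀ n → coeff [ suc n ]ₓ 0 R.≈ R.1#
    coeff₀-[suc]ₓ n = R.trans (coeff₀-+ 1# (sum {n} λ i → X ^ suc (toℕ i)))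
      (R.trans (R.+-congˡ (coeff₀-sum {n} _ λ i → coeff₀-X* (X ^ toℕ i))) (R.+-identityʳ R.1#))

  module _ (R-domain : IsStableDomain R) where
    open IsStableDomain R-domain

    private
      drop-zero : ∀ {a p} → a R.≈ R.0# → ¬ a ∷ p ≈ [] → ¬ p ≈ []
      drop-zero a≈0 ap≉0 p≈0 = ap≉0 (≈-trans (a≈0 ∷-cong p≈0) shift-[])

      unshift : ∀ {p} → R.0# ∷ p ≈ [] → p ≈ []
      unshift e = equal λ n → at e (suc n)

      -- Negated goals, so that "a is zero or not" may be used freely.
      excluded-middle : ∀ (A : Set) {B : Set} → (A → ¬ B) → (¬ A → ¬ B) → ¬ B
      excluded-middle A pos neg b = neg (λ a → pos a b) b

      nonzero : ∀ p r → ¬ p ≈ [] → ¬ r ≈ [] → ¬ p * r ≈ []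
      nonzero []      r       p≉0 r≉0 = λ _ → p≉0 ≈-refl
      nonzero (a ∷ p) []      p≉0 r≉0 = λ _ → r≉0 ≈-refl
      nonzero (a ∷ p) (b ∷ r) p≉0 r≉0 = excluded-middle (a R.≈ R.0#)
        (λ a≈0 pr≈0 → nonzero p (b ∷ r) (drop-zero a≈0 p≉0) r≉0 (unshift
          (≈-trans (≈-sym (≈-trans
            (*-cong {a ∷ p} {R.0# ∷ p} {b ∷ r} (a≈0 ∷-cong ≈-refl) ≈-refl) (shift-* p (b ∷ r)))) pr≈0)))
        (λ a≉0 → excluded-middle (b R.≈ R.0#)
          (λ b≈0 pr≈0 → nonzero (a ∷ p) r p≉0 (drop-zero b≈0 r≉0) (unshift
            (≈-trans (≈-sym (≈-trans (*-∷ (a ∷ p) b r)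
              (+-cong (≈-trans (·-cong b≈0 ≈-refl) (0·p (a ∷ p))) ≈-refl))) pr≈0)))
          (λ b≉0 pr≈0 → noZeroDivisors a≉0 b≉0
            (R.trans (R.sym (R.+-identityʳ (a R.* b))) (at pr≈0 0))))

    polynomial-isStableDomain : IsStableDomain polynomialRing
    polynomial-isStableDomain = record
      { 1≉0            = λ e → 1≉0 (at e 0)
      ; noZeroDivisors = λ {p} {r} → nonzero p r
      ; ≈0-stable      = λ ¬¬e → equal λ n → ≈0-stable λ ¬e → ¬¬e λ e → ¬e (at e n)
      }

    [suc]ₓ≉0 : ∀ n → ¬ [ suc n ]ₓ ≈ []
    [suc]ₓ≉0 n e = 1≉0 (R.trans (R.sym (coeff₀-[suc]ₓ n)) (at e 0))

module FieldOfFractions (D : CommutativeRing 0ℓ 0ℓ) (D-domain : IsStableDomain D) where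
  open CommutativeRing D
  open IsStableDomain D-domain
  open import Algebra.Properties.Ring ring using (x[y-z]≈xy-xz; -‿distribˡ-*)
  open import Algebra.Properties.Group +-group using (x∙y⁻¹≈ε⇒x≈y; x≈y⇒x∙y⁻¹≈ε)
  open import Algebra.Properties.CommutativeSemigroup *-commutativeSemigroup
    using (interchange; x∙yz≈y∙xz; xy∙z≈xz∙y; x∙yz≈xz∙y)
  open import Relation.Binary.Reasoning.Setoid setoid

  record Fraction : Set where
    constructor _/_[_]
    field
      num   : Carrier
      den   : Carrier
      den≉0 : ¬ den ≈ 0#
  open Fraction public

  infix 4 _≃_
  record _≃_ (x y : Fraction) : Set where
    constructor cross
    field cross-equal : num x * den y ≈ num y * den x
  open _≃_ public

  fromDomain : Carrier → Fraction
  fromDomain a = a / 1# [ 1≉0 ]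

  infixl 6 _⊕_
  infixl 7 _⊗_
  infix  8 ⊖_

  _⊕_ : Fraction → Fraction → Fraction
  (a / b [ b≉0 ]) ⊕ (c / d [ d≉0 ]) = (a * d + c * b) / (b * d) [ noZeroDivisors b≉0 d≉0 ]

  _⊗_ : Fraction → Fraction → Fraction
  (a / b [ b≉0 ]) ⊗ (c / d [ d≉0 ]) = (a * c) / (b * d) [ noZeroDivisors b≉0 d≉0 ]

  ⊖_ : Fraction → Fraction
  ⊖ (a / b [ b≉0 ]) = (- a) / b [ b≉0 ]

  private
    cancel : ∀ {s x y} → ¬ s ≈ 0# → s * x ≈ s * y → x ≈ y
    cancel {s} {x} {y} s≉0 e = x∙y⁻¹≈ε⇒x≈y x y (≈0-stable λ ne →
      noZeroDivisors s≉0 ne (trans (x[y-z]≈xy-xz s x y) (x≈y⇒x∙y⁻¹≈ε e)))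

    ≃-trans : ∀ {x y z} → x ≃ y → y ≃ z → x ≃ z
    ≃-trans {a / b [ _ ]} {c / d [ d≉0 ]} {e / f [ _ ]} (cross ad≈cb) (cross cf≈ed) =
      cross (cancel d≉0 (begin
        d * (a * f)  ≈⟨ x∙yz≈y∙xz d a f ⟩
        a * (d * f)  ≈⟨ *-assoc a d f ⟨
        (a * d) * f  ≈⟨ *-congʳ ad≈cb ⟩
        (c * b) * f  ≈⟨ xy∙z≈xz∙y c b f ⟩
        (c * f) * b  ≈⟨ *-congʳ cf≈ed ⟩
        (e * d) * b  ≈⟨ xy∙z≈xz∙y e d b ⟩
        (e * b) * d  ≈⟨ *-comm (e * b) d ⟩
        d * (e * b)  ∎))

    ≃-reflexive : ∀ {a b c d b≉0 d≉0} → a ≈ c → b ≈ d → (a / b [ b≉0 ]) ≃ (c / d [ d≉0 ])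
    ≃-reflexive a≈c b≈d = cross (*-cong a≈c (sym b≈d))

    ⊕-cong : ∀ {x y u v} → x ≃ y → u ≃ v → x ⊕ u ≃ y ⊕ v
    ⊕-cong {a / b [ _ ]} {a′ / b′ [ _ ]} {c / d [ _ ]} {c′ / d′ [ _ ]} (cross e) (cross f) =
      cross (begin
        (a * d + c * b) * (b′ * d′)               ≈⟨ distribʳ (b′ * d′) (a * d) (c * b) ⟩
        a * d * (b′ * d′) + c * b * (b′ * d′)     ≈⟨ +-cong (interchange a d b′ d′) (*-congˡ (*-comm b′ d′)) ⟩
        a * b′ * (d * d′) + c * b * (d′ * b′)     ≈⟨ +-cong (*-cong e (*-comm d d′)) (interchange c b d′ b′) ⟩
        a′ * b * (d′ * d) + c * d′ * (b * b′)     ≈⟨ +-cong (interchange a′ b d′ d) (*-cong f (*-comm b b′)) ⟩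
        a′ * d′ * (b * d) + c′ * d * (b′ * b)     ≈⟨ +-congˡ (interchange c′ d b′ b) ⟩
        a′ * d′ * (b * d) + c′ * b′ * (d * b)     ≈⟨ +-congˡ (*-congˡ (*-comm d b)) ⟩
        a′ * d′ * (b * d) + c′ * b′ * (b * d)     ≈⟨ distribʳ (b * d) (a′ * d′) (c′ * b′) ⟨
        (a′ * d′ + c′ * b′) * (b * d)             ∎)

    ⊗-cong : ∀ {x y u v} → x ≃ y → u ≃ v → x ⊗ u ≃ y ⊗ v
    ⊗-cong {a / b [ _ ]} {a′ / b′ [ _ ]} {c / d [ _ ]} {c′ / d′ [ _ ]} (cross e) (cross f) =
      cross (begin
        (a * c) * (b′ * d′)   ≈⟨ interchange a c b′ d′ ⟩
        (a * b′) * (c * d′)   ≈⟨ *-cong e f ⟩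
        (a′ * b) * (c′ * d)   ≈⟨ interchange a′ b c′ d ⟩
        (a′ * c′) * (b * d)   ∎)

    ⊖-cong : ∀ {x y} → x ≃ y → ⊖ x ≃ ⊖ y
    ⊖-cong {a / b [ _ ]} {c / d [ _ ]} (cross e) = cross (begin
      - a * d      ≈⟨ -‿distribˡ-* a d ⟨
      - (a * d)    ≈⟨ -‿cong e ⟩
      - (c * b)    ≈⟨ -‿distribˡ-* c b ⟩
      - c * b      ∎)

    ⊕-assoc : ∀ x y z → (x ⊕ y) ⊕ z ≃ x ⊕ (y ⊕ z)
    ⊕-assoc (a / b [ _ ]) (c / d [ _ ]) (e / f [ _ ]) = ≃-reflexive (begin
      (a * d + c * b) * f + e * (b * d)         ≈⟨ +-congʳ (distribʳ f (a * d) (c * b)) ⟩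
      a * d * f + c * b * f + e * (b * d)       ≈⟨ +-assoc _ _ _ ⟩
      a * d * f + (c * b * f + e * (b * d))
        ≈⟨ +-cong (*-assoc a d f) (+-cong (xy∙z≈xz∙y c b f) (x∙yz≈xz∙y e b d)) ⟩
      a * (d * f) + (c * f * b + e * d * b)     ≈⟨ +-congˡ (distribʳ b (c * f) (e * d)) ⟨
      a * (d * f) + (c * f + e * d) * b         ∎)
      (*-assoc b d f)

    ⊕-comm : ∀ x y → x ⊕ y ≃ y ⊕ x
    ⊕-comm (a / b [ _ ]) (c / d [ _ ]) = ≃-reflexive (+-comm (a * d) (c * b)) (*-comm b d)

    ⊕-identityˡ : ∀ x → fromDomain 0# ⊕ x ≃ x
    ⊕-identityˡ (a / b [ _ ]) = ≃-reflexive
      (trans (+-cong (zeroˡ b) (*-identityʳ a)) (+-identityˡ a)) (*-identityˡ b)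

    ⊕-inverseˡ : ∀ x → ⊖ x ⊕ x ≃ fromDomain 0#
    ⊕-inverseˡ (a / b [ _ ]) = cross (begin
      (- a * b + a * b) * 1#  ≈⟨ *-congʳ (distribʳ b (- a) a) ⟨
      (- a + a) * b * 1#      ≈⟨ *-congʳ (*-congʳ (-‿inverseˡ a)) ⟩
      0# * b * 1#             ≈⟨ *-congʳ (zeroˡ b) ⟩
      0# * 1#                 ≈⟨ zeroˡ 1# ⟩
      0#                      ≈⟨ zeroˡ (b * b) ⟨
      0# * (b * b)            ∎)

    ⊗-assoc : ∀ x y z → (x ⊗ y) ⊗ z ≃ x ⊗ (y ⊗ z)
    ⊗-assoc (a / b [ _ ]) (c / d [ _ ]) (e / f [ _ ]) =
      ≃-reflexive (*-assoc a c e) (*-assoc b d f)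

    ⊗-comm : ∀ x y → x ⊗ y ≃ y ⊗ x
    ⊗-comm (a / b [ _ ]) (c / d [ _ ]) = ≃-reflexive (*-comm a c) (*-comm b d)

    ⊗-identityˡ : ∀ x → fromDomain 1# ⊗ x ≃ x
    ⊗-identityˡ (a / b [ _ ]) = ≃-reflexive (*-identityˡ a) (*-identityˡ b)

    ⊗-distribʳ-⊕ : ∀ x y z → (y ⊕ z) ⊗ x ≃ y ⊗ x ⊕ z ⊗ x
    ⊗-distribʳ-⊕ (a / b [ _ ]) (c / d [ _ ]) (e / f [ _ ]) = cross (begin
      (c * f + e * d) * a * (d * b * (f * b))
        ≈⟨ *-congˡ (interchange d b f b) ⟩
      (c * f + e * d) * a * (d * f * (b * b))
        ≈⟨ x∙yz≈xz∙y _ (d * f) (b * b) ⟩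
      (c * f + e * d) * a * (b * b) * (d * f)
        ≈⟨ *-congʳ (interchange (c * f + e * d) a b b) ⟩
      (c * f + e * d) * b * (a * b) * (d * f)
        ≈⟨ *-congʳ (xy∙z≈xz∙y _ b (a * b)) ⟩
      (c * f + e * d) * (a * b) * b * (d * f)
        ≈⟨ *-assoc _ b (d * f) ⟩
      (c * f + e * d) * (a * b) * (b * (d * f))
        ≈⟨ *-cong (distribʳ (a * b) (c * f) (e * d)) (*-comm b (d * f)) ⟩
      (c * f * (a * b) + e * d * (a * b)) * (d * f * b)
        ≈⟨ *-congʳ (+-cong (interchange c f a b) (interchange e d a b)) ⟩
      (c * a * (f * b) + e * a * (d * b)) * (d * f * b)  ∎)

  fractionRing : CommutativeRing 0ℓ 0ℓ
  fractionRing = record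
    { Carrier = Fraction ; _≈_ = _≃_ ; _+_ = _⊕_ ; _*_ = _⊗_ ; -_ = ⊖_
    ; 0# = fromDomain 0# ; 1# = fromDomain 1#
    ; isCommutativeRing = record
      { isRing = record
        { +-isAbelianGroup = record
          { isGroup = record
            { isMonoid = record
              { isSemigroup = record
                { isMagma = record
                  { isEquivalence = record
                    { refl  = cross refl
                    ; sym   = λ e → cross (sym (cross-equal e))
                    ; trans = ≃-trans
                    }
                  ; ∙-cong = ⊕-cong
                  }
                ; assoc = ⊕-assoc
                }
              ; identity = ⊕-identityˡ
                         , λ x → ≃-trans (⊕-comm x (fromDomain 0#)) (⊕-identityˡ x)
              }
            ; inverse = ⊕-inverseˡ , λ x → ≃-trans (⊕-comm x (⊖ x)) (⊕-inverseˡ x)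
            ; ⁻¹-cong = ⊖-cong
            }
          ; comm = ⊕-comm
          }
        ; *-cong = ⊗-cong
        ; *-assoc = ⊗-assoc
        ; *-identity = ⊗-identityˡ
                     , λ x → ≃-trans (⊗-comm x (fromDomain 1#)) (⊗-identityˡ x)
        ; distrib = (λ x y z → ≃-trans (⊗-comm x (y ⊕ z))
                      (≃-trans (⊗-distribʳ-⊕ x y z) (⊕-cong (⊗-comm y x) (⊗-comm z x))))
                  , ⊗-distribʳ-⊕
        }
      ; *-comm = ⊗-comm
      }
    }

module ℝ[q] = Polynomial Real.ℝ-commutativeRing

module ℝ⟨q⟩ = FieldOfFractions ℝ[q].polynomialRing
  (ℝ[q].polynomial-isStableDomain Real.ℝ-isStableDomain)

record FinitePoset : Set₁ where
  field
    decPoset    : DecPoset 0ℓ 0ℓ 0ℓ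
    size        : ℕ
    enumeration : Inverse (≡.setoid (Fin size)) (DecPoset.Eq.setoid decPoset)

  open DecPoset decPoset public
  open Relation.Binary.Properties.Poset poset public using (_<_)

  element : Fin size → Carrier
  element = Inverse.to enumeration

  MinimalIn MaximalIn : Pred Carrier 0ℓ → Pred Carrier 0ℓ
  MinimalIn S x = S x × (∀ y → S y → y ≤ x → y ≈ x)
  MaximalIn S x = S x × (∀ y → S y → x ≤ y → x ≈ y)

  infix 4 _⋖_
  _⋖_ : Carrier → Carrier → Set
  x ⋖ y = x < y × (∀ z → ¬ (x < z × z < y))

  record IsRankFunction (rk : Carrier → ℕ) : Set where
    field
      cong      : ∀ {x y} → x ≈ y → rk x ≡ rk y
      minimal⇒0 : ∀ {x} → MinimalIn U x → rk x ≡ 0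
      cover⇒suc : ∀ {x y} → x ⋖ y → rk y ≡ suc (rk x)

  maximum : (Carrier → ℕ) → ℕ
  maximum f = Vector.foldr ℕ._⊔_ 0 (f ∘ element)

  record OrderIdeal : Set₁ where
    field
      Member     : Pred Carrier 0ℓ
      member?    : Decidable Member
      downClosed : ∀ {x y} → x ≤ y → Member y → Member x

  open OrderIdeal public

  private
    all? : ∀ {S : Pred Carrier 0ℓ} → S Respects _≈_ → Decidable S → Dec (∀ x → S x)
    all? {S} resp S? = Dec.map′
      (λ h x → resp (Inverse.inverseˡ enumeration ≡.refl) (h (Inverse.from enumeration x)))
      (λ h i → h (element i))
      (Fin.all? (S? ∘ element))

    respects : ∀ (I : OrderIdeal) → Member I Respects _≈_
    respects I x≈y = downClosed I (reflexive (Eq.sym x≈y))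

  minimalOutside? : ∀ I → Decidable (MinimalIn (∁ (Member I)))
  minimalOutside? I x = ¬? (member? I x) ×-dec
    all? (λ y≈z h z∉I z≤x → Eq.trans (Eq.sym y≈z)
            (h (z∉I ∘ respects I y≈z) (trans (reflexive y≈z) z≤x)))
         (λ y → ¬? (member? I y) →-dec (y ≤? x →-dec y ≟ x))

  maximalInside? : ∀ I → Decidable (MaximalIn (Member I))
  maximalInside? I x = member? I x ×-dec
    all? (λ y≈z h z∈I x≤z → Eq.trans
            (h (respects I (Eq.sym y≈z) z∈I) (trans x≤z (reflexive (Eq.sym y≈z)))) y≈z)
         (λ y → member? I y →-dec (x ≤? y →-dec x ≟ y))

module Toggleability
  (P : FinitePoset) (F : CommutativeRing 0ℓ 0ℓ) (q : CommutativeRing.Carrier F) where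
  open FinitePoset P using (OrderIdeal; element; size; minimalOutside?; maximalInside?)
    renaming (Carrier to ∣P∣)
  open CommutativeRing F
  open Algebra.Definitions.RawMonoid +-rawMonoid using (sum)

  Statistic : Set₁
  Statistic = OrderIdeal → Carrier

  ∑ₚ : (∣P∣ → Carrier) → Carrier
  ∑ₚ f = sum (f ∘ element)

  T⁺ T⁻ T^q : ∣P∣ → Statistic
  T⁺ p I = if does (minimalOutside? I p) then 1# else 0#
  T⁻ p I = if does (maximalInside? I p) then 1# else 0#
  T^q p I = T⁺ p I - q * T⁻ p I

  ∑T⁻ : Statistic
  ∑T⁻ I = ∑ₚ λ p → T⁻ p I

  infix 4 _≡^q_
  _≡^q_ : Statistic → Statistic → Set₁
  f ≡^q g = Σ[ c ∈ (∣P∣ → Carrier) ] ∀ I → f I - g I ≈ ∑ₚ λ p → c p * T^q p I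

-- Toggleability statistics of P over ℝ(q).
module Statistics (P : FinitePoset) where
  open FinitePoset P using (Carrier; element)
  open CommutativeRing ℝ[q].polynomialRing using (+-rawMonoid)
  open Algebra.Definitions.RawMonoid +-rawMonoid using (sum)
  open Toggleability P ℝ⟨q⟩.fractionRing (ℝ⟨q⟩.fromDomain ℝ[q].X) public

  rankGeneratingFunction : (Carrier → ℕ) → ℝ[q].Poly
  rankGeneratingFunction rk = sum λ i → ℝ[q].X ℝ[q].^ rk (element i)

infix 4 _≅_
_≅_ : Poset 0ℓ 0ℓ 0ℓ → Poset 0ℓ 0ℓ 0ℓ → Set
P ≅ Q = ∃ (IsOrderIsomorphism P._≈_ Q._≈_ P._≤_ Q._≤_)
  where
  module P = Poset P
  module Q = Poset Q

chain : ℕ → Poset 0ℓ 0ℓ 0ℓ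
chain = Fin.≤-poset

rectangle : ℕ → ℕ → Poset 0ℓ 0ℓ 0ℓ
rectangle a b = ×-poset (chain a) (chain b)

shiftedStaircase : ℕ → Poset 0ℓ 0ℓ 0ℓ
shiftedStaircase n = On.poset {B = Σ[ (i , j) ∈ Fin n × Fin n ] i Fin.≤ j} (rectangle n n) proj₁

ordinalSum : Poset 0ℓ 0ℓ 0ℓ → Poset 0ℓ 0ℓ 0ℓ → Poset 0ℓ 0ℓ 0ℓ
ordinalSum = ⊎-<-poset {d = 0ℓ} {e = 0ℓ} {f = 0ℓ}

-- The xᵢ below the antichain {y₁, y₂} below the zᵢ, which decrease with i.
doubleTailedDiamond : ℕ → Poset 0ℓ 0ℓ 0ℓ
doubleTailedDiamond n = ordinalSum xs (ordinalSum ys zs)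
  where
  xs = chain (n ℕ.∸ 1)
  ys = ≡.poset Bool
  zs = Flip.poset (chain (n ℕ.∸ 1))

DynkinDiagram : ℕ → Set
DynkinDiagram n = List (Fin n × Fin n)

-- Simply laced root systems, with roots given by their coordinates in the simple roots.
module RootSystem {n : ℕ} (edges : DynkinDiagram n) where
  open Data.List.Membership.DecPropositional
    (Product.≡-dec (Fin._≟_ {n}) (Fin._≟_ {n})) using (_∈?_)

  cartan : Fin n → Fin n → ℤ
  cartan i j =
    if does (i Fin.≟ j) then ℤ.+ 2
    else if does ((i , j) ∈? edges ⊎-dec (j , i) ∈? edges) then -1ℤ
    else 0ℤ

  RootVector : Set
  RootVector = Vec ℤ n

  simpleRoot : Fin n → RootVector
  simpleRoot j = replicate n 0ℤ [ j ]≔ 1ℤ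

  -- ⟨ β , αⱼ^∨ ⟩
  pairing : RootVector → Fin n → ℤ
  pairing β j = Vector.foldr ℤ._+_ 0ℤ λ i → lookup β i ℤ.* cartan i j

  reflect : Fin n → RootVector → RootVector
  reflect j β = β [ j ]%= (ℤ._- pairing β j)

  -- The orbit of the simple roots under the Weyl group.
  data IsRoot : RootVector → Set where
    simple    : ∀ j → IsRoot (simpleRoot j)
    reflected : ∀ j {β} → IsRoot β → IsRoot (reflect j β)

  -- β ≤ γ when γ - β is a nonnegative integer combination of simple roots.
  rootOrder : Poset 0ℓ 0ℓ 0ℓ
  rootOrder = record
    { Carrier = RootVector
    ; _≈_ = _≡_
    ; _≤_ = Pointwise.Pointwise ℤ._≤_
    ; isPartialOrder = record
      { isPreorder = record
        { isEquivalence = ≡.isEquivalence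
        ; reflexive     = λ { ≡.refl → Pointwise.refl ℤ.≤-refl }
        ; trans         = Pointwise.trans ℤ.≤-trans
        }
      ; antisym = antisym
      }
    }
    where
    antisym : ∀ {m} {β γ : Vec ℤ m} →
              Pointwise.Pointwise ℤ._≤_ β γ → Pointwise.Pointwise ℤ._≤_ γ β → β ≡ γ
    antisym Pointwise.[]       Pointwise.[]       = ≡.refl
    antisym (p Pointwise.∷ ps) (r Pointwise.∷ rs) = ≡.cong₂ Vec._∷_ (ℤ.≤-antisym p r) (antisym ps rs)

  IsPositiveRoot : RootVector → Set
  IsPositiveRoot β = IsRoot β × ∀ i → 0ℤ ℤ.≤ lookup β i

  -- The positive roots whose support contains the node m.
  minusculePoset : Fin n → Poset 0ℓ 0ℓ 0ℓ
  minusculePoset m = On.poset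
    {B = Σ[ β ∈ RootVector ] IsPositiveRoot β × 0ℤ ℤ.< lookup β m} rootOrder proj₁

-- Bourbaki numbering, shifted to start at 0.
E₆ : DynkinDiagram 6
E₆ = (0F , 2F) ∷ (2F , 3F) ∷ (3F , 4F) ∷ (4F , 5F) ∷ (1F , 3F) ∷ []

E₇ : DynkinDiagram 7
E₇ = (0F , 2F) ∷ (2F , 3F) ∷ (3F , 4F) ∷ (4F , 5F) ∷ (5F , 6F) ∷ (1F , 3F) ∷ []

-- The other minuscule node 5F of E₆ gives an isomorphic poset.
Λ-E₆ Λ-E₇ : Poset 0ℓ 0ℓ 0ℓ
Λ-E₆ = RootSystem.minusculePoset E₆ 0F
Λ-E₇ = RootSystem.minusculePoset E₇ 6F

data IsMinuscule (P : Poset 0ℓ 0ℓ 0ℓ) : Set where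
  is-rectangle           : ∀ a b → 1 ℕ.≤ a → 1 ℕ.≤ b → P ≅ rectangle a b → IsMinuscule P
  is-shiftedStaircase    : ∀ n → 1 ℕ.≤ n → P ≅ shiftedStaircase n → IsMinuscule P
  is-doubleTailedDiamond : ∀ n → 2 ℕ.≤ n → P ≅ doubleTailedDiamond n → IsMinuscule P
  is-Λ-E₆                : P ≅ Λ-E₆ → IsMinuscule P
  is-Λ-E₇                : P ≅ Λ-E₇ → IsMinuscule P

{-# OPTIONS --safe #-}
module Submission where

-- Every minuscule poset is a planar distributive lattice: it embeds in ℕ × ℕ as a region between
-- two monotone boundaries, with covers the unit steps and rank the height i + j.  Suppose a, b on
-- the cells satisfy a + q b = d.  Writing T⁻ and T⁺ through the indicators of membership in the
-- ideal, ∑ (a T⁻ + b T⁺) becomes linear once a z + b (z + (1,1)) = 0 on every unit square, and it is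
-- the constant b (0,0) if moreover the coefficient of each indicator vanishes.  Dividing by d gives
-- ∑ T⁻ ≡^q b (0,0) / d.  Such a, b exist explicitly for each family.
--
-- The value of the constant need not be computed case by case: adding up the constancy for the ideals
-- {height ≤ rank − s} with weights qˢ gives [rank + 2] b (0,0) = d ∑ q^(rank − height), and the region has
-- a height-reversing symmetry.

open import Defs
open import Algebra.Bundles using (CommutativeRing)
import Algebra.Definitions.RawMonoid
import Algebra.Properties.AbelianGroup
import Algebra.Properties.CommutativeSemigroup
import Algebra.Properties.Ring
import Algebra.Properties.Semiring.Exp
import Algebra.Properties.Semiring.Mult.TCOptimised
import Algebra.Properties.Semiring.Sum
import Algebra.Solver.Ring
open import Algebra.Solver.Ring.AlmostCommutativeRing using (_-Raw-AlmostCommutative⟶_; fromCommutativeRing)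
open import Data.Bool.Base using (Bool; true; false; if_then_else_; not; _∧_; _∨_; T)
import Data.Bool.Properties as Bool
open import Data.Fin.Base as Fin using (Fin; toℕ; fromℕ<)
open import Data.Fin.Patterns
import Data.Fin.Properties as Fin
open import Data.Integer.Base as ℤ using (ℤ; +_; -[1+_]; _⊖_; 0ℤ; 1ℤ; -1ℤ)
import Data.Integer.Properties as ℤ
open import Data.List.Base as List using (List; []; _∷_; _++_)
open import Data.List.Membership.Propositional using (_∈_)
open import Data.List.Relation.Unary.All as All using (All)
open import Data.List.Relation.Unary.Any as Any using ()
open import Data.Maybe.Base as Maybe using (Maybe; just; nothing)
open import Data.Maybe.Properties using (just-injective)
open import Data.Nat.Base as ℕ using (ℕ; zero; suc; _≤_; _<_; z≤n; s≤s; _∸_)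
open import Data.Nat.Properties as ℕ using (_≤?_; ≤-refl; ≤-trans)
open import Data.Product.Base using (_×_; _,_; _,′_; ∃-syntax; proj₁; proj₂)
import Data.Product.Properties as Product
open import Data.Sum.Base using (_⊎_; inj₁; inj₂)
open import Data.Sum.Relation.Binary.LeftOrder using (₁∼₂; ₁∼₁; ₂∼₂)
open import Data.Vec.Base as Vec using (Vec; []; _∷_)
import Data.Vec.Functional as Vector
import Data.Vec.Properties as Vec
import Data.Vec.Relation.Binary.Pointwise.Inductive as Pointwise
open import Function.Base using (_∘_; case_of_)
open import Function.Bundles using (Inverse)
open import Level using (0ℓ)
open import Relation.Binary.Bundles using (Poset)
open import Relation.Binary.Definitions using (DecidableEquality)
open import Relation.Binary.Morphism.Structures using (IsOrderIsomorphism)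
open import Relation.Binary.PropositionalEquality as ≡ using (_≡_; _≢_; cong; cong₂; subst)
open import Relation.Nullary.Decidable
  using (Dec; yes; no; does; dec-true; dec-false; dec⇒maybe; True; toWitness; map′; _×-dec_; _→-dec_)
open import Relation.Nullary.Negation.Core using (¬_; contradiction)
open import Relation.Unary using (Pred; Decidable)

-- Planarity keeps the nonlinearity small. A cell has at most two lower and two upper neighbours, so
-- the only product of indicators that appears is the one over the antidiagonal of a unit square,
-- and it occurs just twice: in T⁻ of the bottom corner and in T⁺ of the top corner. Hence one
-- equation per square is enough. The weights can be guessed from the interior equations. There a z
-- = - b (z + (1,1)), and the vanishing of the coefficient of z says that the mixed second
-- difference of b is zero, so b is a sum f i + g j; then a + q b = d makes f and g affine in q^i
-- and q^j. The boundary fixes what is left. For the diamond the equations can be followed along its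
-- two chains, and for E₆ and E₇ a table of solutions is verified. The only division needed is by d,
-- and each d divides a product of elements 1 - q^k. So everything up to the last step holds over
-- any commutative ring where all 1 - q^k with k ≥ 1 are invertible.

module IntegerCoefficients (K : CommutativeRing 0ℓ 0ℓ) where
  open CommutativeRing K
  open Algebra.Properties.Ring ring using (-‿distribˡ-*; -0#≈0#)
  open Algebra.Properties.AbelianGroup +-abelianGroup using (⁻¹-∙-comm; ⁻¹-involutive)
  open Algebra.Properties.CommutativeSemigroup +-commutativeSemigroup using (interchange)
  open Algebra.Properties.Semiring.Mult.TCOptimised semiring
    using (×-homo-+; ×1-homo-*; 1+×) renaming (_×_ to _⊠_)
  open import Relation.Binary.Reasoning.Setoid setoid

  -- The canonical homomorphism from ℤ. Equality in an abstract ring cannot be decided, but integer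
  -- coefficients can be compared, so normal forms over ℤ still compute.
  ι : ℤ → Carrier
  ι (+ n)    = n ⊠ 1#
  ι -[1+ n ] = - (suc n ⊠ 1#)

  ι-⊖ : ∀ m n → ι (m ⊖ n) ≈ m ⊠ 1# - n ⊠ 1#
  ι-⊖ m       zero    = sym (trans (+-congˡ -0#≈0#) (+-identityʳ (m ⊠ 1#)))
  ι-⊖ zero    (suc n) = sym (+-identityˡ _)
  ι-⊖ (suc m) (suc n) = begin
    ι (suc m ⊖ suc n)                        ≡⟨ cong ι (ℤ.[1+m]⊖[1+n]≡m⊖n m n) ⟩
    ι (m ⊖ n)                                ≈⟨ ι-⊖ m n ⟩
    m ⊠ 1# - n ⊠ 1#                          ≈⟨ +-identityˡ _ ⟨
    0# + (m ⊠ 1# - n ⊠ 1#)                   ≈⟨ +-congʳ (-‿inverseʳ 1#) ⟨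
    (1# - 1#) + (m ⊠ 1# - n ⊠ 1#)            ≈⟨ interchange _ _ _ _ ⟩
    (1# + m ⊠ 1#) + (- 1# - n ⊠ 1#)          ≈⟨ +-congˡ (⁻¹-∙-comm 1# (n ⊠ 1#)) ⟩
    (1# + m ⊠ 1#) - (1# + n ⊠ 1#)            ≈⟨ +-cong (1+× m 1#) (-‿cong (1+× n 1#)) ⟨
    suc m ⊠ 1# - suc n ⊠ 1#                  ∎

  ι-+ : ∀ i j → ι (i ℤ.+ j) ≈ ι i + ι j
  ι-+ (+ m)    (+ n)    = ×-homo-+ 1# m n
  ι-+ (+ m)    -[1+ n ] = ι-⊖ m (suc n)
  ι-+ -[1+ m ] (+ n)    = trans (ι-⊖ n (suc m)) (+-comm _ _)
  ι-+ -[1+ m ] -[1+ n ] = begin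
    - (suc (suc (m ℕ.+ n)) ⊠ 1#)             ≡⟨ cong (λ k → - (suc k ⊠ 1#)) (ℕ.+-suc m n) ⟨
    - ((suc m ℕ.+ suc n) ⊠ 1#)               ≈⟨ -‿cong (×-homo-+ 1# (suc m) (suc n)) ⟩
    - (suc m ⊠ 1# + suc n ⊠ 1#)              ≈⟨ ⁻¹-∙-comm _ _ ⟨
    - (suc m ⊠ 1#) - suc n ⊠ 1#              ∎

  ι-neg : ∀ i → ι (ℤ.- i) ≈ - ι i
  ι-neg (+ zero)  = sym -0#≈0#
  ι-neg (+ suc n) = refl
  ι-neg -[1+ n ]  = sym (⁻¹-involutive _)

  ι-+* : ∀ m j → ι (+ m ℤ.* j) ≈ ι (+ m) * ι j
  ι-+* m (+ n)    = trans (reflexive (cong ι (≡.sym (ℤ.pos-* m n)))) (×1-homo-* m n)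
  ι-+* m -[1+ n ] = begin
    ι (+ m ℤ.* -[1+ n ])               ≡⟨ cong ι (ℤ.*-comm (+ m) -[1+ n ]) ⟩
    ι (ℤ.- (+ suc n) ℤ.* + m)          ≡⟨ cong ι (ℤ.neg-distribˡ-* (+ suc n) (+ m)) ⟨
    ι (ℤ.- (+ suc n ℤ.* + m))          ≈⟨ ι-neg (+ suc n ℤ.* + m) ⟩
    - ι (+ suc n ℤ.* + m)              ≈⟨ -‿cong (ι-+* (suc n) (+ m)) ⟩
    - (ι (+ suc n) * ι (+ m))          ≈⟨ -‿distribˡ-* _ _ ⟩
    - ι (+ suc n) * ι (+ m)            ≈⟨ *-comm _ _ ⟩
    ι (+ m) * ι -[1+ n ]               ∎

  ι-* : ∀ i j → ι (i ℤ.* j) ≈ ι i * ι j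
  ι-* (+ m)    j = ι-+* m j
  ι-* -[1+ m ] j = begin
    ι (ℤ.- (+ suc m) ℤ.* j)            ≡⟨ cong ι (ℤ.neg-distribˡ-* (+ suc m) j) ⟨
    ι (ℤ.- (+ suc m ℤ.* j))            ≈⟨ ι-neg (+ suc m ℤ.* j) ⟩
    - ι (+ suc m ℤ.* j)                ≈⟨ -‿cong (ι-+* (suc m) j) ⟩
    - (ι (+ suc m) * ι j)              ≈⟨ -‿distribˡ-* _ _ ⟩
    - ι (+ suc m) * ι j                ∎

  ι-homomorphism : ℤ.+-*-rawRing -Raw-AlmostCommutative⟶ fromCommutativeRing K
  ι-homomorphism = record
    { ⟦_⟧ = ι ; +-homo = ι-+ ; *-homo = ι-* ; -‿homo = ι-neg ; 0-homo = refl ; 1-homo = refl }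

  ι-≟ : ∀ i j → Maybe (ι i ≈ ι j)
  ι-≟ i j = Maybe.map (λ i≡j → reflexive (cong ι i≡j)) (dec⇒maybe (i ℤ.≟ j))

  open Algebra.Solver.Ring ℤ.+-*-rawRing (fromCommutativeRing K) ι-homomorphism ι-≟ public

-- Planar regions and their unit steps.

Cell : Set
Cell = ℕ × ℕ

infix 4 _≟ᶜ_ _⊑_
_≟ᶜ_ : DecidableEquality Cell
_≟ᶜ_ = Product.≡-dec ℕ._≟_ ℕ._≟_

_⊑_ : Cell → Cell → Set
(i , j) ⊑ (k , l) = i ≤ k × j ≤ l

height : Cell → ℕ
height (i , j) = i ℕ.+ j

infix 8 _↑₁ _↑₂ _↑₁₂ _↓₁ _↓₂ _↓₁₂
_↑₁ _↑₂ _↑₁₂ : Cell → Cell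
(i , j) ↑₁  = suc i , j
(i , j) ↑₂  = i , suc j
(i , j) ↑₁₂ = suc i , suc j

_↓₁ _↓₂ _↓₁₂ : Cell → Maybe Cell
(zero  , j) ↓₁ = nothing
(suc i , j) ↓₁ = just (i , j)
(i , zero)  ↓₂ = nothing
(i , suc j) ↓₂ = just (i , j)
(suc i , suc j) ↓₁₂ = just (i , j)
(zero  , _)     ↓₁₂ = nothing
(suc i , zero)  ↓₁₂ = nothing

⊑-antisym : ∀ {z w} → z ⊑ w → w ⊑ z → z ≡ w
⊑-antisym (p , q) (r , s) = cong₂ _,_ (ℕ.≤-antisym p r) (ℕ.≤-antisym q s)

⊑-reflexive : ∀ {z w} → z ≡ w → z ⊑ w
⊑-reflexive ≡.refl = ℕ.≤-refl , ℕ.≤-refl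

height-mono : ∀ {z w} → z ⊑ w → height z ≤ height w
height-mono (p , q) = ℕ.+-mono-≤ p q

height-mono-≢ : ∀ {z w} → z ⊑ w → z ≢ w → height z < height w
height-mono-≢ {i , j} {k , l} (p , q) z≢w = case ℕ.m≤n⇒m<n∨m≡n p of λ where
  (inj₁ i<k) → ℕ.+-mono-<-≤ i<k q
  (inj₂ i≡k) → ℕ.+-mono-≤-< p (ℕ.≤∧≢⇒< q λ j≡l → z≢w (cong₂ _,_ i≡k j≡l))

height-≥⇒≡ : ∀ {z w} → z ⊑ w → height w ≤ height z → z ≡ w
height-≥⇒≡ {z} {w} z⊑w h = case z ≟ᶜ w of λ where
  (yes z≡w) → z≡w
  (no z≢w)  → contradiction (ℕ.<-≤-trans (height-mono-≢ z⊑w z≢w) h) (ℕ.<-irrefl ≡.refl)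

⊑-↑₁ : ∀ z → z ⊑ z ↑₁
⊑-↑₁ z = ℕ.n≤1+n _ , ℕ.≤-refl

⊑-↑₂ : ∀ z → z ⊑ z ↑₂
⊑-↑₂ z = ℕ.≤-refl , ℕ.n≤1+n _

-- Monotone boundaries with overlapping rows make the cells a sublattice of ℕ × ℕ with unit steps as covers.
record Region : Set where
  field
    last    : ℕ
    lo hi   : ℕ → ℕ
    lo-0    : lo 0 ≡ 0
    lo-step : ∀ {i} → i < last → lo i ≤ lo (suc i)
    hi-step : ∀ {i} → i < last → hi i ≤ hi (suc i)
    overlaps : ∀ {i} → i < last → lo (suc i) ≤ hi i

  In : Cell → Set
  In (i , j) = i ≤ last × lo i ≤ j × j ≤ hi i

  In? : ∀ z → Dec (In z)
  In? (i , j) = i ≤? last ×-dec lo i ≤? j ×-dec j ≤? hi i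

  private
    mono : (f : ℕ → ℕ) → (∀ {i} → i < last → f i ≤ f (suc i)) →
           ∀ {i k} → i ≤ k → k ≤ last → f i ≤ f k
    mono f step {i} {k} i≤k k≤l with ℕ.m≤n⇒m<n∨m≡n i≤k
    ... | inj₂ ≡.refl = ≤-refl
    mono f step {i} {suc k} _ k<l | inj₁ (s≤s i≤k) =
      ≤-trans (mono f step i≤k (ℕ.<⇒≤ k<l)) (step k<l)

  lo-mono : ∀ {i k} → i ≤ k → k ≤ last → lo i ≤ lo k
  lo-mono = mono lo lo-step

  hi-mono : ∀ {i k} → i ≤ k → k ≤ last → hi i ≤ hi k
  hi-mono = mono hi hi-step

  bottom top : Cell
  bottom = 0 , 0
  top    = last , hi last

  rank : ℕ
  rank = height top

  lo≤hi : ∀ {i} → i ≤ last → lo i ≤ hi i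
  lo≤hi {zero}  _   = subst (_≤ hi 0) (≡.sym lo-0) z≤n
  lo≤hi {suc i} i<l = ≤-trans (overlaps i<l) (hi-step i<l)

  bottom∈ : In bottom
  bottom∈ = z≤n , ℕ.≤-reflexive lo-0 , z≤n

  top∈ : In top
  top∈ = ≤-refl , lo≤hi ≤-refl , ≤-refl

  ⊑-top : ∀ {z} → In z → z ⊑ top
  ⊑-top (i≤ , _ , ≤hi) = i≤ , ≤-trans ≤hi (hi-mono i≤ ≤-refl)

  -- Let z lie in a lower row than w. If `z ↑₁` is missing, then j < lo (suc i) ≤ hi i by
  -- `overlaps`, so `z ↑₂` is in the region and still below w. Covers are therefore exactly the unit
  -- steps.
  step-up : ∀ {z w} → In z → In w → z ⊑ w → z ≢ w →
            In (z ↑₁) × z ↑₁ ⊑ w ⊎ In (z ↑₂) × z ↑₂ ⊑ w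
  step-up {i , j} {k , l} (i≤ , lo≤j , j≤hi) (k≤ , lo≤l , l≤hi) (i≤k , j≤l) z≢w
    with ℕ.m≤n⇒m<n∨m≡n i≤k
  ... | inj₂ ≡.refl = inj₂ ((i≤ , ℕ.m≤n⇒m≤1+n lo≤j , ≤-trans j<l l≤hi) , ≤-refl , j<l)
    where j<l = ℕ.≤∧≢⇒< j≤l λ j≡l → z≢w (cong (i ,_) j≡l)
  ... | inj₁ i<k with lo (suc i) ≤? j
  ...   | yes lo≤ = inj₁ ((i<last , lo≤ , ≤-trans j≤hi (hi-step i<last)) , i<k , j≤l)
    where i<last = ≤-trans i<k k≤
  ...   | no  lo≰ = inj₂ ((i≤ , ℕ.m≤n⇒m≤1+n lo≤j , ≤-trans j<lo (overlaps i<last)) ,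
                         i≤k , ≤-trans j<lo (≤-trans (lo-mono i<k k≤) lo≤l))
    where
    i<last = ≤-trans i<k k≤
    j<lo = ℕ.≰⇒> lo≰

  -- Indexed by the upper cell, so that a match exposes it as `w ↑₁` or `w ↑₂` and the partial maps
  -- `_↓₁` and `_↓₂` compute on it.
  data StepDown (z : Cell) : Cell → Set where
    down₁ : ∀ {w} → In w → z ⊑ w → StepDown z (w ↑₁)
    down₂ : ∀ {w} → In w → z ⊑ w → StepDown z (w ↑₂)

  step-down : ∀ {z w} → In z → In w → z ⊑ w → z ≢ w → StepDown z w
  step-down {i , j} {k , l} (i≤ , lo≤j , j≤hi) (k≤ , lo≤l , l≤hi) (i≤k , j≤l) z≢w
    with ℕ.m≤n⇒m<n∨m≡n i≤k
  step-down {i , j} {i , l} (i≤ , lo≤j , j≤hi) (k≤ , lo≤l , l≤hi) (i≤k , j≤l) z≢w | inj₂ ≡.refl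
    with ℕ.≤∧≢⇒< j≤l (λ j≡l → z≢w (cong (i ,_) j≡l))
  ... | s≤s j≤l′ = down₂ (i≤ , ≤-trans lo≤j j≤l′ , ℕ.<⇒≤ l≤hi) (≤-refl , j≤l′)
  step-down {i , j} {suc k , l} (i≤ , lo≤j , j≤hi) (k< , lo≤l , l≤hi) (i≤k , j≤l) z≢w | inj₁ (s≤s i≤k′)
    with l ≤? hi k
  ... | yes l≤ = down₁ (ℕ.<⇒≤ k< , ≤-trans (lo-step k<) lo≤l , l≤) (i≤k′ , j≤l)
  ... | no  l≰ with ℕ.≰⇒> l≰
  ...   | s≤s hi≤l′ = down₂ (k< , ≤-trans (overlaps k<) hi≤l′ , ℕ.<⇒≤ l≤hi)
                            (i≤k , ≤-trans j≤hi (≤-trans (hi-mono i≤k′ (ℕ.<⇒≤ k<)) hi≤l′))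

  square-up : ∀ {z} → In (z ↑₁) → In (z ↑₂) → In (z ↑₁₂)
  square-up (i< , lo≤ , _) (_ , _ , <hi) = i< , ℕ.m≤n⇒m≤1+n lo≤ , ≤-trans <hi (hi-step i<)

  square-down : ∀ {z} → In (z ↑₁) → In (z ↑₂) → In z
  square-down (i< , lo≤ , _) (i≤ , _ , <hi) = i≤ , ≤-trans (lo-step i<) lo≤ , ℕ.<⇒≤ <hi

-- Weights and sums over the cells of a region.

module Guards (K : CommutativeRing 0ℓ 0ℓ) (S : Region) where
  open CommutativeRing K
  open Region S

  when unless : Cell → Carrier → Carrier
  when   z x = if does (In? z) then x else 0#
  unless z x = if does (In? z) then 0# else x

  atM : Maybe Cell → (Cell → Carrier) → Carrier
  atM m f = Maybe.maybe′ (λ z → when z (f z)) 0# m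

  unlessM : Maybe Cell → Carrier → Carrier
  unlessM m x = Maybe.maybe′ (λ z → unless z x) x m

  -- The `below` maps collect the terms that T⁻ of the lower neighbours contributes to the indicator
  -- of z. The `above` maps do the same for T⁺, but only where z is the sole lower neighbour: if
  -- there are two, T⁺ involves their product, which `antidiagonal` handles.
  below₁ below₂ above₁ above₂ : (Cell → Carrier) → Cell → Carrier
  below₁ a z = atM (z ↓₁) a
  below₂ a z = atM (z ↓₂) a
  above₁ b z = when (z ↑₁) (unlessM (z ↑₁ ↓₂) (b (z ↑₁)))
  above₂ b z = when (z ↑₂) (unlessM (z ↑₂ ↓₁) (b (z ↑₂)))

  when-in : ∀ {z x} → In z → when z x ≡ x
  when-in {z} {x} z∈ = cong (if_then x else 0#) (dec-true (In? z) z∈)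

  when-out : ∀ {z x} → ¬ In z → when z x ≡ 0#
  when-out {z} {x} z∉ = cong (if_then x else 0#) (dec-false (In? z) z∉)

  unless-in : ∀ {z x} → In z → unless z x ≡ 0#
  unless-in {z} {x} z∈ = cong (if_then 0# else x) (dec-true (In? z) z∈)

  unless-out : ∀ {z x} → ¬ In z → unless z x ≡ x
  unless-out {z} {x} z∉ = cong (if_then 0# else x) (dec-false (In? z) z∉)

  if-cong : ∀ b {x y} → x ≈ y → (if b then x else 0#) ≈ (if b then y else 0#)
  if-cong true  x≈y = x≈y
  if-cong false _   = refl

  when-cong : ∀ z {x y} → x ≈ y → when z x ≈ when z y
  when-cong z = if-cong (does (In? z))

-- `antidiagonal` makes ∑ (a T⁻ + b T⁺) linear in the membership indicators of the cells, and `balance`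
-- makes the coefficient of each indicator vanish.
record Weights (K : CommutativeRing 0ℓ 0ℓ) (q : CommutativeRing.Carrier K) (S : Region) : Set where
  open CommutativeRing K
  open Region S
  open Guards K S
  field
    a b : Cell → Carrier
    d d⁻¹ : Carrier
    inverse : d * d⁻¹ ≈ 1#
    a+qb    : ∀ {z} → In z → a z + q * b z ≈ d
    balance : ∀ {z} → In z → a z + (above₁ b z + above₂ b z) ≈ b z + (below₁ a z + below₂ a z)
    antidiagonal : ∀ {z} → In z → In (z ↑₁) → In (z ↑₂) → a z + b (z ↑₁₂) ≈ 0#

module Sums (K : CommutativeRing 0ℓ 0ℓ) where
  open CommutativeRing K
  open Algebra.Properties.Semiring.Sum semiring public
    using (sum; sum-cong-≋; ∑-distrib-+; ∑-comm; sum-replicate-zero; *-distribˡ-sum; *-distribʳ-sum)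

  sum-zero : ∀ {n} (f : Fin n → Carrier) → (∀ i → f i ≈ 0#) → sum f ≈ 0#
  sum-zero {n} f f≈0 = trans (sum-cong-≋ f≈0) (sum-replicate-zero n)

  if-⇔ : ∀ {P Q : Set} (P? : Dec P) (Q? : Dec Q) {x y} → (P → Q) → (Q → P) → (P → x ≈ y) →
         (if does P? then x else 0#) ≈ (if does Q? then y else 0#)
  if-⇔ (yes p) (yes r) f g x≈y = x≈y p
  if-⇔ (yes p) (no ¬r) f g x≈y = contradiction (f p) ¬r
  if-⇔ (no ¬p) (yes r) f g x≈y = contradiction (g r) ¬p
  if-⇔ (no ¬p) (no ¬r) f g x≈y = refl

  if-no : ∀ {P : Set} (P? : Dec P) {x} → ¬ P → (if does P? then x else 0#) ≈ 0#
  if-no P? {x} ¬p = reflexive (cong (if_then x else 0#) (dec-false P? ¬p))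

  sum-δ : ∀ {n} (k : Fin n) x → sum (λ i → if does (i Fin.≟ k) then x else 0#) ≈ x
  sum-δ {suc n} Fin.zero    x = trans (+-congˡ (sum-replicate-zero n)) (+-identityʳ x)
  sum-δ {suc n} (Fin.suc k) x = trans (+-identityˡ _) (sum-δ k x)

module CellSums (K : CommutativeRing 0ℓ 0ℓ) (S : Region)
  {n : ℕ} (cell : Fin n → Cell)
  (cell-injective : ∀ {i j} → cell i ≡ cell j → i ≡ j)
  (cell∈ : ∀ i → Region.In S (cell i))
  (cell-surjective : ∀ {z} → Region.In S z → ∃[ i ] cell i ≡ z)
  where
  open Region S
  open CommutativeRing K
  open Guards K S
  open Sums K

  ∑ : (Cell → Carrier) → Carrier
  ∑ f = sum (f ∘ cell)

  ∑-cong : ∀ {f g} → (∀ {z} → In z → f z ≈ g z) → ∑ f ≈ ∑ g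
  ∑-cong f≈g = sum-cong-≋ λ i → f≈g (cell∈ i)

  -- A record, so that f and g can be inferred.
  infix 4 _∼_
  record _∼_ (f g : Cell → Carrier) : Set where
    constructor equal
    field sums : ∑ f ≈ ∑ g
  open _∼_ public

  keep : ∀ f → f ∼ f
  keep f = equal refl

  infixr 5 _⊕_
  _⊕_ : ∀ {f f′ g g′} → f ∼ f′ → g ∼ g′ → (λ z → f z + g z) ∼ (λ z → f′ z + g′ z)
  _⊕_ {f} {f′} {g} {g′} (equal p) (equal r) = equal (trans (∑-distrib-+ (f ∘ cell) (g ∘ cell))
    (trans (+-cong p r) (sym (∑-distrib-+ (f′ ∘ cell) (g′ ∘ cell)))))

  ∑-δ : ∀ z x → ∑ (λ w → if does (w ≟ᶜ z) then x else 0#) ≈ when z x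
  ∑-δ z x = case In? z of λ where
    (yes z∈) → let k , ck≡z = cell-surjective z∈ in
      trans (sum-cong-≋ λ i → if-⇔ (cell i ≟ᶜ z) (i Fin.≟ k)
              (λ ci≡z → cell-injective (≡.trans ci≡z (≡.sym ck≡z)))
              (λ i≡k → ≡.trans (cong cell i≡k) ck≡z) (λ _ → refl))
        (trans (sum-δ k x) (reflexive (≡.sym (when-in z∈))))
    (no z∉) → trans
      (sum-zero _ λ i → if-no (cell i ≟ᶜ z) λ ci≡z → z∉ (≡.subst In ci≡z (cell∈ i)))
      (reflexive (≡.sym (when-out z∉)))

  -- A shift moves some cells out of the region and misses others, so it is no permutation of the
  -- index set. Writing each term as a sum over w of a delta at s z and exchanging the two sums
  -- avoids any need for one.
  ∑-shift : (s : Cell → Cell) (s⁻ : Cell → Maybe Cell) →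
            (∀ {z} → In z → s⁻ (s z) ≡ just z) →
            (∀ {z w} → In w → s⁻ w ≡ just z → w ≡ s z) →
            ∀ h → ∑ (λ z → when (s z) (h z)) ≈ ∑ (λ w → atM (s⁻ w) h)
  ∑-shift s s⁻ s⁻s ss⁻ h =
    trans (sum-cong-≋ λ i → sym (∑-δ (s (cell i)) (h (cell i))))
      (trans (∑-comm λ i j → if does (cell j ≟ᶜ s (cell i)) then h (cell i) else 0#)
        (∑-cong inner))
    where
    inner : ∀ {w} → In w → ∑ (λ z → if does (w ≟ᶜ s z) then h z else 0#) ≈ atM (s⁻ w) h
    inner {w} w∈ with s⁻ w in eq
    ... | nothing = sum-zero _ λ i → if-no (w ≟ᶜ s (cell i)) λ w≡ →
            contradiction (≡.trans (≡.sym eq) (≡.trans (cong s⁻ w≡) (s⁻s (cell∈ i)))) λ ()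
    ... | just y  = trans
            (∑-cong λ {z} z∈ → if-⇔ (w ≟ᶜ s z) (z ≟ᶜ y)
              (λ w≡ → just-injective (≡.trans (≡.sym (s⁻s z∈)) (≡.trans (cong s⁻ (≡.sym w≡)) eq)))
              (λ { ≡.refl → ss⁻ w∈ eq })
              (λ w≡ → reflexive (cong h (just-injective
                (≡.trans (≡.sym (s⁻s z∈)) (≡.trans (cong s⁻ (≡.sym w≡)) eq))))))
            (∑-δ y (h y))

-- Order ideals of a region and their toggles.

module CellIdeal (S : Region) (χ : Cell → Bool)
  (χ⇒In : ∀ {z} → χ z ≡ true → Region.In S z)
  (χ-down : ∀ {z w} → Region.In S z → z ⊑ w → χ w ≡ true → χ z ≡ true)
  where
  open Region S

  χ-false : ∀ {z w} → In z → z ⊑ w → χ z ≡ false → χ w ≡ false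
  χ-false {z} {w} z∈ z⊑w χz with χ w in eq
  ... | false = ≡.refl
  ... | true  = ≡.trans (≡.sym (χ-down z∈ z⊑w eq)) χz

  -- A neighbour that does not exist, or lies outside the region, imposes no condition on adding a
  -- cell; hence the default `true`.
  holds : Maybe Cell → Bool
  holds = Maybe.maybe′ (λ z → not (does (In? z)) ∨ χ z) true

  removable addable : Cell → Bool
  removable z = χ z ∧ not (χ (z ↑₁)) ∧ not (χ (z ↑₂))
  addable   z = not (χ z) ∧ holds (z ↓₁) ∧ holds (z ↓₂)

  holds-in : ∀ {z} → In z → holds (just z) ≡ χ z
  holds-in {z} z∈ = cong (λ t → not t ∨ χ z) (dec-true (In? z) z∈)

  holds-out : ∀ {z} → ¬ In z → holds (just z) ≡ true
  holds-out {z} z∉ = cong (λ t → not t ∨ χ z) (dec-false (In? z) z∉)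

  holds-below : ∀ {z w} → z ⊑ w → χ w ≡ true → holds (just z) ≡ true
  holds-below {z} {w} z⊑w χw = case In? z of λ where
    (yes z∈) → ≡.trans (holds-in z∈) (χ-down z∈ z⊑w χw)
    (no z∉)  → holds-out z∉

  -- Since membership implies the condition on the lower neighbours, the factor `not (χ z)` in
  -- `addable` turns into a subtraction of indicators.
  holds↓ : ∀ z → χ z ≡ true → holds (z ↓₁) ∧ holds (z ↓₂) ≡ true
  holds↓ (zero  , zero)  χz = ≡.refl
  holds↓ (zero  , suc j) χz = holds-below (ℕ.≤-refl , ℕ.n≤1+n _) χz
  holds↓ (suc i , zero)  χz rewrite holds-below {i , zero} (ℕ.n≤1+n _ , ℕ.≤-refl) χz = ≡.refl
  holds↓ (suc i , suc j) χz
    rewrite holds-below {i , suc j} (ℕ.n≤1+n _ , ℕ.≤-refl) χz = holds-below (ℕ.≤-refl , ℕ.n≤1+n _) χz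

  removable⇐ : ∀ {z} → χ z ≡ true → (∀ {w} → χ w ≡ true → z ⊑ w → z ≡ w) → removable z ≡ true
  removable⇐ {z} χz maximal rewrite χz with χ (z ↑₁) in e₁ | χ (z ↑₂) in e₂
  ... | true  | _     = contradiction (maximal e₁ (⊑-↑₁ z)) λ ()
  ... | false | true  = contradiction (maximal e₂ (⊑-↑₂ z)) λ ()
  ... | false | false = ≡.refl

  -- Testing two neighbours is enough: a member strictly above z would, by `step-up` and
  -- down-closure, put one of them into the ideal.
  removable⇒ : ∀ {z} → removable z ≡ true → χ z ≡ true × (∀ {w} → χ w ≡ true → z ⊑ w → z ≡ w)
  removable⇒ {z} r with χ z in e | χ (z ↑₁) in e₁ | χ (z ↑₂) in e₂
  ... | true | false | false = ≡.refl , maximal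
    where
    maximal : ∀ {w} → χ w ≡ true → z ⊑ w → z ≡ w
    maximal {w} χw z⊑w = case z ≟ᶜ w of λ where
      (yes z≡w) → z≡w
      (no z≢w)  → case step-up (χ⇒In e) (χ⇒In χw) z⊑w z≢w of λ where
        (inj₁ (z₁∈ , z₁⊑w)) → contradiction (≡.trans (≡.sym (χ-down z₁∈ z₁⊑w χw)) e₁) λ ()
        (inj₂ (z₂∈ , z₂⊑w)) → contradiction (≡.trans (≡.sym (χ-down z₂∈ z₂⊑w χw)) e₂) λ ()

  addable⇐ : ∀ {z} → χ z ≡ false → (∀ {w} → In w → χ w ≡ false → w ⊑ z → w ≡ z) → addable z ≡ true
  addable⇐ {z} χz minimal rewrite χz = both z minimal
    where
    below : ∀ {z w} → (∀ {w} → In w → χ w ≡ false → w ⊑ z → w ≡ z) → w ⊑ z → w ≢ z → holds (just w) ≡ true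
    below {z} {w} minimal w⊑z w≢z = case In? w of λ where
        (no w∉)  → holds-out w∉
        (yes w∈) → ≡.trans (holds-in w∈) (inside w∈)
      where
      inside : In w → χ w ≡ true
      inside w∈ with χ w in e
      ... | true  = ≡.refl
      ... | false = contradiction (minimal w∈ e w⊑z) w≢z
    both : ∀ z → (∀ {w} → In w → χ w ≡ false → w ⊑ z → w ≡ z) → holds (z ↓₁) ∧ holds (z ↓₂) ≡ true
    both (zero  , zero)  minimal = ≡.refl
    both (zero  , suc j) minimal = below minimal (⊑-↑₂ (zero , j)) λ ()
    both (suc i , zero)  minimal rewrite below minimal (⊑-↑₁ (i , zero)) (λ ()) = ≡.refl
    both (suc i , suc j) minimal rewrite below minimal (⊑-↑₁ (i , suc j)) (λ ()) =
      below minimal (⊑-↑₂ (suc i , j)) λ ()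

  addable⇒ : ∀ {z} → In z → addable z ≡ true →
             χ z ≡ false × (∀ {w} → In w → χ w ≡ false → w ⊑ z → w ≡ z)
  addable⇒ {z} z∈ r with χ z in e
  ... | false = ≡.refl , minimal
    where
    minimal : ∀ {w} → In w → χ w ≡ false → w ⊑ z → w ≡ z
    minimal {w} w∈ χw w⊑z = case w ≟ᶜ z of λ where
        (yes w≡z) → w≡z
        (no w≢z)  → contradiction (≡.trans (≡.sym (inside (step-down w∈ z∈ w⊑z w≢z) r)) χw) λ ()
      where
      inside : ∀ {z} → StepDown w z → holds (z ↓₁) ∧ holds (z ↓₂) ≡ true → χ w ≡ true
      inside {z} (down₁ y∈ w⊑y) r =
        χ-down w∈ w⊑y (≡.trans (≡.sym (holds-in y∈)) (Bool.∧-conicalˡ _ (holds (z ↓₂)) r))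
      inside {z} (down₂ y∈ w⊑y) r =
        χ-down w∈ w⊑y (≡.trans (≡.sym (holds-in y∈)) (Bool.∧-conicalʳ (holds (z ↓₁)) _ r))

-- The weighted sum of toggles is the same for all ideals.

module Constancy
  (K : CommutativeRing 0ℓ 0ℓ) (q : CommutativeRing.Carrier K) (S : Region) (W : Weights K q S)
  (χ : Cell → Bool)
  (χ⇒In : ∀ {z} → χ z ≡ true → Region.In S z)
  (χ-down : ∀ {z w} → Region.In S z → z ⊑ w → χ w ≡ true → χ z ≡ true)
  where
  open Region S
  open CommutativeRing K hiding (zero)
  open Guards K S
  open Weights W
  open CellIdeal S χ χ⇒In χ-down
  open IntegerCoefficients K
  open import Relation.Binary.Reasoning.Setoid setoid

  𝟙 : Bool → Carrier
  𝟙 b = if b then 1# else 0#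

  x m h₁ h₂ k₁ k₂ k₁₂ base : Cell → Carrier
  x z   = 𝟙 (χ z)
  m z   = x (z ↑₁) * x (z ↑₂)
  h₁ z  = - (a z * x (z ↑₁))
  h₂ z  = - (a z * x (z ↑₂))
  k₁ z  = unlessM (z ↑₁ ↓₂) (b (z ↑₁)) * x z
  k₂ z  = unlessM (z ↑₂ ↓₁) (b (z ↑₂)) * x z
  k₁₂ z = b (z ↑₁₂) * m z
  base z = if does (z ≟ᶜ bottom) then b bottom else 0#

  x-out : ∀ {z} → ¬ In z → x z ≡ 0#
  x-out {z} z∉ with χ z in eq
  ... | true  = contradiction (χ⇒In eq) z∉
  ... | false = ≡.refl

  -- Indicators vanish outside the region, so a guard may be inserted for free; this brings the
  -- summands into the form that `∑-shift` reindexes.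
  when-absorb : ∀ z {y} → (¬ In z → y ≈ 0#) → when z y ≈ y
  when-absorb z {y} y≈0 = case In? z of λ where
    (yes z∈) → reflexive (when-in z∈)
    (no z∉)  → trans (reflexive (when-out z∉)) (sym (y≈0 z∉))

  -- By down-closure the indicator of an upper neighbour absorbs that of z. So the expansion of x z
  -- (1 - x (z ↑₁)) (1 - x (z ↑₂)) keeps `m z` as its only quadratic term.
  removable-linear : ∀ {z} → In z →
    a z * 𝟙 (removable z) ≈ a z * x z + (when (z ↑₁) (h₁ z) + (when (z ↑₂) (h₂ z) + a z * m z))
  removable-linear {z} z∈ = trans expand
    (+-congˡ (sym (+-cong (when-absorb (z ↑₁) (vanish {z ↑₁})) (+-congʳ (when-absorb (z ↑₂) (vanish {z ↑₂}))))))
    where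
    vanish : ∀ {w} → ¬ In w → - (a z * x w) ≈ 0#
    vanish {w} w∉ = trans (-‿cong (*-congˡ (reflexive (x-out w∉))))
      (solve 1 (λ t → :- (t :* con 0ℤ) := con 0ℤ) refl (a z))
    expansion : ∀ (i i₁ i₂ : ℤ) → Polynomial 1 → Polynomial 1
    expansion i i₁ i₂ t = t :* con i :+ (:- (t :* con i₁) :+ (:- (t :* con i₂) :+ t :* (con i₁ :* con i₂)))
    expand : a z * 𝟙 (removable z) ≈ a z * x z + (h₁ z + (h₂ z + a z * m z))
    expand with χ z in e | χ (z ↑₁) in e₁ | χ (z ↑₂) in e₂
    ... | true  | true  | true  = solve 1 (λ t → t :* con 0ℤ := expansion 1ℤ 1ℤ 1ℤ t) refl (a z)
    ... | true  | true  | false = solve 1 (λ t → t :* con 0ℤ := expansion 1ℤ 1ℤ 0ℤ t) refl (a z)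
    ... | true  | false | true  = solve 1 (λ t → t :* con 0ℤ := expansion 1ℤ 0ℤ 1ℤ t) refl (a z)
    ... | true  | false | false = solve 1 (λ t → t :* con 1ℤ := expansion 1ℤ 0ℤ 0ℤ t) refl (a z)
    ... | false | false | false = solve 1 (λ t → t :* con 0ℤ := expansion 0ℤ 0ℤ 0ℤ t) refl (a z)
    ... | false | true  | _     = contradiction (≡.trans (≡.sym e₁) (χ-false z∈ (ℕ.n≤1+n _ , ℕ.≤-refl) e)) λ ()
    ... | false | false | true  = contradiction (≡.trans (≡.sym e₂) (χ-false z∈ (ℕ.≤-refl , ℕ.n≤1+n _) e)) λ ()

  𝟙-∧ : ∀ p r → 𝟙 (p ∧ r) ≈ 𝟙 p * 𝟙 r
  𝟙-∧ true  r = sym (*-identityˡ (𝟙 r))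
  𝟙-∧ false r = sym (zeroˡ (𝟙 r))

  at-in : ∀ {z} → In z → ∀ f → atM (just z) f ≈ f z
  at-in z∈ f = reflexive (when-in z∈)

  at-out : ∀ {z} → ¬ In z → ∀ f → atM (just z) f ≈ 0#
  at-out z∉ f = reflexive (when-out z∉)

  𝟙-in : ∀ {z} → In z → 𝟙 (holds (just z)) ≈ x z
  𝟙-in z∈ = reflexive (cong 𝟙 (holds-in z∈))

  𝟙-out : ∀ {z} → ¬ In z → 𝟙 (holds (just z)) ≈ 1#
  𝟙-out z∉ = reflexive (cong 𝟙 (holds-out z∉))

  -- With two lower neighbours inside, the unless-guards kill the linear terms and the product
  -- remains; with one, its linear term alone survives; with none, the cell is the bottom and
  -- contributes the constant.
  supports : ∀ {z} → In z →
    atM (z ↓₁) k₁ + (atM (z ↓₂) k₂ + (atM (z ↓₁₂) k₁₂ + base z)) ≈ b z * (𝟙 (holds (z ↓₁)) * 𝟙 (holds (z ↓₂)))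
  supports {zero , zero} z∈ =
    solve 1 (λ t → con 0ℤ :+ (con 0ℤ :+ (con 0ℤ :+ t)) := t :* (con 1ℤ :* con 1ℤ)) refl (b bottom)
  supports {zero , suc j} z∈ with step-down bottom∈ z∈ (z≤n , z≤n) (λ ())
  ... | down₂ w∈ _ = trans (+-congˡ (+-congʳ (at-in w∈ k₂)))
    (trans (solve 2 (λ t y → con 0ℤ :+ (t :* y :+ (con 0ℤ :+ con 0ℤ)) := t :* (con 1ℤ :* y))
              refl (b (zero , suc j)) (x (zero , j)))
      (*-congˡ (*-congˡ (sym (𝟙-in w∈)))))
  supports {suc i , zero} z∈ with step-down bottom∈ z∈ (z≤n , z≤n) (λ ())
  ... | down₁ w∈ _ = trans (+-congʳ (at-in w∈ k₁))
    (trans (solve 2 (λ t y → t :* y :+ (con 0ℤ :+ (con 0ℤ :+ con 0ℤ)) := t :* (y :* con 1ℤ))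
              refl (b (suc i , zero)) (x (i , zero)))
      (*-congˡ (*-congʳ (sym (𝟙-in w∈)))))
  supports {suc i , suc j} z∈ = case In? (i , suc j) ,′ In? (suc i , j) of λ where
      (yes w₁∈ , yes w₂∈) → begin
        atM (just w₁) k₁ + (atM (just w₂) k₂ + (atM (just (i , j)) k₁₂ + 0#))
          ≈⟨ +-cong (at-in w₁∈ k₁) (+-cong (at-in w₂∈ k₂) (+-congʳ (at-in (square-down w₂∈ w₁∈) k₁₂))) ⟩
        unless w₂ (b z) * x w₁ + (unless w₁ (b z) * x w₂ + (b z * (x w₂ * x w₁) + 0#))
          ≈⟨ +-cong (*-congʳ (reflexive (unless-in w₂∈))) (+-congʳ (*-congʳ (reflexive (unless-in w₁∈)))) ⟩
        0# * x w₁ + (0# * x w₂ + (b z * (x w₂ * x w₁) + 0#))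
          ≈⟨ solve 3 (λ t y₁ y₂ → con 0ℤ :* y₁ :+ (con 0ℤ :* y₂ :+ (t :* (y₂ :* y₁) :+ con 0ℤ)) := t :* (y₁ :* y₂))
               refl (b z) (x w₁) (x w₂) ⟩
        b z * (x w₁ * x w₂)
          ≈⟨ *-congˡ (*-cong (𝟙-in w₁∈) (𝟙-in w₂∈)) ⟨
        b z * (𝟙 (holds (just w₁)) * 𝟙 (holds (just w₂))) ∎
      (yes w₁∈ , no w₂∉) → begin
        atM (just w₁) k₁ + (atM (just w₂) k₂ + (atM (just (i , j)) k₁₂ + 0#))
          ≈⟨ +-cong (at-in w₁∈ k₁) (+-cong (at-out w₂∉ k₂)
               (+-congʳ (at-zero (trans (*-congʳ (reflexive (x-out w₂∉))) (zeroˡ _))))) ⟩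
        unless w₂ (b z) * x w₁ + (0# + (0# + 0#))
          ≈⟨ +-congʳ (*-congʳ (reflexive (unless-out w₂∉))) ⟩
        b z * x w₁ + (0# + (0# + 0#))
          ≈⟨ solve 2 (λ t y → t :* y :+ (con 0ℤ :+ (con 0ℤ :+ con 0ℤ)) := t :* (y :* con 1ℤ)) refl (b z) (x w₁) ⟩
        b z * (x w₁ * 1#)
          ≈⟨ *-congˡ (*-cong (𝟙-in w₁∈) (𝟙-out w₂∉)) ⟨
        b z * (𝟙 (holds (just w₁)) * 𝟙 (holds (just w₂))) ∎
      (no w₁∉ , yes w₂∈) → begin
        atM (just w₁) k₁ + (atM (just w₂) k₂ + (atM (just (i , j)) k₁₂ + 0#))
          ≈⟨ +-cong (at-out w₁∉ k₁) (+-cong (at-in w₂∈ k₂)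
               (+-congʳ (at-zero (trans (*-congˡ (reflexive (x-out w₁∉))) (zeroʳ _))))) ⟩
        0# + (unless w₁ (b z) * x w₂ + (0# + 0#))
          ≈⟨ +-congˡ (+-congʳ (*-congʳ (reflexive (unless-out w₁∉)))) ⟩
        0# + (b z * x w₂ + (0# + 0#))
          ≈⟨ solve 2 (λ t y → con 0ℤ :+ (t :* y :+ (con 0ℤ :+ con 0ℤ)) := t :* (con 1ℤ :* y)) refl (b z) (x w₂) ⟩
        b z * (1# * x w₂)
          ≈⟨ *-congˡ (*-cong (𝟙-out w₁∉) (𝟙-in w₂∈)) ⟨
        b z * (𝟙 (holds (just w₁)) * 𝟙 (holds (just w₂))) ∎
      -- Impossible, because every cell except the bottom has a lower neighbour in the region.
      (no w₁∉ , no w₂∉) → case step-down bottom∈ z∈ (z≤n , z≤n) (λ ()) of λ where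
        (down₁ w₁∈ _) → contradiction w₁∈ w₁∉
        (down₂ w₂∈ _) → contradiction w₂∈ w₂∉
    where
    z w₁ w₂ : Cell
    z  = suc i , suc j
    w₁ = i , suc j
    w₂ = suc i , j
    at-zero : ∀ {y} → x w₂ * x w₁ ≈ 0# → when (i , j) (y * (x w₂ * x w₁)) ≈ 0#
    at-zero {y} p = trans (when-cong (i , j) (trans (*-congˡ p) (zeroʳ y))) (if-0 (does (In? (i , j))))
      where
      if-0 : ∀ t → (if t then 0# else 0#) ≈ 0#
      if-0 true  = refl
      if-0 false = refl

  addable-linear : ∀ {z} → In z →
    b z * 𝟙 (addable z) ≈ - (b z * x z) + (atM (z ↓₁) k₁ + (atM (z ↓₂) k₂ + (atM (z ↓₁₂) k₁₂ + base z)))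
  addable-linear {z} z∈ = trans split
    (+-congˡ (trans (*-congˡ (𝟙-∧ (holds (z ↓₁)) (holds (z ↓₂)))) (sym (supports z∈))))
    where
    split : b z * 𝟙 (addable z) ≈ - (b z * x z) + b z * 𝟙 (holds (z ↓₁) ∧ holds (z ↓₂))
    split with χ z in e
    ... | false = solve 2 (λ t y → t :* y := :- (t :* con 0ℤ) :+ t :* y) refl (b z) _
    ... | true rewrite holds↓ z e =
      solve 1 (λ t → t :* con 0ℤ := :- (t :* con 1ℤ) :+ t :* con 1ℤ) refl (b z)

  module _ {n : ℕ} (cell : Fin n → Cell)
    (cell-injective : ∀ {i j} → cell i ≡ cell j → i ≡ j)
    (cell∈ : ∀ i → In (cell i))
    (cell-surjective : ∀ {z} → In z → ∃[ i ] cell i ≡ z)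
    where
    open CellSums K S cell cell-injective cell∈ cell-surjective

    ∑-toggles : ∑ (λ z → a z * 𝟙 (removable z) + b z * 𝟙 (addable z)) ≈ b bottom
    ∑-toggles = begin
      ∑ (λ z → a z * 𝟙 (removable z) + b z * 𝟙 (addable z))
        ≈⟨ ∑-cong (λ z∈ → trans (+-cong (removable-linear z∈) (addable-linear z∈)) (regroup _ _ _ _ _ _ _ _ _)) ⟩
      ∑ before
        -- Each linear term moves to the cell whose indicator it contains, and each product moves to
        -- the bottom corner of its square. Afterwards everything but `base` cancels cell by cell.
        ≈⟨ sums (keep (λ z → a z * x z - b z * x z) ⊕ shift₁ h₁ ⊕ shift₂ h₂ ⊕ shift₁⁻ k₁ ⊕ shift₂⁻ k₂ ⊕
               keep (λ z → a z * m z) ⊕ shift₁₂⁻ k₁₂ ⊕ keep base) ⟩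
      ∑ after
        ≈⟨ ∑-cong cancel ⟩
      ∑ base
        ≈⟨ ∑-δ bottom (b bottom) ⟩
      when bottom (b bottom)
        ≡⟨ when-in bottom∈ ⟩
      b bottom ∎
      where
      before after : Cell → Carrier
      before z = (a z * x z - b z * x z) + (when (z ↑₁) (h₁ z) + (when (z ↑₂) (h₂ z) +
        (atM (z ↓₁) k₁ + (atM (z ↓₂) k₂ + (a z * m z + (atM (z ↓₁₂) k₁₂ + base z))))))
      after z = (a z * x z - b z * x z) + (atM (z ↓₁) h₁ + (atM (z ↓₂) h₂ +
        (when (z ↑₁) (k₁ z) + (when (z ↑₂) (k₂ z) + (a z * m z + (when (z ↑₁₂) (k₁₂ z) + base z))))))

      regroup : ∀ ax s₁ s₂ am bx u₁ u₂ u₁₂ t →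
        ax + (s₁ + (s₂ + am)) + (- bx + (u₁ + (u₂ + (u₁₂ + t)))) ≈
        (ax - bx) + (s₁ + (s₂ + (u₁ + (u₂ + (am + (u₁₂ + t))))))
      regroup = solve 9 (λ ax s₁ s₂ am bx u₁ u₂ u₁₂ t →
        ax :+ (s₁ :+ (s₂ :+ am)) :+ (:- bx :+ (u₁ :+ (u₂ :+ (u₁₂ :+ t)))) :=
        (ax :- bx) :+ (s₁ :+ (s₂ :+ (u₁ :+ (u₂ :+ (am :+ (u₁₂ :+ t))))))) refl

      ↓₁⇒ : ∀ {z w} → In w → w ↓₁ ≡ just z → w ≡ z ↑₁
      ↓₁⇒ {w = suc i , j} _ ≡.refl = ≡.refl
      ↓₂⇒ : ∀ {z w} → In w → w ↓₂ ≡ just z → w ≡ z ↑₂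
      ↓₂⇒ {w = i , suc j} _ ≡.refl = ≡.refl
      ↓₁₂⇒ : ∀ {z w} → In w → w ↓₁₂ ≡ just z → w ≡ z ↑₁₂
      ↓₁₂⇒ {w = suc i , suc j} _ ≡.refl = ≡.refl

      shift₁ : ∀ h → (λ z → when (z ↑₁) (h z)) ∼ (λ z → atM (z ↓₁) h)
      shift₁ h = equal (∑-shift _↑₁ _↓₁ (λ _ → ≡.refl) ↓₁⇒ h)
      shift₂ : ∀ h → (λ z → when (z ↑₂) (h z)) ∼ (λ z → atM (z ↓₂) h)
      shift₂ h = equal (∑-shift _↑₂ _↓₂ (λ _ → ≡.refl) ↓₂⇒ h)
      shift₁⁻ : ∀ h → (λ z → atM (z ↓₁) h) ∼ (λ z → when (z ↑₁) (h z))
      shift₁⁻ h = equal (sym (sums (shift₁ h)))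
      shift₂⁻ : ∀ h → (λ z → atM (z ↓₂) h) ∼ (λ z → when (z ↑₂) (h z))
      shift₂⁻ h = equal (sym (sums (shift₂ h)))
      shift₁₂⁻ : ∀ h → (λ z → atM (z ↓₁₂) h) ∼ (λ z → when (z ↑₁₂) (h z))
      shift₁₂⁻ h = equal (sym (∑-shift _↑₁₂ _↓₁₂ (λ _ → ≡.refl) ↓₁₂⇒ h))

      when-* : ∀ z y t → when z (y * t) ≈ when z y * t
      when-* z y t with does (In? z)
      ... | true  = refl
      ... | false = sym (zeroˡ t)

      when-neg : ∀ z y t → when z (- (y * t)) ≈ - (when z y * t)
      when-neg z y t with does (In? z)
      ... | true  = refl
      ... | false = solve 1 (λ t → con 0ℤ := :- (con 0ℤ :* t)) refl t

      below₁-x : ∀ z → atM (z ↓₁) h₁ ≈ - (below₁ a z * x z)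
      below₁-x (zero  , j) = solve 1 (λ t → con 0ℤ := :- (con 0ℤ :* t)) refl (x (zero , j))
      below₁-x (suc i , j) = when-neg (i , j) (a (i , j)) (x (suc i , j))

      below₂-x : ∀ z → atM (z ↓₂) h₂ ≈ - (below₂ a z * x z)
      below₂-x (i , zero)  = solve 1 (λ t → con 0ℤ := :- (con 0ℤ :* t)) refl (x (i , zero))
      below₂-x (i , suc j) = when-neg (i , j) (a (i , j)) (x (i , suc j))

      antidiagonal-m : ∀ {z} → In z → a z * m z + when (z ↑₁₂) (k₁₂ z) ≈ 0#
      antidiagonal-m {z} z∈ = case In? (z ↑₁) ,′ In? (z ↑₂) of λ where
          (yes z₁∈ , yes z₂∈) → begin
            a z * m z + when (z ↑₁₂) (b (z ↑₁₂) * m z)  ≈⟨ +-congˡ (reflexive (when-in (square-up z₁∈ z₂∈))) ⟩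
            a z * m z + b (z ↑₁₂) * m z                 ≈⟨ distribʳ (m z) (a z) (b (z ↑₁₂)) ⟨
            (a z + b (z ↑₁₂)) * m z                     ≈⟨ *-congʳ (antidiagonal z∈ z₁∈ z₂∈) ⟩
            0# * m z                                    ≈⟨ zeroˡ (m z) ⟩
            0#                                          ∎
          (no z₁∉ , _) → vanish (trans (*-congʳ (reflexive (x-out z₁∉))) (zeroˡ _))
          (_ , no z₂∉) → vanish (trans (*-congˡ (reflexive (x-out z₂∉))) (zeroʳ _))
        where
        vanish : m z ≈ 0# → a z * m z + when (z ↑₁₂) (k₁₂ z) ≈ 0#
        vanish m≈0 = begin
          a z * m z + when (z ↑₁₂) (b (z ↑₁₂) * m z)  ≈⟨ +-congˡ (when-* (z ↑₁₂) (b (z ↑₁₂)) (m z)) ⟩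
          a z * m z + when (z ↑₁₂) (b (z ↑₁₂)) * m z  ≈⟨ distribʳ (m z) (a z) (when (z ↑₁₂) (b (z ↑₁₂))) ⟨
          (a z + when (z ↑₁₂) (b (z ↑₁₂))) * m z      ≈⟨ *-congˡ m≈0 ⟩
          (a z + when (z ↑₁₂) (b (z ↑₁₂))) * 0#       ≈⟨ zeroʳ _ ⟩
          0#                                          ∎

      balance-x : ∀ {z} → In z →
        (a z * x z - b z * x z) + (- (below₁ a z * x z) + (- (below₂ a z * x z) + (above₁ b z * x z + above₂ b z * x z))) ≈ 0#
      balance-x {z} z∈ = begin
        (a z * x z - b z * x z) + (- (below₁ a z * x z) + (- (below₂ a z * x z) + (above₁ b z * x z + above₂ b z * x z)))
          ≈⟨ solve 7 (λ az bz l₁ l₂ u₁ u₂ t → (az :* t :- bz :* t) :+ (:- (l₁ :* t) :+ (:- (l₂ :* t) :+ (u₁ :* t :+ u₂ :* t))) :=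
               ((az :+ (u₁ :+ u₂)) :- (bz :+ (l₁ :+ l₂))) :* t) refl (a z) (b z) _ _ _ _ (x z) ⟩
        ((a z + (above₁ b z + above₂ b z)) - (b z + (below₁ a z + below₂ a z))) * x z
          ≈⟨ *-congʳ (trans (+-congʳ (balance z∈)) (-‿inverseʳ _)) ⟩
        0# * x z
          ≈⟨ zeroˡ (x z) ⟩
        0# ∎

      cancel : ∀ {z} → In z → after z ≈ base z
      cancel {z} z∈ = begin
        after z
          ≈⟨ +-congˡ (+-cong (below₁-x z) (+-cong (below₂-x z)
               (+-cong (when-* (z ↑₁) _ (x z)) (+-congʳ (when-* (z ↑₂) _ (x z)))))) ⟩
        (a z * x z - b z * x z) + (- (below₁ a z * x z) + (- (below₂ a z * x z) +
          (above₁ b z * x z + (above₂ b z * x z + (a z * m z + (when (z ↑₁₂) (k₁₂ z) + base z))))))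
          ≈⟨ solve 8 (λ t l₁ l₂ u₁ u₂ y y′ s → t :+ (l₁ :+ (l₂ :+ (u₁ :+ (u₂ :+ (y :+ (y′ :+ s)))))) :=
               (t :+ (l₁ :+ (l₂ :+ (u₁ :+ u₂)))) :+ ((y :+ y′) :+ s)) refl
               (a z * x z - b z * x z) _ _ _ _ (a z * m z) (when (z ↑₁₂) (k₁₂ z)) (base z) ⟩
        ((a z * x z - b z * x z) + (- (below₁ a z * x z) + (- (below₂ a z * x z) +
          (above₁ b z * x z + above₂ b z * x z)))) + ((a z * m z + when (z ↑₁₂) (k₁₂ z)) + base z)
          ≈⟨ +-cong (balance-x z∈) (+-congʳ (antidiagonal-m z∈)) ⟩
        0# + (0# + base z)
          ≈⟨ trans (+-identityˡ _) (+-identityˡ _) ⟩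
        base z ∎

-- Embedded posets, truncations by height, and the value of the constant.

record Embedding (P : Poset 0ℓ 0ℓ 0ℓ) (S : Region) : Set where
  open Poset P using (Carrier) renaming (_≤_ to _≼_)
  open Region S
  field
    cell     : Carrier → Cell
    monotone : ∀ {x y} → x ≼ y → cell x ⊑ cell y
    reflects : ∀ {x y} → cell x ⊑ cell y → x ≼ y
    cell∈    : ∀ x → In (cell x)
    onto     : ∀ {z} → In z → ∃[ x ] cell x ≡ z

record Symmetry (S : Region) : Set where
  open Region S
  field
    σ            : Cell → Cell
    σ∈           : ∀ {z} → In z → In (σ z)
    involutive   : ∀ {z} → In z → σ (σ z) ≡ z
    complement   : ∀ {z} → In z → height z ℕ.+ height (σ z) ≡ rank

does-≡ : ∀ {P : Set} (P? : Dec P) b → (P → b ≡ true) → (b ≡ true → P) → does P? ≡ b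
does-≡ (yes p) b     to from = ≡.sym (to p)
does-≡ (no ¬p) true  to from = contradiction (from ≡.refl) ¬p
does-≡ (no ¬p) false to from = ≡.refl

does-true : ∀ {P : Set} (P? : Dec P) → does P? ≡ true → P
does-true (yes p) _ = p

module Truncation (S : Region) (s : ℕ) (s≤ : s ≤ suc (Region.rank S)) where
  open Region S

  χ : Cell → Bool
  χ z = does (In? z) ∧ does (height z ℕ.+ s ≤? rank)

  χ⇒In : ∀ {z} → χ z ≡ true → In z
  χ⇒In {z} χz = does-true (In? z) (Bool.∧-conicalˡ _ _ χz)

  χ⇒≤ : ∀ {z} → χ z ≡ true → height z ℕ.+ s ≤ rank
  χ⇒≤ {z} χz = does-true (height z ℕ.+ s ≤? rank) (Bool.∧-conicalʳ (does (In? z)) _ χz)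

  χ-true : ∀ {z} → In z → height z ℕ.+ s ≤ rank → χ z ≡ true
  χ-true {z} z∈ h = cong₂ _∧_ (dec-true (In? z) z∈) (dec-true (height z ℕ.+ s ≤? rank) h)

  χ-false′ : ∀ {z} → In z → rank < height z ℕ.+ s → χ z ≡ false
  χ-false′ {z} z∈ h = cong₂ _∧_ (dec-true (In? z) z∈) (dec-false (height z ℕ.+ s ≤? rank) (ℕ.<⇒≱ h))

  χ⇒> : ∀ {z} → In z → χ z ≡ false → rank < height z ℕ.+ s
  χ⇒> {z} z∈ χz = ℕ.≰⇒> λ h → contradiction (≡.trans (≡.sym (χ-true z∈ h)) χz) λ ()

  χ-down : ∀ {z w} → In z → z ⊑ w → χ w ≡ true → χ z ≡ true
  χ-down {z} {w} z∈ z⊑w χw = χ-true z∈ (ℕ.≤-trans (ℕ.+-monoˡ-≤ s (height-mono z⊑w)) (χ⇒≤ {w} χw))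

  open CellIdeal S χ (λ {z} → χ⇒In {z}) (λ {z} {w} → χ-down {z} {w}) public

  -- A member strictly below the cut other than the top can step up and stay in the truncation, so
  -- it is not maximal; the top itself never lies strictly below the cut, as rank ≤ rank + s.
  removable-≡ : ∀ {z} → In z → removable z ≡ does (height z ℕ.+ s ℕ.≟ rank)
  removable-≡ {z} z∈ = ≡.sym (does-≡ (height z ℕ.+ s ℕ.≟ rank) (removable z) to from)
    where
    to : height z ℕ.+ s ≡ rank → removable z ≡ true
    to h = removable⇐ {z} (χ-true z∈ (ℕ.≤-reflexive h)) λ {w} χw z⊑w →
      height-≥⇒≡ z⊑w (ℕ.+-cancelʳ-≤ s _ _ (ℕ.≤-trans (χ⇒≤ {w} χw) (ℕ.≤-reflexive (≡.sym h))))
    from : removable z ≡ true → height z ℕ.+ s ≡ rank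
    from r with removable⇒ {z} r
    ... | χz , maximal = ℕ.≤-antisym (χ⇒≤ {z} χz) (ℕ.≮⇒≥ λ h → case z ≟ᶜ top of λ where
      (yes ≡.refl) → contradiction (ℕ.≤-trans h (ℕ.≤-refl)) (ℕ.≤⇒≯ (ℕ.m≤m+n rank s))
      (no z≢top)   → case step-up z∈ top∈ (⊑-top z∈) z≢top of λ where
        (inj₁ (z₁∈ , _)) → contradiction (maximal (χ-true z₁∈ h) (⊑-↑₁ z)) λ ()
        (inj₂ (z₂∈ , _)) → contradiction
          (maximal (χ-true z₂∈ (ℕ.≤-trans (ℕ.≤-reflexive (cong (ℕ._+ s) (ℕ.+-suc (proj₁ z) (proj₂ z)))) h)) (⊑-↑₂ z)) λ ())

  addable-≡ : ∀ {z} → In z → addable z ≡ does (height z ℕ.+ s ℕ.≟ suc rank)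
  addable-≡ {z} z∈ = ≡.sym (does-≡ (height z ℕ.+ s ℕ.≟ suc rank) (addable z) to from)
    where
    to : height z ℕ.+ s ≡ suc rank → addable z ≡ true
    to h = addable⇐ {z} (χ-false′ z∈ (ℕ.≤-reflexive (≡.sym h))) λ {w} w∈ χw w⊑z →
      height-≥⇒≡ w⊑z (ℕ.+-cancelʳ-≤ s _ _ (ℕ.≤-trans (ℕ.≤-reflexive h) (χ⇒> w∈ χw)))
    small : ∀ {z} → In z → (∀ {w} → In w → χ w ≡ false → w ⊑ z → w ≡ z) → height z ℕ.+ s ≤ suc rank
    small {z} z∈ minimal = case bottom ≟ᶜ z of λ where
        -- The bottom is addable to every empty truncation. The bound s ≤ rank + 1 admits just one
        -- of these, the one whose cut meets the bottom.
        (yes ≡.refl) → s≤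
        (no z≢)      → below (step-down bottom∈ z∈ (z≤n , z≤n) z≢) minimal
      where
      below : ∀ {z} → StepDown bottom z → (∀ {w} → In w → χ w ≡ false → w ⊑ z → w ≡ z) →
              height z ℕ.+ s ≤ suc rank
      below (down₁ {w} w∈ _) minimal = ℕ.≮⇒≥ λ { (s≤s h) →
        contradiction (minimal w∈ (χ-false′ w∈ h) (⊑-↑₁ w)) λ () }
      below (down₂ {w} w∈ _) minimal = ℕ.≮⇒≥ λ h →
        contradiction (minimal w∈ (χ-false′ w∈ (ℕ.≤-pred (ℕ.≤-trans h (ℕ.≤-reflexive
          (cong (ℕ._+ s) (ℕ.+-suc (proj₁ w) (proj₂ w))))))) (⊑-↑₂ w)) λ ()
    from : addable z ≡ true → height z ℕ.+ s ≡ suc rank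
    from r with addable⇒ z∈ r
    ... | χz , minimal = ℕ.≤-antisym (small z∈ minimal) (χ⇒> z∈ χz)

module RankGenerating
  (K : CommutativeRing 0ℓ 0ℓ) (q : CommutativeRing.Carrier K) (S : Region)
  (W : Weights K q S) (sym-S : Symmetry S)
  {n : ℕ} (cell : Fin n → Cell)
  (cell-injective : ∀ {i j} → cell i ≡ cell j → i ≡ j)
  (cell∈ : ∀ i → Region.In S (cell i))
  (cell-surjective : ∀ {z} → Region.In S z → ∃[ i ] cell i ≡ z)
  where
  open Region S
  open Symmetry sym-S
  open CommutativeRing K
  open Weights W
  open Sums K
  open Guards K S
  open CellSums K S cell cell-injective cell∈ cell-surjective
  open IntegerCoefficients K using (solve; _:=_; _:+_; _:*_)
  open Algebra.Properties.Semiring.Exp semiring using (_^_)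
  open import Relation.Binary.Reasoning.Setoid setoid

  private
    𝟙 : Bool → Carrier
    𝟙 t = if t then 1# else 0#

    sum-at : ∀ {m} (f : ℕ → Carrier) t → t < m →
             sum {m} (λ s → if does (toℕ s ℕ.≟ t) then f (toℕ s) else 0#) ≈ f t
    sum-at {m} f t t<m = trans
      (sum-cong-≋ λ s → if-⇔ (toℕ s ℕ.≟ t) (s Fin.≟ fromℕ< t<m)
        (λ s≡t → Fin.toℕ-injective (≡.trans s≡t (≡.sym (Fin.toℕ-fromℕ< t<m))))
        (λ s≡t → ≡.trans (cong toℕ s≡t) (Fin.toℕ-fromℕ< t<m))
        (λ s≡t → reflexive (cong f s≡t)))
      (sum-δ (fromℕ< t<m) (f t))

    if-* : ∀ t c y → c * (y * 𝟙 t) ≈ (if t then c * y else 0#)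
    if-* true  c y = *-congˡ (*-identityʳ y)
    if-* false c y = trans (*-congˡ (zeroʳ y)) (zeroʳ c)

  -- The parameter s runs from 0, the whole region, to rank + 1, the empty ideal. With both ends
  -- included, each cell is removable for exactly one s and addable for exactly one s.
  toggled : Fin (2 ℕ.+ rank) → Cell → Carrier
  toggled s z = a z * 𝟙 (removable z) + b z * 𝟙 (addable z)
    where open Truncation S (toℕ s) (Fin.toℕ≤pred[n] s)

  -- The cell z is removable only at s = t and addable only at s = t + 1, where t = rank - height z.
  -- Its contribution is q^t a + q^(t+1) b, which is q^t (a + q b).
  weighted : ∀ {z} → In z → sum (λ s → q ^ toℕ s * toggled s z) ≈ d * q ^ height (σ z)
  weighted {z} z∈ = begin
    sum (λ s → q ^ toℕ s * toggled s z)
      ≈⟨ sum-cong-≋ {2 ℕ.+ rank} {λ s → q ^ toℕ s * toggled s z} {λ s → u s + v s} pointwise ⟩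
    sum {2 ℕ.+ rank} (λ s → u s + v s)
      ≈⟨ ∑-distrib-+ {2 ℕ.+ rank} u v ⟩
    sum {2 ℕ.+ rank} u + sum {2 ℕ.+ rank} v
      ≈⟨ +-cong (sum-at {2 ℕ.+ rank} (λ s → q ^ s * a z) t (ℕ.m≤n⇒m≤1+n (s≤s t≤)))
                (sum-at {2 ℕ.+ rank} (λ s → q ^ s * b z) (suc t) (s≤s (s≤s t≤))) ⟩
    q ^ t * a z + q * q ^ t * b z
      ≈⟨ solve 4 (λ x y z q → x :* y :+ q :* x :* z := (y :+ q :* z) :* x) refl (q ^ t) (a z) (b z) q ⟩
    (a z + q * b z) * q ^ t
      ≈⟨ *-congʳ (a+qb z∈) ⟩
    d * q ^ t ∎
    where
    t = height (σ z)
    u v : Fin (2 ℕ.+ rank) → Carrier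
    u s = if does (toℕ s ℕ.≟ t) then q ^ toℕ s * a z else 0#
    v s = if does (toℕ s ℕ.≟ suc t) then q ^ toℕ s * b z else 0#
    t≤ : t ≤ rank
    t≤ = ℕ.≤-trans (ℕ.m≤n+m t (height z)) (ℕ.≤-reflexive (complement z∈))
    removable-iff : ∀ s → does (height z ℕ.+ s ℕ.≟ rank) ≡ does (s ℕ.≟ t)
    removable-iff s = does-≡ (height z ℕ.+ s ℕ.≟ rank) _
      (λ h → dec-true (s ℕ.≟ t) (ℕ.+-cancelˡ-≡ (height z) s t (≡.trans h (≡.sym (complement z∈)))))
      (λ e → ≡.trans (cong (height z ℕ.+_) (does-true (s ℕ.≟ t) e)) (complement z∈))
    addable-iff : ∀ s → does (height z ℕ.+ s ℕ.≟ suc rank) ≡ does (s ℕ.≟ suc t)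
    addable-iff s = does-≡ (height z ℕ.+ s ℕ.≟ suc rank) _
      (λ h → dec-true (s ℕ.≟ suc t) (ℕ.+-cancelˡ-≡ (height z) s (suc t) (≡.trans h (≡.sym complement′))))
      (λ e → ≡.trans (cong (height z ℕ.+_) (does-true (s ℕ.≟ suc t) e)) complement′)
      where
      complement′ : height z ℕ.+ suc t ≡ suc rank
      complement′ = ≡.trans (ℕ.+-suc (height z) t) (cong suc (complement z∈))
    pointwise : ∀ s → q ^ toℕ s * toggled s z ≈ u s + v s
    pointwise s = trans (distribˡ _ _ _) (+-cong
      (trans (if-* (removable z) _ _)
        (reflexive (cong (if_then q ^ toℕ s * a z else 0#) (≡.trans (removable-≡ z∈) (removable-iff (toℕ s))))))
      (trans (if-* (addable z) _ _)
        (reflexive (cong (if_then q ^ toℕ s * b z else 0#) (≡.trans (addable-≡ z∈) (addable-iff (toℕ s)))))))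
      where open Truncation S (toℕ s) (Fin.toℕ≤pred[n] s)

  -- Being an involution of the region, σ serves as its own inverse in `∑-shift`.
  ∑-symmetric : (f : Cell → Carrier) → ∑ (f ∘ σ) ≈ ∑ f
  ∑-symmetric f = begin
    ∑ (f ∘ σ)                                ≈⟨ ∑-cong {f ∘ σ} (λ z∈ → reflexive (≡.sym (when-in (σ∈ z∈)))) ⟩
    ∑ (λ z → when (σ z) (f (σ z)))           ≈⟨ ∑-shift σ (just ∘ σ) (cong just ∘ involutive)
                                                  (λ w∈ e → ≡.trans (≡.sym (involutive w∈)) (cong σ (just-injective e))) (f ∘ σ) ⟩
    ∑ (λ z → when (σ z) (f (σ (σ z))))       ≈⟨ ∑-cong (λ z∈ → reflexive (≡.trans (when-in (σ∈ z∈)) (cong f (involutive z∈)))) ⟩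
    ∑ f                                      ∎

  rank-generating : sum {2 ℕ.+ rank} (λ s → q ^ toℕ s) * b bottom ≈ d * ∑ (λ z → q ^ height z)
  rank-generating = begin
    sum {2 ℕ.+ rank} (λ s → q ^ toℕ s) * b bottom
      ≈⟨ *-distribʳ-sum {2 ℕ.+ rank} (b bottom) (λ s → q ^ toℕ s) ⟩
    sum {2 ℕ.+ rank} (λ s → q ^ toℕ s * b bottom)
      ≈⟨ sum-cong-≋ (λ s → trans (*-congˡ (sym (constant s))) (*-distribˡ-sum (q ^ toℕ s) (toggled s ∘ cell))) ⟩
    sum (λ s → ∑ (λ z → q ^ toℕ s * toggled s z))
      ≈⟨ ∑-comm (λ s i → q ^ toℕ s * toggled s (cell i)) ⟩
    ∑ (λ z → sum (λ s → q ^ toℕ s * toggled s z))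
      ≈⟨ ∑-cong weighted ⟩
    ∑ (λ z → d * q ^ height (σ z))
      ≈⟨ *-distribˡ-sum d (λ i → q ^ height (σ (cell i))) ⟨
    d * ∑ (λ z → q ^ height (σ z))
      ≈⟨ *-congˡ (∑-symmetric (λ z → q ^ height z)) ⟩
    d * ∑ (λ z → q ^ height z) ∎
    where
    constant : ∀ s → ∑ (toggled s) ≈ b bottom
    constant s = ∑-toggles cell cell-injective cell∈ cell-surjective
      where
      open Truncation S (toℕ s) (Fin.toℕ≤pred[n] s)
      open Constancy K q S W χ (λ {z} → χ⇒In {z}) (λ {z} {w} → χ-down {z} {w}) using (∑-toggles)

-- Transfer from cells to a finite poset.

module Homomesy (P : FinitePoset) (S : Region) (E : Embedding (FinitePoset.poset P) S) where
  open FinitePoset P renaming (_≤_ to _≼_; _≈_ to _≋_; _<_ to _≺_)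
  open Region S
  open Embedding E

  cell-cong : ∀ {x y} → x ≋ y → cell x ≡ cell y
  cell-cong x≋y = ⊑-antisym (monotone (reflexive x≋y)) (monotone (reflexive (Eq.sym x≋y)))

  cell-injective : ∀ {x y} → cell x ≡ cell y → x ≋ y
  cell-injective e = antisym (reflects (⊑-reflexive e)) (reflects (⊑-reflexive (≡.sym e)))

  cellᶠ : Fin size → Cell
  cellᶠ = cell ∘ element

  cellᶠ-injective : ∀ {i j} → cellᶠ i ≡ cellᶠ j → i ≡ j
  cellᶠ-injective {i} {j} e = ≡.trans (≡.sym (strictlyInverseʳ i))
    (≡.trans (from-cong (cell-injective e)) (strictlyInverseʳ j))
    where open Inverse enumeration

  cellᶠ-surjective : ∀ {z} → In z → ∃[ i ] cellᶠ i ≡ z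
  cellᶠ-surjective z∈ = let x , e = onto z∈ in
    from x , ≡.trans (cell-cong (strictlyInverseˡ x)) e
    where open Inverse enumeration

  module _ (I : OrderIdeal) where
    -- Splitting on the decision as an argument exposes the proof that `onto` requires. The preimage
    -- that it returns is arbitrary, but preimages of one cell are comparable both ways, so an ideal
    -- cannot separate them.
    χ′ : ∀ {z} → Dec (In z) → Bool
    χ′ (yes z∈) = does (member? I (proj₁ (onto z∈)))
    χ′ (no _)   = false

    χ : Cell → Bool
    χ z = χ′ (In? z)

    χ⇒In : ∀ {z} → χ z ≡ true → In z
    χ⇒In {z} χz with In? z
    ... | yes z∈ = z∈

    χ⇒member : ∀ {x} → χ (cell x) ≡ true → Member I x
    χ⇒member {x} χx with In? (cell x)
    ... | yes z∈ = let y , e = onto z∈ in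
      downClosed I (reflects (⊑-reflexive (≡.sym e))) (does-true (member? I y) χx)

    member⇒χ : ∀ {x} → Member I x → χ (cell x) ≡ true
    member⇒χ {x} x∈I with In? (cell x)
    ... | yes z∈ = let y , e = onto z∈ in
      dec-true (member? I y) (downClosed I (reflects (⊑-reflexive e)) x∈I)
    ... | no z∉  = contradiction (cell∈ x) z∉

    χ-down : ∀ {z w} → In z → z ⊑ w → χ w ≡ true → χ z ≡ true
    χ-down {z} {w} z∈ z⊑w χw with onto z∈ | onto (χ⇒In {w} χw)
    ... | x , ≡.refl | y , ≡.refl = member⇒χ (downClosed I (reflects z⊑w) (χ⇒member χw))

    open CellIdeal S χ (λ {z} → χ⇒In {z}) (λ {z} {w} → χ-down {z} {w})

    maximal-removable : ∀ x → does (maximalInside? I x) ≡ removable (cell x)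
    maximal-removable x = does-≡ (maximalInside? I x) _ to from
      where
      to : MaximalIn (Member I) x → removable (cell x) ≡ true
      to (x∈I , maximal) = removable⇐ (member⇒χ x∈I) λ {w} → lift {w}
        where
        lift : ∀ {w} → χ w ≡ true → cell x ⊑ w → cell x ≡ w
        lift {w} χw x⊑w with onto (χ⇒In {w} χw)
        ... | y , ≡.refl = cell-cong (maximal y (χ⇒member χw) (reflects x⊑w))
      from : removable (cell x) ≡ true → MaximalIn (Member I) x
      from r = let χx , maximal = removable⇒ {cell x} r in
        χ⇒member χx , λ y y∈I x≼y → cell-injective (maximal (member⇒χ y∈I) (monotone x≼y))

    minimal-addable : ∀ x → does (minimalOutside? I x) ≡ addable (cell x)
    minimal-addable x = does-≡ (minimalOutside? I x) _ to from
      where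
      outside : ∀ {x} → ¬ Member I x → χ (cell x) ≡ false
      outside {x} x∉I = Bool.¬-not λ χx → x∉I (χ⇒member χx)
      outside⁻ : ∀ {x} → χ (cell x) ≡ false → ¬ Member I x
      outside⁻ χx x∈I = contradiction (≡.trans (≡.sym (member⇒χ x∈I)) χx) λ ()
      to : MinimalIn (λ y → ¬ Member I y) x → addable (cell x) ≡ true
      to (x∉I , minimal) = addable⇐ {cell x} (outside x∉I) lift
        where
        lift : ∀ {w} → In w → χ w ≡ false → w ⊑ cell x → w ≡ cell x
        lift w∈ χw w⊑x with onto w∈
        ... | y , ≡.refl = cell-cong (minimal y (outside⁻ χw) (reflects w⊑x))
      from : addable (cell x) ≡ true → MinimalIn (λ y → ¬ Member I y) x
      from r = let χx , minimal = addable⇒ {cell x} (cell∈ x) r in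
        outside⁻ χx , λ y y∉I y≼x → cell-injective (minimal (cell∈ y) (outside y∉I) (monotone y≼x))

  module _ (rk : Carrier → ℕ) (isRank : IsRankFunction rk) where
    open IsRankFunction isRank using (minimal⇒0; cover⇒suc)

    -- Induction along unit steps down to the bottom. Each step is a cover, because an element
    -- strictly between would have a height strictly between two consecutive integers.
    rk≡height : ∀ x → rk x ≡ height (cell x)
    rk≡height x = go (height (cell x)) x ≡.refl
      where
      covers : ∀ {x y} → cell y ⊑ cell x → height (cell x) ≡ suc (height (cell y)) → y ⋖ x
      covers {x} {y} y⊑x h = (reflects y⊑x , λ y≋x → ℕ.1+n≢n (≡.trans (≡.sym h) (cong height (≡.sym (cell-cong y≋x))))) ,
        λ z ((y≼z , y≉z) , (z≼x , z≉x)) →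
          ℕ.<-irrefl ≡.refl (ℕ.<-≤-trans
            (s≤s (height-mono-≢ (monotone y≼z) (y≉z ∘ cell-injective)))
            (ℕ.≤-trans (height-mono-≢ (monotone z≼x) (z≉x ∘ cell-injective)) (ℕ.≤-reflexive h)))
      go : ∀ n x → height (cell x) ≡ n → rk x ≡ height (cell x)
      below : ∀ n x {z} → cell x ≡ z → height z ≡ n → StepDown bottom z → rk x ≡ height z
      go n x h = case bottom ≟ᶜ cell x of λ where
        (yes e) → ≡.trans (minimal⇒0 (_ , λ y _ y≼x →
          cell-injective (⊑-antisym (monotone y≼x) (subst (_⊑ cell y) e (z≤n , z≤n))))) (cong height e)
        (no ne) → below n x ≡.refl h (step-down bottom∈ (cell∈ x) (z≤n , z≤n) ne)
      below (suc n) x e h (down₁ {w} w∈ _) with onto w∈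
      ... | y , ≡.refl = ≡.trans
        (cover⇒suc (covers {x} {y} (subst (cell y ⊑_) (≡.sym e) (⊑-↑₁ (cell y))) (cong height e)))
        (cong suc (go n y (ℕ.suc-injective h)))
      below zero x e () (down₁ w∈ _)
      below n x e h (down₂ {w} w∈ _) with onto w∈
      ... | y , ≡.refl with n | ≡.trans (≡.sym (ℕ.+-suc (proj₁ (cell y)) (proj₂ (cell y)))) h
      ...   | suc n | h′ = ≡.trans
        (cover⇒suc (covers {x} {y} (subst (cell y ⊑_) (≡.sym e) (⊑-↑₂ (cell y)))
          (≡.trans (cong height e) (ℕ.+-suc _ _))))
        (≡.trans (cong suc (go n y (ℕ.suc-injective h′))) (≡.sym (ℕ.+-suc _ _)))

    maximum≡rank : maximum rk ≡ rank
    maximum≡rank = ℕ.≤-antisym (upper (rk ∘ element) λ i → ℕ.≤-trans (ℕ.≤-reflexive (rk≡height (element i)))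
        (height-mono (⊑-top (cell∈ (element i)))))
      (let i , e = cellᶠ-surjective top∈ in
        ℕ.≤-trans (ℕ.≤-reflexive (≡.trans (cong height (≡.sym e)) (≡.sym (rk≡height (element i))))) (lower (rk ∘ element) i))
      where
      upper : ∀ {n m} (f : Fin n → ℕ) → (∀ i → f i ≤ m) → Vector.foldr ℕ._⊔_ 0 f ≤ m
      upper {zero}  f f≤ = z≤n
      upper {suc n} f f≤ = ℕ.⊔-lub (f≤ Fin.zero) (upper (f ∘ Fin.suc) (f≤ ∘ Fin.suc))
      lower : ∀ {n} (f : Fin n → ℕ) i → f i ≤ Vector.foldr ℕ._⊔_ 0 f
      lower f Fin.zero    = ℕ.m≤m⊔n (f Fin.zero) _
      lower f (Fin.suc i) = ℕ.≤-trans (lower (f ∘ Fin.suc) i) (ℕ.m≤n⊔m (f Fin.zero) _)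

  module _ (K : CommutativeRing 0ℓ 0ℓ) (q : CommutativeRing.Carrier K)
    (W : Weights K q S) (sym-S : Symmetry S)
    (rk : Carrier → ℕ) (isRank : IsRankFunction rk)
    where
    private module K = CommutativeRing K
    open K using (1#; _+_; _*_; -_; _-_)
    open Algebra.Properties.Semiring.Exp K.semiring using (_^_)
    open Weights W
    open Toggleability P K q
    open Sums K
    open IntegerCoefficients K using (solve; _:=_; _:+_; _:*_; _:-_; :-_)
    open import Relation.Binary.Reasoning.Setoid K.setoid

    homomesy : ∀ r N⁻¹ → (let N = sum {2 ℕ.+ maximum rk} (λ s → q ^ toℕ s)) →
               N * N⁻¹ K.≈ 1# → r * N K.≈ sum (λ i → q ^ rk (element i)) →
               ∑T⁻ ≡^q λ _ → r
    -- Substituting a = d - q b gives d⁻¹ (a T⁻ + b T⁺) = T⁻ + d⁻¹ b (T⁺ - q T⁻). The left side sums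
    -- to a constant, so the coefficients are - d⁻¹ b.
    homomesy r N⁻¹ NN⁻¹≈1 rN≈R = (λ p → - (d⁻¹ * b (cell p))) , λ I → K.sym (toggles I)
      where
      N = sum {2 ℕ.+ maximum rk} (λ s → q ^ toℕ s)
      R = sum (λ i → q ^ rk (element i))

      Nb≈dR : N * b bottom K.≈ d * R
      Nb≈dR = K.trans (K.*-congʳ (K.reflexive (cong (λ m → sum {2 ℕ.+ m} (λ s → q ^ toℕ s)) (maximum≡rank rk isRank))))
        (K.trans (RankGenerating.rank-generating K q S W sym-S cellᶠ cellᶠ-injective (cell∈ ∘ element) cellᶠ-surjective)
          (K.*-congˡ (sum-cong-≋ λ i → K.reflexive (cong (q ^_) (≡.sym (rk≡height rk isRank (element i)))))))

      -- Multiplied by the invertible element d N, both sides become d R: the left by the hypothesis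
      -- on r, the right by `Nb≈dR`.
      r≈d⁻¹b : r K.≈ d⁻¹ * b bottom
      r≈d⁻¹b = begin
        r                              ≈⟨ K.*-identityʳ r ⟨
        r * 1#                         ≈⟨ K.*-congˡ NN⁻¹≈1 ⟨
        r * (N * N⁻¹)                  ≈⟨ K.*-identityˡ _ ⟨
        1# * (r * (N * N⁻¹))           ≈⟨ K.*-congʳ inverse ⟨
        d * d⁻¹ * (r * (N * N⁻¹))      ≈⟨ solve 5 (λ d e r N M → d :* e :* (r :* (N :* M)) := e :* (d :* (r :* N)) :* M)
                                            K.refl d d⁻¹ r N N⁻¹ ⟩
        d⁻¹ * (d * (r * N)) * N⁻¹      ≈⟨ K.*-congʳ (K.*-congˡ (K.*-congˡ rN≈R)) ⟩
        d⁻¹ * (d * R) * N⁻¹            ≈⟨ K.*-congʳ (K.*-congˡ Nb≈dR) ⟨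
        d⁻¹ * (N * b bottom) * N⁻¹     ≈⟨ solve 4 (λ e N y M → e :* (N :* y) :* M := e :* y :* (N :* M))
                                            K.refl d⁻¹ N (b bottom) N⁻¹ ⟩
        d⁻¹ * b bottom * (N * N⁻¹)     ≈⟨ K.*-congˡ NN⁻¹≈1 ⟩
        d⁻¹ * b bottom * 1#            ≈⟨ K.*-identityʳ _ ⟩
        d⁻¹ * b bottom                 ∎

      toggles : ∀ I → ∑ₚ (λ p → - (d⁻¹ * b (cell p)) * T^q p I) K.≈ ∑T⁻ I - r
      toggles I = begin
        ∑ₚ (λ p → - (d⁻¹ * b (cell p)) * T^q p I)
          ≈⟨ sum-cong-≋ (λ i → pointwise (element i)) ⟩
        ∑ₚ (λ p → T⁻ p I + - d⁻¹ * ab p)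
          ≈⟨ ∑-distrib-+ (λ i → T⁻ (element i) I) (λ i → - d⁻¹ * ab (element i)) ⟩
        ∑T⁻ I + ∑ₚ (λ p → - d⁻¹ * ab p)
          ≈⟨ K.+-congˡ (*-distribˡ-sum (- d⁻¹) (ab ∘ element)) ⟨
        ∑T⁻ I + - d⁻¹ * ∑ₚ ab
          ≈⟨ K.+-congˡ (K.*-congˡ (sum-cong-≋ λ i → K.reflexive (cong₂ (λ t u → a (cellᶠ i) * 𝟙 t + b (cellᶠ i) * 𝟙 u)
               (maximal-removable I (element i)) (minimal-addable I (element i))))) ⟩
        ∑T⁻ I + - d⁻¹ * sum (λ i → a (cellᶠ i) * 𝟙 (removable (cellᶠ i)) + b (cellᶠ i) * 𝟙 (addable (cellᶠ i)))
          ≈⟨ K.+-congˡ (K.*-congˡ (∑-toggles cellᶠ cellᶠ-injective (cell∈ ∘ element) cellᶠ-surjective)) ⟩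
        ∑T⁻ I + - d⁻¹ * b bottom
          ≈⟨ solve 3 (λ t e y → t :+ :- e :* y := t :- e :* y) K.refl (∑T⁻ I) d⁻¹ (b bottom) ⟩
        ∑T⁻ I - d⁻¹ * b bottom
          ≈⟨ K.+-congˡ (K.-‿cong r≈d⁻¹b) ⟨
        ∑T⁻ I - r ∎
        where
        ab : Carrier → K.Carrier
        ab p = a (cell p) * T⁻ p I + b (cell p) * T⁺ p I
        open CellIdeal S (χ I) (λ {z} → χ⇒In I {z}) (λ {z} {w} → χ-down I {z} {w}) using (removable; addable)
        open Constancy K q S W (χ I) (λ {z} → χ⇒In I {z}) (λ {z} {w} → χ-down I {z} {w}) using (∑-toggles; 𝟙)
        pointwise : ∀ p → - (d⁻¹ * b (cell p)) * T^q p I K.≈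
                    T⁻ p I + - d⁻¹ * (a (cell p) * T⁻ p I + b (cell p) * T⁺ p I)
        pointwise p = begin
          - (d⁻¹ * b (cell p)) * (T⁺ p I - q * T⁻ p I)
            ≈⟨ solve 6 (λ e a b q s t → :- (e :* b) :* (s :- q :* t) := (e :* (a :+ q :* b)) :* t :+ :- e :* (a :* t :+ b :* s))
                 K.refl d⁻¹ (a (cell p)) (b (cell p)) q (T⁺ p I) (T⁻ p I) ⟩
          (d⁻¹ * (a (cell p) + q * b (cell p))) * T⁻ p I + - d⁻¹ * (a (cell p) * T⁻ p I + b (cell p) * T⁺ p I)
            ≈⟨ K.+-congʳ (K.*-congʳ (K.trans (K.*-congˡ (a+qb (cell∈ p))) (K.trans (K.*-comm d⁻¹ d) inverse))) ⟩
          1# * T⁻ p I + - d⁻¹ * (a (cell p) * T⁻ p I + b (cell p) * T⁺ p I)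
            ≈⟨ K.+-congʳ (K.*-identityˡ _) ⟩
          T⁻ p I + - d⁻¹ * (a (cell p) * T⁻ p I + b (cell p) * T⁺ p I) ∎

transport : ∀ {P Q S} → P ≅ Q → Embedding Q S → Embedding P S
transport {P} {Q} (f , iso) E = record
  { cell     = cell ∘ f
  ; monotone = monotone ∘ mono
  ; reflects = cancel ∘ reflects
  ; cell∈    = cell∈ ∘ f
  ; onto     = λ z∈ → let y , e = onto z∈ ; x , fx≈y = surjective y in
      x , ≡.trans (⊑-antisym (monotone (Q.reflexive (fx≈y P.Eq.refl)))
                             (monotone (Q.reflexive (Q.Eq.sym (fx≈y P.Eq.refl))))) e
  }
  where
  open Embedding E
  open IsOrderIsomorphism iso
  module P = Poset P
  module Q = Poset Q

-- Rectangles and shifted staircases.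

rectangleRegion : ℕ → ℕ → Region
rectangleRegion m n = record
  { last = m ; lo = λ _ → 0 ; hi = λ _ → n ; lo-0 = ≡.refl
  ; lo-step = λ _ → z≤n ; hi-step = λ _ → ℕ.≤-refl ; overlaps = λ _ → z≤n }

rectangle-embedding : ∀ m n → Embedding (rectangle (suc m) (suc n)) (rectangleRegion m n)
rectangle-embedding m n = record
  { cell     = λ (i , j) → toℕ i , toℕ j
  ; monotone = λ x≤y → x≤y
  ; reflects = λ x≤y → x≤y
  ; cell∈    = λ (i , j) → Fin.toℕ≤pred[n] i , z≤n , Fin.toℕ≤pred[n] j
  ; onto     = λ (i≤m , _ , j≤n) → (fromℕ< (s≤s i≤m) , fromℕ< (s≤s j≤n)) ,
                 cong₂ _,_ (Fin.toℕ-fromℕ< (s≤s i≤m)) (Fin.toℕ-fromℕ< (s≤s j≤n))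
  }

complement-+ : ∀ {i j m n} → i ≤ m → j ≤ n → (i ℕ.+ j) ℕ.+ ((m ∸ i) ℕ.+ (n ∸ j)) ≡ m ℕ.+ n
complement-+ {i} {j} {m} {n} i≤m j≤n = ≡.trans (ℕ-interchange i j (m ∸ i) (n ∸ j))
  (cong₂ ℕ._+_ (ℕ.m+[n∸m]≡n i≤m) (ℕ.m+[n∸m]≡n j≤n))
  where open import Algebra.Properties.CommutativeSemigroup ℕ.+-commutativeSemigroup renaming (interchange to ℕ-interchange)

complement-antidiagonal : ∀ {i j n} → i ≤ n → j ≤ n → (i ℕ.+ j) ℕ.+ ((n ∸ j) ℕ.+ (n ∸ i)) ≡ n ℕ.+ n
complement-antidiagonal {i} {j} {n} i≤n j≤n =
  ≡.trans (cong ((i ℕ.+ j) ℕ.+_) (ℕ.+-comm (n ∸ j) (n ∸ i))) (complement-+ i≤n j≤n)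

rectangle-symmetry : ∀ m n → Symmetry (rectangleRegion m n)
rectangle-symmetry m n = record
  { σ          = λ (i , j) → m ∸ i , n ∸ j
  ; σ∈         = λ {(i , j)} _ → ℕ.m∸n≤m m i , z≤n , ℕ.m∸n≤m n j
  ; involutive = λ (i≤m , _ , j≤n) → cong₂ _,_ (ℕ.m∸[m∸n]≡n i≤m) (ℕ.m∸[m∸n]≡n j≤n)
  ; complement = λ (i≤m , _ , j≤n) → complement-+ i≤m j≤n
  }

staircaseRegion : ℕ → Region
staircaseRegion n = record
  { last = n ; lo = λ i → i ; hi = λ _ → n ; lo-0 = ≡.refl
  ; lo-step = λ _ → ℕ.n≤1+n _ ; hi-step = λ _ → ℕ.≤-refl ; overlaps = λ i<n → i<n }

staircase-embedding : ∀ n → Embedding (shiftedStaircase (suc n)) (staircaseRegion n)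
staircase-embedding n = record
  { cell     = λ ((i , j) , _) → toℕ i , toℕ j
  ; monotone = λ x≤y → x≤y
  ; reflects = λ x≤y → x≤y
  ; cell∈    = λ ((i , j) , i≤j) → Fin.toℕ≤pred[n] i , i≤j , Fin.toℕ≤pred[n] j
  ; onto     = λ (i≤n , i≤j , j≤n) →
      let i≡ = Fin.toℕ-fromℕ< (s≤s i≤n) ; j≡ = Fin.toℕ-fromℕ< (s≤s j≤n) in
      ((fromℕ< (s≤s i≤n) , fromℕ< (s≤s j≤n)) , ≡.subst₂ _≤_ (≡.sym i≡) (≡.sym j≡) i≤j) , cong₂ _,_ i≡ j≡
  }

-- A half turn would carry the condition i ≤ j to i ≥ j, so heights are reversed by a reflection
-- that exchanges the two coordinates.
staircase-symmetry : ∀ n → Symmetry (staircaseRegion n)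
staircase-symmetry n = record
  { σ          = λ (i , j) → n ∸ j , n ∸ i
  ; σ∈         = λ {(i , j)} (_ , i≤j , _) → ℕ.m∸n≤m n j , ℕ.∸-monoʳ-≤ n i≤j , ℕ.m∸n≤m n i
  ; involutive = λ (i≤n , _ , j≤n) → cong₂ _,_ (ℕ.m∸[m∸n]≡n i≤n) (ℕ.m∸[m∸n]≡n j≤n)
  ; complement = λ (i≤n , _ , j≤n) → complement-antidiagonal i≤n j≤n
  }

-- The only divisibility demanded of the ring: every d below divides a product of such elements.
Units : (K : CommutativeRing 0ℓ 0ℓ) → CommutativeRing.Carrier K → Set
Units K q = ∀ n → ∃[ x ] (1# - q ^ suc n) * x ≈ 1#
  where
  open CommutativeRing K
  open Algebra.Properties.Semiring.Exp semiring using (_^_)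

module ClassicalWeights (K : CommutativeRing 0ℓ 0ℓ) (q : CommutativeRing.Carrier K)
  (units : Units K q)
  where
  open CommutativeRing K hiding (zero)
  open Algebra.Properties.Semiring.Exp semiring using (_^_; ^-homo-*)
  open IntegerCoefficients K using (solve; _:=_; _:+_; _:*_; _:-_; :-_; con; Polynomial)
  open import Relation.Binary.Reasoning.Setoid setoid

  one : ∀ {n} → Polynomial n
  one = con 1ℤ

  _⁻¹₁₋ : ℕ → Carrier
  n ⁻¹₁₋ = proj₁ (units n)

  module Rectangle (m n : ℕ) where
    S = rectangleRegion m n
    open Region S
    open Guards K S

    u v : Carrier
    u = q ^ suc m
    v = q ^ suc n

    -- The equations force b to be affine in q ^ i and q ^ j, up to scaling; that it vanishes at the corners
    -- (m + 1 , 0) and (0 , n + 1) outside the region gives the coefficients.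
    a b : Cell → Carrier
    b (i , j) = q ^ i * (1# - v) + q ^ j * (1# - u) - (1# - u * v)
    a z = - b (z ↑₁₂)

    -- For j > 0 both sides vanish: `z ↑₁`, if inside, has a second lower neighbour, and `a` at that
    -- corner is - b (z ↑₁). For j = 0 only the end i = m is special, and there b (m + 1 , 0) = 0 is
    -- used. Boundary cases thereby drop out of `balance`.
    above₁-below₂ : ∀ {z} → In z → above₁ b z ≈ b (z ↑₁) + below₂ a z
    above₁-below₂ {i , zero} (i≤m , _) = case ℕ.m≤n⇒m<n∨m≡n i≤m of λ where
        (inj₁ i<m) → trans (reflexive (when-in (i<m , z≤n , z≤n))) (sym (+-identityʳ _))
        (inj₂ ≡.refl) → trans (reflexive (when-out {suc m , 0} λ (1+m≤m , _) → ℕ.1+n≰n 1+m≤m))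
          (solve 2 (λ u v → con 0ℤ := u :* (one :- v) :+ one :* (one :- u) :- (one :- u :* v) :+ con 0ℤ) refl u v)
    above₁-below₂ {i , suc j} (i≤m , _ , j<n) = begin
      when (suc i , suc j) (unless (suc i , j) (b (suc i , suc j)))
        ≈⟨ vanish ⟩
      0#
        ≈⟨ -‿inverseʳ _ ⟨
      b (suc i , suc j) + a (i , j)
        ≡⟨ cong (λ t → b (suc i , suc j) + t) (when-in (i≤m , z≤n , ℕ.<⇒≤ j<n)) ⟨
      b (suc i , suc j) + below₂ a (i , suc j) ∎
      where
      vanish : when (suc i , suc j) (unless (suc i , j) (b (suc i , suc j))) ≈ 0#
      vanish = case In? (suc i , suc j) of λ where
        (yes z∈@(i<m , _)) → reflexive (≡.trans (when-in z∈) (unless-in (i<m , z≤n , ℕ.<⇒≤ j<n)))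
        (no z∉)            → reflexive (when-out z∉)

    above₂-below₁ : ∀ {z} → In z → above₂ b z ≈ b (z ↑₂) + below₁ a z
    above₂-below₁ {zero , j} (_ , _ , j≤n) = case ℕ.m≤n⇒m<n∨m≡n j≤n of λ where
        (inj₁ j<n) → trans (reflexive (when-in (z≤n , z≤n , j<n))) (sym (+-identityʳ _))
        (inj₂ ≡.refl) → trans (reflexive (when-out {0 , suc n} λ (_ , _ , 1+n≤n) → ℕ.1+n≰n 1+n≤n))
          (solve 2 (λ u v → con 0ℤ := one :* (one :- v) :+ v :* (one :- u) :- (one :- u :* v) :+ con 0ℤ) refl u v)
    above₂-below₁ {suc i , j} (i<m , _ , j≤n) = begin
      when (suc i , suc j) (unless (i , suc j) (b (suc i , suc j)))
        ≈⟨ vanish ⟩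
      0#
        ≈⟨ -‿inverseʳ _ ⟨
      b (suc i , suc j) + a (i , j)
        ≡⟨ cong (λ t → b (suc i , suc j) + t) (when-in (ℕ.<⇒≤ i<m , z≤n , j≤n)) ⟨
      b (suc i , suc j) + below₁ a (suc i , j) ∎
      where
      vanish : when (suc i , suc j) (unless (i , suc j) (b (suc i , suc j))) ≈ 0#
      vanish = case In? (suc i , suc j) of λ where
        (yes z∈@(_ , _ , j<n)) → reflexive (≡.trans (when-in z∈) (unless-in (ℕ.<⇒≤ i<m , z≤n , j<n)))
        (no z∉)                → reflexive (when-out z∉)

    weights : Weights K q S
    weights = record
      { a = a
      ; b = b
      ; d = (1# - q) * (1# - u * v)
      -- Index k denotes the inverse of 1 - q^(k+1), and u v = q^(m+n+2), so the two indices are 0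
      -- and m + n + 1.
      ; d⁻¹ = 0 ⁻¹₁₋ * (m ℕ.+ suc n) ⁻¹₁₋
      ; inverse = inverse
      ; a+qb = λ {(i , j)} _ → solve 5 (λ q x y u v →
          :- (q :* x :* (one :- v) :+ q :* y :* (one :- u) :- (one :- u :* v)) :+
            q :* (x :* (one :- v) :+ y :* (one :- u) :- (one :- u :* v)) :=
          (one :- q) :* (one :- u :* v)) refl q (q ^ i) (q ^ j) u v
      ; balance = balance
      ; antidiagonal = λ _ _ _ → -‿inverseˡ _
      }
      where
      inverse : (1# - q) * (1# - u * v) * (0 ⁻¹₁₋ * (m ℕ.+ suc n) ⁻¹₁₋) ≈ 1#
      inverse = begin
        (1# - q) * (1# - u * v) * (0 ⁻¹₁₋ * (m ℕ.+ suc n) ⁻¹₁₋)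
          ≈⟨ *-congʳ (*-cong (+-congˡ (-‿cong (*-identityʳ q))) (+-congˡ (-‿cong (^-homo-* q (suc m) (suc n))))) ⟨
        (1# - q ^ 1) * (1# - q ^ (suc m ℕ.+ suc n)) * (0 ⁻¹₁₋ * (m ℕ.+ suc n) ⁻¹₁₋)
          ≈⟨ solve 4 (λ x y z w → x :* y :* (z :* w) := (x :* z) :* (y :* w)) refl _ _ _ _ ⟩
        ((1# - q ^ 1) * 0 ⁻¹₁₋) * ((1# - q ^ (suc m ℕ.+ suc n)) * (m ℕ.+ suc n) ⁻¹₁₋)
          ≈⟨ *-cong (proj₂ (units 0)) (proj₂ (units (m ℕ.+ suc n))) ⟩
        1# * 1#
          ≈⟨ *-identityˡ 1# ⟩
        1# ∎
      balance : ∀ {z} → In z → a z + (above₁ b z + above₂ b z) ≈ b z + (below₁ a z + below₂ a z)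
      balance {z@(i , j)} z∈ = begin
        a z + (above₁ b z + above₂ b z)
          ≈⟨ +-congˡ (+-cong (above₁-below₂ z∈) (above₂-below₁ z∈)) ⟩
        a z + ((b (z ↑₁) + below₂ a z) + (b (z ↑₂) + below₁ a z))
          ≈⟨ solve 5 (λ a b₁ b₂ l₁ l₂ → a :+ ((b₁ :+ l₂) :+ (b₂ :+ l₁)) := (a :+ (b₁ :+ b₂)) :+ (l₁ :+ l₂)) refl
               (a z) (b (z ↑₁)) (b (z ↑₂)) _ _ ⟩
        (a z + (b (z ↑₁) + b (z ↑₂))) + (below₁ a z + below₂ a z)
          -- What remains is that the mixed second difference of b is zero, true for any sum of a
          -- function of i and a function of j.
          ≈⟨ +-congʳ (solve 5 (λ q x y u v →
               let B = λ x y → x :* (one :- v) :+ y :* (one :- u) :- (one :- u :* v) in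
               :- B (q :* x) (q :* y) :+ (B (q :* x) y :+ B x (q :* y)) := B x y) refl q (q ^ i) (q ^ j) u v) ⟩
        b z + (below₁ a z + below₂ a z) ∎

  module Staircase (n : ℕ) where
    S = staircaseRegion n
    open Region S
    open Guards K S

    v : Carrier
    v = q ^ suc n

    -- Of the same separated form as for the rectangle, with the constant fixed by vanishing at (0 ,
    -- n + 1). The factor 1 + q clears the denominator of the values on the diagonal.
    offᵃ offᵇ : Cell → Carrier
    offᵇ (i , j) = (1# + q) * (q ^ i + q ^ j - (1# + v))
    offᵃ z       = - offᵇ (z ↑₁₂)

    -- No unit square has its bottom or top corner on the diagonal, so `antidiagonal` says nothing
    -- here. Instead `balance` at (i , i) amounts to `diagᵃ i` + `offᵇ (i , suc i)` = `diagᵇ i`, and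
    -- together with a + q b = d this determines both values.
    diagᵃ diagᵇ : ℕ → Carrier
    diagᵃ i = 1# + v - (q ^ suc i + q ^ suc (suc i))
    diagᵇ i = q ^ i + q ^ suc i - q * (1# + v)

    a b : Cell → Carrier
    a (i , j) = if does (i ℕ.≟ j) then diagᵃ i else offᵃ (i , j)
    b (i , j) = if does (i ℕ.≟ j) then diagᵇ i else offᵇ (i , j)

    a-diag : ∀ i → a (i , i) ≡ diagᵃ i
    a-diag i = cong (if_then diagᵃ i else offᵃ (i , i)) (dec-true (i ℕ.≟ i) ≡.refl)

    b-diag : ∀ i → b (i , i) ≡ diagᵇ i
    b-diag i = cong (if_then diagᵇ i else offᵇ (i , i)) (dec-true (i ℕ.≟ i) ≡.refl)

    a-off : ∀ {i j} → i < j → a (i , j) ≡ offᵃ (i , j)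
    a-off {i} {j} i<j = cong (if_then diagᵃ i else offᵃ (i , j)) (dec-false (i ℕ.≟ j) (ℕ.<⇒≢ i<j))

    b-off : ∀ {i j} → i < j → b (i , j) ≡ offᵇ (i , j)
    b-off {i} {j} i<j = cong (if_then diagᵇ i else offᵇ (i , j)) (dec-false (i ℕ.≟ j) (ℕ.<⇒≢ i<j))

    -- Serves the cell (i , i + 1), where `_↑₁` leads to a diagonal cell with no other lower
    -- neighbour. It replaces the cancellation of b against a that holds away from the diagonal.
    diag-shift : ∀ i → diagᵇ (suc i) ≈ offᵇ (suc i , suc i) + diagᵃ i
    diag-shift i = solve 3 (λ q x v →
      q :* x :+ q :* (q :* x) :- q :* (one :+ v) :=
      (one :+ q) :* (q :* x :+ q :* x :- (one :+ v)) :+ (one :+ v :- (q :* x :+ q :* (q :* x)))) refl q (q ^ i) v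

    above₁-below₂ : ∀ {i j} → In (i , j) → i < j → above₁ b (i , j) ≈ offᵇ (suc i , j) + below₂ a (i , j)
    above₁-below₂ {i} {suc j} (i≤n , _ , j<n) (s≤s i≤j) = case ℕ.m≤n⇒m<n∨m≡n i≤j of λ where
      (inj₂ ≡.refl) → begin
        when (suc i , suc i) (unless (suc i , i) (b (suc i , suc i)))
          ≡⟨ ≡.trans (when-in (j<n , ℕ.≤-refl , j<n)) (unless-out {suc i , i} λ (_ , 1+i≤i , _) → ℕ.1+n≰n 1+i≤i) ⟩
        b (suc i , suc i)
          ≡⟨ b-diag (suc i) ⟩
        diagᵇ (suc i)
          ≈⟨ diag-shift i ⟩
        offᵇ (suc i , suc i) + diagᵃ i
          ≡⟨ cong (λ t → offᵇ (suc i , suc i) + t) (≡.trans (when-in (i≤n , ℕ.≤-refl , i≤n)) (a-diag i)) ⟨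
        offᵇ (suc i , suc i) + when (i , i) (a (i , i)) ∎
      (inj₁ i<j) → begin
        when (suc i , suc j) (unless (suc i , j) (b (suc i , suc j)))
          ≡⟨ ≡.trans (when-in (ℕ.≤-trans (s≤s i≤j) j<n , s≤s i≤j , j<n))
               (unless-in (ℕ.≤-trans (s≤s i≤j) j<n , i<j , ℕ.<⇒≤ j<n)) ⟩
        0#
          ≈⟨ -‿inverseʳ _ ⟨
        offᵇ (suc i , suc j) + offᵃ (i , j)
          ≡⟨ cong (λ t → offᵇ (suc i , suc j) + t) (≡.trans (when-in (i≤n , i≤j , ℕ.<⇒≤ j<n)) (a-off i<j)) ⟨
        offᵇ (suc i , suc j) + when (i , j) (a (i , j)) ∎

    above₂-below₁ : ∀ {i j} → In (i , j) → above₂ b (i , j) ≈ offᵇ (i , suc j) + below₁ a (i , j)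
    above₂-below₁ {zero} {j} (_ , _ , j≤n) = case ℕ.m≤n⇒m<n∨m≡n j≤n of λ where
      (inj₁ j<n) → trans (reflexive (when-in (z≤n , z≤n , j<n))) (sym (+-identityʳ _))
      (inj₂ ≡.refl) → trans (reflexive (when-out {0 , suc n} λ (_ , _ , 1+n≤n) → ℕ.1+n≰n 1+n≤n))
        (solve 2 (λ q v → con 0ℤ := (one :+ q) :* (one :+ v :- (one :+ v)) :+ con 0ℤ) refl q v)
    above₂-below₁ {suc i} {j} (i<n , i<j , j≤n) = begin
      when (suc i , suc j) (unless (i , suc j) (b (suc i , suc j)))
        ≈⟨ vanish ⟩
      0#
        ≈⟨ -‿inverseʳ _ ⟨
      offᵇ (suc i , suc j) + offᵃ (i , j)
        ≡⟨ cong (λ t → offᵇ (suc i , suc j) + t) (≡.trans (when-in (ℕ.<⇒≤ i<n , ℕ.<⇒≤ i<j , j≤n)) (a-off i<j)) ⟨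
      offᵇ (suc i , suc j) + when (i , j) (a (i , j)) ∎
      where
      vanish : when (suc i , suc j) (unless (i , suc j) (b (suc i , suc j))) ≈ 0#
      vanish = case In? (suc i , suc j) of λ where
        (yes z∈@(_ , 1+i≤1+j , j<n)) → reflexive (≡.trans (when-in z∈) (unless-in (ℕ.<⇒≤ i<n , ℕ.<⇒≤ 1+i≤1+j , j<n)))
        (no z∉)                      → reflexive (when-out z∉)

    balance-off : ∀ {i j} → In (i , j) → i < j →
      a (i , j) + (above₁ b (i , j) + above₂ b (i , j)) ≈ b (i , j) + (below₁ a (i , j) + below₂ a (i , j))
    balance-off {i} {j} z∈ i<j = begin
      a (i , j) + (above₁ b (i , j) + above₂ b (i , j))
        ≈⟨ +-cong (reflexive (a-off i<j)) (+-cong (above₁-below₂ z∈ i<j) (above₂-below₁ z∈)) ⟩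
      offᵃ (i , j) + ((offᵇ (suc i , j) + below₂ a (i , j)) + (offᵇ (i , suc j) + below₁ a (i , j)))
        ≈⟨ solve 6 (λ q x y v l₁ l₂ →
             let B = λ x y → (one :+ q) :* (x :+ y :- (one :+ v)) in
             :- B (q :* x) (q :* y) :+ ((B (q :* x) y :+ l₂) :+ (B x (q :* y) :+ l₁)) := B x y :+ (l₁ :+ l₂))
             refl q (q ^ i) (q ^ j) v (below₁ a (i , j)) (below₂ a (i , j)) ⟩
      offᵇ (i , j) + (below₁ a (i , j) + below₂ a (i , j))
        ≡⟨ cong (λ t → t + (below₁ a (i , j) + below₂ a (i , j))) (b-off i<j) ⟨
      b (i , j) + (below₁ a (i , j) + below₂ a (i , j)) ∎

    balance-diag : ∀ {i} → In (i , i) →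
      a (i , i) + (above₁ b (i , i) + above₂ b (i , i)) ≈ b (i , i) + (below₁ a (i , i) + below₂ a (i , i))
    balance-diag {i} z∈ = begin
      a (i , i) + (above₁ b (i , i) + above₂ b (i , i))
        ≈⟨ +-cong (reflexive (a-diag i))
             (+-cong (reflexive (when-out {suc i , i} λ (_ , 1+i≤i , _) → ℕ.1+n≰n 1+i≤i)) (above₂-below₁ z∈)) ⟩
      diagᵃ i + (0# + (offᵇ (i , suc i) + below₁ a (i , i)))
        ≈⟨ solve 4 (λ q x v l → one :+ v :- (q :* x :+ q :* (q :* x)) :+ (con 0ℤ :+ ((one :+ q) :* (x :+ q :* x :- (one :+ v)) :+ l)) :=
             x :+ q :* x :- q :* (one :+ v) :+ (l :+ con 0ℤ)) refl q (q ^ i) v (below₁ a (i , i)) ⟩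
      diagᵇ i + (below₁ a (i , i) + 0#)
        ≈⟨ +-cong (reflexive (≡.sym (b-diag i))) (+-congˡ (sym (no-below i))) ⟩
      b (i , i) + (below₁ a (i , i) + below₂ a (i , i)) ∎
      where
      no-below : ∀ i → below₂ a (i , i) ≈ 0#
      no-below zero    = refl
      no-below (suc i) = reflexive (when-out {suc i , i} λ (_ , 1+i≤i , _) → ℕ.1+n≰n 1+i≤i)

    weights : Weights K q S
    weights = record
      { a = a
      ; b = b
      ; d = (1# - q * q) * (1# + v)
      -- The factor 1 + v is inverted through (1 + v) (1 - v) = 1 - q^(2n+2).
      ; d⁻¹ = 1 ⁻¹₁₋ * ((1# - v) * (n ℕ.+ suc n) ⁻¹₁₋)
      ; inverse = inverse
      ; a+qb = a+qb
      ; balance = λ { {i , j} z∈@(_ , i≤j , _) → case ℕ.m≤n⇒m<n∨m≡n i≤j of λ where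
          (inj₁ i<j)    → balance-off z∈ i<j
          (inj₂ ≡.refl) → balance-diag z∈ }
      ; antidiagonal = λ { {i , j} _ (_ , i<j , _) _ →
          trans (+-cong (reflexive (a-off i<j)) (reflexive (b-off (s≤s i<j)))) (-‿inverseˡ _) }
      }
      where
      inverse : (1# - q * q) * (1# + v) * (1 ⁻¹₁₋ * ((1# - v) * (n ℕ.+ suc n) ⁻¹₁₋)) ≈ 1#
      inverse = begin
        (1# - q * q) * (1# + v) * (1 ⁻¹₁₋ * ((1# - v) * (n ℕ.+ suc n) ⁻¹₁₋))
          ≈⟨ solve 4 (λ q v x y → (one :- q :* q) :* (one :+ v) :* (x :* ((one :- v) :* y)) :=
               ((one :- q :* (q :* one)) :* x) :* ((one :- v :* v) :* y)) refl q v _ _ ⟩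
        ((1# - q ^ 2) * 1 ⁻¹₁₋) * ((1# - v * v) * (n ℕ.+ suc n) ⁻¹₁₋)
          ≈⟨ *-congˡ (*-congʳ (+-congˡ (-‿cong (^-homo-* q (suc n) (suc n))))) ⟨
        ((1# - q ^ 2) * 1 ⁻¹₁₋) * ((1# - q ^ (suc n ℕ.+ suc n)) * (n ℕ.+ suc n) ⁻¹₁₋)
          ≈⟨ *-cong (proj₂ (units 1)) (proj₂ (units (n ℕ.+ suc n))) ⟩
        1# * 1#
          ≈⟨ *-identityˡ 1# ⟩
        1# ∎
      a+qb : ∀ {z} → In z → a z + q * b z ≈ (1# - q * q) * (1# + v)
      a+qb {i , j} (_ , i≤j , _) = case ℕ.m≤n⇒m<n∨m≡n i≤j of λ where
        (inj₁ i<j) → trans (+-cong (reflexive (a-off i<j)) (*-congˡ (reflexive (b-off i<j))))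
          (solve 4 (λ q x y v → let B = λ x y → (one :+ q) :* (x :+ y :- (one :+ v)) in
            :- B (q :* x) (q :* y) :+ q :* B x y := (one :- q :* q) :* (one :+ v)) refl q (q ^ i) (q ^ j) v)
        (inj₂ ≡.refl) → trans (+-cong (reflexive (a-diag i)) (*-congˡ (reflexive (b-diag i))))
          (solve 3 (λ q x v → one :+ v :- (q :* x :+ q :* (q :* x)) :+ q :* (x :+ q :* x :- q :* (one :+ v)) :=
            (one :- q :* q) :* (one :+ v)) refl q (q ^ i) v)

-- Double-tailed diamonds.

-- Two rows: x₁ < ⋯ < xₙ₋₁ < y₁ below y₂ < zₙ₋₁ < ⋯ < z₁, where n = m + 2.
diamondRegion : ℕ → Region
diamondRegion m = record
  { last = 1 ; lo = lo ; hi = hi ; lo-0 = ≡.refl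
  ; lo-step  = λ { {zero} _ → z≤n ; {suc _} _ → ℕ.≤-refl }
  ; hi-step  = λ { {zero} _ → ℕ.m≤n+m (suc m) m ; {suc _} _ → ℕ.≤-refl }
  ; overlaps = λ { {zero} _ → ℕ.n≤1+n m ; {suc _} (s≤s ()) }
  }
  where
  lo hi : ℕ → ℕ
  lo zero    = 0
  lo (suc _) = m
  hi zero    = suc m
  hi (suc _) = m ℕ.+ suc m

data DiamondCell (m : ℕ) : Cell → Set where
  x-cell  : ∀ {j} → j ≤ m → DiamondCell m (0 , j)
  y₁-cell : DiamondCell m (0 , suc m)
  y₂-cell : DiamondCell m (1 , m)
  z-cell  : ∀ {t} → t ≤ m → DiamondCell m (1 , t ℕ.+ suc m)

diamondCell : ∀ {m w} → Region.In (diamondRegion m) w → DiamondCell m w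
diamondCell {m} {zero , j} (_ , _ , j≤) = case ℕ.m≤n⇒m<n∨m≡n j≤ of λ where
  (inj₁ (s≤s j≤m)) → x-cell j≤m
  (inj₂ ≡.refl)    → y₁-cell
diamondCell {m} {suc zero , j} (_ , m≤j , j≤) = case ℕ.m≤n⇒m<n∨m≡n m≤j of λ where
  (inj₂ ≡.refl) → y₂-cell
  (inj₁ m<j)    → subst (λ j → DiamondCell m (1 , j)) (ℕ.m∸n+n≡m m<j)
    (z-cell (ℕ.≤-trans (ℕ.∸-monoˡ-≤ (suc m) j≤) (ℕ.≤-reflexive (ℕ.m+n∸n≡m m (suc m)))))
diamondCell {m} {suc (suc i) , j} (s≤s () , _)

diamond-embedding : ∀ m → Embedding (doubleTailedDiamond (suc (suc m))) (diamondRegion m)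
diamond-embedding m = record
  { cell     = cell
  ; monotone = λ {p} {r} → monotone {p} {r}
  ; reflects = λ {p} {r} → reflects p r
  ; cell∈    = cell∈
  ; onto     = onto ∘ diamondCell
  }
  where
  open Region (diamondRegion m)
  open Poset (doubleTailedDiamond (suc (suc m))) using (Carrier) renaming (_≤_ to _≼_)

  cell : Carrier → Cell
  cell (inj₁ i)                = 0 , toℕ i
  cell (inj₂ (inj₁ false))     = 0 , suc m
  cell (inj₂ (inj₁ true))      = 1 , m
  cell (inj₂ (inj₂ k))         = 1 , (m ∸ toℕ k) ℕ.+ suc m

  toℕ≤ : (i : Fin (suc m)) → toℕ i ≤ m
  toℕ≤ = Fin.toℕ≤pred[n]

  monotone : ∀ {p r} → p ≼ r → cell p ⊑ cell r
  monotone {inj₁ i} {inj₂ (inj₁ false)} _ = z≤n , ℕ.m≤n⇒m≤1+n (toℕ≤ i)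
  monotone {inj₁ i} {inj₂ (inj₁ true)}  _ = z≤n , toℕ≤ i
  monotone {inj₁ i} {inj₂ (inj₂ k)}     _ = z≤n , ℕ.≤-trans (ℕ.m≤n⇒m≤1+n (toℕ≤ i)) (ℕ.m≤n+m (suc m) _)
  monotone (₁∼₁ i≤k)            = z≤n , i≤k
  monotone {inj₂ (inj₁ false)} {inj₂ (inj₂ k)} (₂∼₂ ₁∼₂) = z≤n , ℕ.m≤n+m (suc m) _
  monotone {inj₂ (inj₁ true)}  {inj₂ (inj₂ k)} (₂∼₂ ₁∼₂) = ℕ.≤-refl , ℕ.≤-trans (ℕ.n≤1+n m) (ℕ.m≤n+m (suc m) _)
  monotone (₂∼₂ (₁∼₁ ≡.refl))   = ⊑-reflexive ≡.refl
  monotone (₂∼₂ (₂∼₂ k≤i))      = ℕ.≤-refl , ℕ.+-monoˡ-≤ (suc m) (ℕ.∸-monoʳ-≤ m k≤i)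

  reflects : ∀ p r → cell p ⊑ cell r → p ≼ r
  reflects (inj₁ i) (inj₁ k) (_ , i≤k) = ₁∼₁ i≤k
  reflects (inj₁ i) (inj₂ r) _         = ₁∼₂
  reflects (inj₂ (inj₁ false)) (inj₁ k) (_ , 1+m≤k) = contradiction (ℕ.≤-trans 1+m≤k (toℕ≤ k)) ℕ.1+n≰n
  reflects (inj₂ (inj₁ false)) (inj₂ (inj₁ false)) _ = ₂∼₂ (₁∼₁ ≡.refl)
  reflects (inj₂ (inj₁ false)) (inj₂ (inj₁ true)) (_ , 1+m≤m) = contradiction 1+m≤m ℕ.1+n≰n
  reflects (inj₂ (inj₁ true)) (inj₂ (inj₁ false)) (() , _)
  reflects (inj₂ (inj₁ true)) (inj₂ (inj₁ true)) _ = ₂∼₂ (₁∼₁ ≡.refl)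
  reflects (inj₂ (inj₁ _)) (inj₂ (inj₂ k)) _ = ₂∼₂ ₁∼₂
  reflects (inj₂ (inj₂ i)) (inj₂ (inj₁ true)) (_ , h) = contradiction (ℕ.≤-trans (ℕ.m≤n+m (suc m) _) h) ℕ.1+n≰n
  reflects (inj₂ (inj₂ i)) (inj₂ (inj₂ k)) (_ , h) =
    ₂∼₂ (₂∼₂ (ℕ.∸-cancelʳ-≤ (toℕ≤ k) (ℕ.+-cancelʳ-≤ (suc m) _ _ h)))

  cell∈ : ∀ p → In (cell p)
  cell∈ (inj₁ i)            = z≤n , z≤n , ℕ.m≤n⇒m≤1+n (toℕ≤ i)
  cell∈ (inj₂ (inj₁ false)) = z≤n , z≤n , ℕ.≤-refl
  cell∈ (inj₂ (inj₁ true))  = ℕ.≤-refl , ℕ.≤-refl , ℕ.m≤m+n m (suc m)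
  cell∈ (inj₂ (inj₂ k))     = ℕ.≤-refl , ℕ.≤-trans (ℕ.n≤1+n m) (ℕ.m≤n+m (suc m) _) , ℕ.+-monoˡ-≤ (suc m) (ℕ.m∸n≤m m (toℕ k))

  onto : ∀ {w} → DiamondCell m w → ∃[ p ] cell p ≡ w
  onto (x-cell j≤m)     = inj₁ (fromℕ< (s≤s j≤m)) , cong (0 ,_) (Fin.toℕ-fromℕ< (s≤s j≤m))
  onto y₁-cell          = inj₂ (inj₁ false) , ≡.refl
  onto y₂-cell          = inj₂ (inj₁ true) , ≡.refl
  onto (z-cell {t} t≤m) = inj₂ (inj₂ (fromℕ< (s≤s (ℕ.m∸n≤m m t)))) ,
    cong (λ k → 1 , k ℕ.+ suc m) (≡.trans (cong (m ∸_) (Fin.toℕ-fromℕ< (s≤s (ℕ.m∸n≤m m t)))) (ℕ.m∸[m∸n]≡n t≤m))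

diamond-symmetry : ∀ m → Symmetry (diamondRegion m)
diamond-symmetry m = record
  { σ = σ ; σ∈ = σ∈
  ; involutive = λ z∈@(i≤1 , _) → cong₂ _,_ (ℕ.m∸[m∸n]≡n i≤1) (ℕ.m∸[m∸n]≡n (j≤ z∈))
  ; complement = λ z∈@(i≤1 , _) → complement-+ i≤1 (j≤ z∈)
  }
  where
  open Region (diamondRegion m)
  σ : Cell → Cell
  σ (i , j) = 1 ∸ i , (m ℕ.+ suc m) ∸ j
  j≤ : ∀ {i j} → In (i , j) → j ≤ m ℕ.+ suc m
  j≤ {zero}  (_ , _ , j≤) = ℕ.≤-trans j≤ (ℕ.m≤n+m (suc m) m)
  j≤ {suc i} (_ , _ , j≤) = j≤
  σ∈ : ∀ {w} → In w → In (σ w)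
  σ∈ {zero , j} (_ , _ , j≤) = ℕ.≤-refl ,
    ℕ.≤-trans (ℕ.≤-reflexive (≡.sym (ℕ.m+n∸n≡m m (suc m)))) (ℕ.∸-monoʳ-≤ (m ℕ.+ suc m) j≤) , ℕ.m∸n≤m _ j
  σ∈ {suc zero , j} (_ , m≤j , _) = z≤n , z≤n ,
    ℕ.≤-trans (ℕ.∸-monoʳ-≤ (m ℕ.+ suc m) m≤j) (ℕ.≤-reflexive (ℕ.m+n∸m≡n m (suc m)))
  σ∈ {suc (suc i) , j} (s≤s () , _)

module DiamondWeights (K : CommutativeRing 0ℓ 0ℓ) (q : CommutativeRing.Carrier K)
  (units : Units K q)
  (m : ℕ)
  where
  open CommutativeRing K hiding (zero)
  open Algebra.Properties.Semiring.Exp semiring using (_^_; ^-homo-*)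
  open IntegerCoefficients K using (solve; _:=_; _:+_; _:*_; _:-_; :-_; con; Polynomial)
  open import Relation.Binary.Reasoning.Setoid setoid

  S = diamondRegion m
  open Region S
  open Guards K S

  one : ∀ {n} → Polynomial n
  one = con 1ℤ

  v : Carrier
  v = q ^ suc m

  -- There is only one unit square. Along each tail, `a` at a cell plus `b` at the next is 1 + v. At
  -- the top no next cell exists, so the value v - q^(m+1) that it would carry must vanish; this
  -- explains v = q^(m+1).
  a b : Cell → Carrier
  a (zero  , j) = if does (j ≤? m) then 1# - q ^ suc j else 1#
  a (suc _ , j) = if does (j ≤? m) then 1# else 1# + q ^ (j ∸ m)
  b (zero  , j) = if does (j ≤? m) then v + q ^ j else v
  b (suc _ , j) = if does (j ≤? m) then v else v - q ^ (j ∸ suc m)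

  if-≤ : ∀ {j} {s t : Carrier} → j ≤ m → (if does (j ≤? m) then s else t) ≡ s
  if-≤ {j} {s} {t} j≤m = cong (if_then s else t) (dec-true (j ≤? m) j≤m)

  if-> : ∀ {j} {s t : Carrier} → m < j → (if does (j ≤? m) then s else t) ≡ t
  if-> {j} {s} {t} m<j = cong (if_then s else t) (dec-false (j ≤? m) (ℕ.<⇒≱ m<j))

  m< : ∀ t → m < t ℕ.+ suc m
  m< t = ℕ.m≤n+m (suc m) t

  a-z : ∀ t → a (1 , t ℕ.+ suc m) ≡ 1# + q ^ suc t
  a-z t = ≡.trans (if-> (m< t)) (cong (λ k → 1# + q ^ k) (≡.trans (cong (_∸ m) (ℕ.+-suc t m)) (ℕ.m+n∸n≡m (suc t) m)))

  b-z : ∀ t → b (1 , t ℕ.+ suc m) ≡ v - q ^ t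
  b-z t = ≡.trans (if-> (m< t)) (cong (λ k → v - q ^ k) (ℕ.m+n∸n≡m t (suc m)))

  out₀ : ∀ {j} → suc m < j → ¬ In (0 , j)
  out₀ m<j (_ , _ , j≤) = ℕ.<⇒≱ m<j j≤

  out₁ : ∀ {j} → j < m → ¬ In (1 , j)
  out₁ j<m (_ , m≤j , _) = ℕ.<⇒≱ j<m m≤j

  in₀ : ∀ {j} → j ≤ suc m → In (0 , j)
  in₀ j≤ = z≤n , z≤n , j≤

  in₁ : ∀ {t} → t ≤ m → In (1 , t ℕ.+ suc m)
  in₁ {t} t≤m = ℕ.≤-refl , ℕ.<⇒≤ (m< t) , ℕ.+-monoˡ-≤ (suc m) t≤m

  in-y₂ : In (1 , m)
  in-y₂ = ℕ.≤-refl , ℕ.≤-refl , ℕ.m≤m+n m (suc m)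

  unless-left : ∀ j {s} → j ≤ m → unlessM ((1 , j) ↓₂) s ≡ s
  unless-left zero    _    = ≡.refl
  unless-left (suc j) j<m  = unless-out {1 , j} (out₁ j<m)

  -- The chains carry the constant 1 + v on both sides of the balance equation.
  upper : ∀ {w} → DiamondCell m w → Carrier
  upper (x-cell _) = 1# + v
  upper y₁-cell    = 1#
  upper y₂-cell    = 1#
  upper (z-cell _) = 1# + v

  above-upper : ∀ {w} (w∈ : DiamondCell m w) → a w + (above₁ b w + above₂ b w) ≈ upper w∈
  above-upper (x-cell {j} j≤m) = case ℕ.m≤n⇒m<n∨m≡n j≤m of λ where
    (inj₁ j<m) → begin
      a (0 , j) + (above₁ b (0 , j) + above₂ b (0 , j))
        ≡⟨ cong₂ _+_ (if-≤ j≤m) (cong₂ _+_ (when-out {1 , j} (out₁ j<m)) (≡.trans (when-in (in₀ (s≤s j≤m))) (if-≤ j<m))) ⟩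
      1# - q ^ suc j + (0# + (v + q ^ suc j))
        ≈⟨ solve 2 (λ s v → one :- s :+ (con 0ℤ :+ (v :+ s)) := one :+ v) refl (q ^ suc j) v ⟩
      1# + v ∎
    (inj₂ ≡.refl) → begin
      a (0 , m) + (above₁ b (0 , m) + above₂ b (0 , m))
        ≡⟨ cong₂ _+_ (if-≤ j≤m) (cong₂ _+_ (≡.trans (when-in in-y₂) (≡.trans (unless-left m ℕ.≤-refl) (if-≤ j≤m)))
             (≡.trans (when-in (in₀ ℕ.≤-refl)) (if-> (m< 0)))) ⟩
      1# - v + (v + v)
        ≈⟨ solve 1 (λ v → one :- v :+ (v :+ v) := one :+ v) refl v ⟩
      1# + v ∎
  above-upper y₁-cell = begin
    a (0 , suc m) + (above₁ b (0 , suc m) + above₂ b (0 , suc m))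
      ≡⟨ cong₂ _+_ (if-> (m< 0)) (cong₂ _+_ (≡.trans (when-in (in₁ z≤n)) (unless-in in-y₂)) (when-out (out₀ ℕ.≤-refl))) ⟩
    1# + (0# + 0#)
      ≈⟨ trans (+-congˡ (+-identityˡ 0#)) (+-identityʳ 1#) ⟩
    1# ∎
  above-upper y₂-cell = begin
    a (1 , m) + (above₁ b (1 , m) + above₂ b (1 , m))
      ≡⟨ cong₂ _+_ (if-≤ ℕ.≤-refl) (cong₂ _+_ ≡.refl (≡.trans (when-in (in₁ z≤n)) (unless-in (in₀ ℕ.≤-refl)))) ⟩
    1# + (0# + 0#)
      ≈⟨ trans (+-congˡ (+-identityˡ 0#)) (+-identityʳ 1#) ⟩
    1# ∎
  above-upper (z-cell {t} t≤m) = begin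
    a (1 , t ℕ.+ suc m) + (above₁ b (1 , t ℕ.+ suc m) + above₂ b (1 , t ℕ.+ suc m))
      ≈⟨ +-cong (reflexive (a-z t)) (+-cong refl next) ⟩
    1# + q ^ suc t + (0# + (v - q ^ suc t))
      ≈⟨ solve 2 (λ s v → one :+ s :+ (con 0ℤ :+ (v :- s)) := one :+ v) refl (q ^ suc t) v ⟩
    1# + v ∎
    where
    next : above₂ b (1 , t ℕ.+ suc m) ≈ v - q ^ suc t
    next = case ℕ.m≤n⇒m<n∨m≡n t≤m of λ where
      (inj₁ t<m) → reflexive (≡.trans (when-in (in₁ t<m)) (≡.trans (unless-out (out₀ (s≤s (m< t)))) (b-z (suc t))))
      (inj₂ ≡.refl) → trans (reflexive (when-out {1 , suc t ℕ.+ suc m} λ (_ , _ , h) → ℕ.1+n≰n h)) (sym (-‿inverseʳ v))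

  below-upper : ∀ {w} (w∈ : DiamondCell m w) → b w + (below₁ a w + below₂ a w) ≈ upper w∈
  below-upper (x-cell {zero} _) = solve 1 (λ v → v :+ one :+ (con 0ℤ :+ con 0ℤ) := one :+ v) refl v
  below-upper (x-cell {suc j} j<m) = begin
    b (0 , suc j) + (0# + below₂ a (0 , suc j))
      ≡⟨ cong₂ (λ s t → s + (0# + t)) (if-≤ j<m) (≡.trans (when-in (in₀ (ℕ.m≤n⇒m≤1+n (ℕ.<⇒≤ j<m)))) (if-≤ (ℕ.<⇒≤ j<m))) ⟩
    v + q ^ suc j + (0# + (1# - q ^ suc j))
      ≈⟨ solve 2 (λ s v → v :+ s :+ (con 0ℤ :+ (one :- s)) := one :+ v) refl (q ^ suc j) v ⟩
    1# + v ∎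
  below-upper y₁-cell = begin
    b (0 , suc m) + (0# + below₂ a (0 , suc m))
      ≡⟨ cong₂ (λ s t → s + (0# + t)) (if-> (m< 0)) (≡.trans (when-in (in₀ (ℕ.n≤1+n m))) (if-≤ ℕ.≤-refl)) ⟩
    v + (0# + (1# - v))
      ≈⟨ solve 1 (λ v → v :+ (con 0ℤ :+ (one :- v)) := one) refl v ⟩
    1# ∎
  below-upper y₂-cell = begin
    b (1 , m) + (below₁ a (1 , m) + below₂ a (1 , m))
      ≡⟨ cong₂ _+_ (if-≤ ℕ.≤-refl) (cong₂ _+_ (≡.trans (when-in (in₀ (ℕ.n≤1+n m))) (if-≤ ℕ.≤-refl)) (left m ℕ.≤-refl)) ⟩
    v + (1# - v + 0#)
      ≈⟨ solve 1 (λ v → v :+ (one :- v :+ con 0ℤ) := one) refl v ⟩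
    1# ∎
    where
    left : ∀ j → j ≤ m → atM ((1 , j) ↓₂) a ≡ 0#
    left zero    _   = ≡.refl
    left (suc j) j<m = when-out {1 , j} (out₁ j<m)
  below-upper (z-cell {zero} t≤m) = begin
    b (1 , suc m) + (below₁ a (1 , suc m) + below₂ a (1 , suc m))
      ≡⟨ cong₂ _+_ (b-z 0) (cong₂ _+_ (≡.trans (when-in (in₀ ℕ.≤-refl)) (if-> (m< 0))) (≡.trans (when-in in-y₂) (if-≤ ℕ.≤-refl))) ⟩
    v - 1# + (1# + 1#)
      ≈⟨ solve 1 (λ v → v :- one :+ (one :+ one) := one :+ v) refl v ⟩
    1# + v ∎
  below-upper (z-cell {suc t} t<m) = begin
    b (1 , suc t ℕ.+ suc m) + (below₁ a (1 , suc t ℕ.+ suc m) + below₂ a (1 , suc t ℕ.+ suc m))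
      ≡⟨ cong₂ _+_ (b-z (suc t)) (cong₂ _+_ (when-out (out₀ (s≤s (m< t)))) (≡.trans (when-in (in₁ (ℕ.<⇒≤ t<m))) (a-z t))) ⟩
    v - q ^ suc t + (0# + (1# + q ^ suc t))
      ≈⟨ solve 2 (λ s v → v :- s :+ (con 0ℤ :+ (one :+ s)) := one :+ v) refl (q ^ suc t) v ⟩
    1# + v ∎

  weights : Weights K q S
  weights = record
    { a = a
    ; b = b
    ; d = 1# + q * v
    -- As before 1 + q v is inverted through 1 - (q v)², and (q v)² = q^(2m+4).
    ; d⁻¹ = (1# - q * v) * proj₁ (units (suc m ℕ.+ suc (suc m)))
    ; inverse = inverse
    ; a+qb = a+qb ∘ diamondCell
    ; balance = λ w∈ → let w = diamondCell w∈ in trans (above-upper w) (sym (below-upper w))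
    ; antidiagonal = antidiagonal
    }
    where
    inverse : (1# + q * v) * ((1# - q * v) * proj₁ (units (suc m ℕ.+ suc (suc m)))) ≈ 1#
    inverse = begin
      (1# + q * v) * ((1# - q * v) * proj₁ (units (suc m ℕ.+ suc (suc m))))
        ≈⟨ solve 2 (λ s t → (one :+ s) :* ((one :- s) :* t) := (one :- s :* s) :* t) refl (q * v) _ ⟩
      (1# - (q * v) * (q * v)) * proj₁ (units (suc m ℕ.+ suc (suc m)))
        ≈⟨ *-congʳ (+-congˡ (-‿cong (^-homo-* q (suc (suc m)) (suc (suc m))))) ⟨
      (1# - q ^ (suc (suc m) ℕ.+ suc (suc m))) * proj₁ (units (suc m ℕ.+ suc (suc m)))
        ≈⟨ proj₂ (units (suc m ℕ.+ suc (suc m))) ⟩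
      1# ∎
    a+qb : ∀ {w} → DiamondCell m w → a w + q * b w ≈ 1# + q * v
    a+qb (x-cell {j} j≤m) = trans (+-cong (reflexive (if-≤ j≤m)) (*-congˡ (reflexive (if-≤ j≤m))))
      (solve 3 (λ q s v → one :- q :* s :+ q :* (v :+ s) := one :+ q :* v) refl q (q ^ j) v)
    a+qb y₁-cell = +-cong (reflexive (if-> (m< 0))) (*-congˡ (reflexive (if-> (m< 0))))
    a+qb y₂-cell = +-cong (reflexive (if-≤ ℕ.≤-refl)) (*-congˡ (reflexive (if-≤ ℕ.≤-refl)))
    a+qb (z-cell {t} _) = trans (+-cong (reflexive (a-z t)) (*-congˡ (reflexive (b-z t))))
      (solve 3 (λ q s v → one :+ q :* s :+ q :* (v :- s) := one :+ q :* v) refl q (q ^ t) v)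
    antidiagonal : ∀ {w} → In w → In (w ↑₁) → In (w ↑₂) → a w + b (w ↑₁₂) ≈ 0#
    antidiagonal {zero , j} _ (_ , m≤j , _) (_ , _ , s≤s j≤m) with ℕ.≤-antisym j≤m m≤j
    ... | ≡.refl = trans (+-cong (reflexive (if-≤ j≤m)) (reflexive (b-z 0)))
      (solve 1 (λ v → one :- v :+ (v :- one) := con 0ℤ) refl v)
    antidiagonal {suc i , j} _ (s≤s () , _) _

-- Exceptional posets: tables verified by evaluation.

entry : List ℕ → ℕ → ℕ
entry []       _       = 0
entry (k ∷ ks) zero    = k
entry (k ∷ ks) (suc i) = entry ks i

-- The region lies in the finite box below `top`, so a bounded search decides the statement.
allCells? : (S : Region) (let open Region S) {P : Pred Cell 0ℓ} → Decidable P →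
            Dec (∀ {z} → In z → P z)
allCells? S {P} P? = map′ to (λ f {i} _ {j} _ → f {i , j}) (ℕ.allUpTo? row? (suc last))
  where
  open Region S
  Row : ℕ → Set
  Row i = ∀ {j} → j < suc (hi last) → In (i , j) → P (i , j)
  to : (∀ {i} → i < suc last → Row i) → ∀ {z} → In z → P z
  to f {i , j} z∈ = f (s≤s (proj₁ z∈)) (s≤s (proj₂ (⊑-top z∈))) z∈
  row? : Decidable Row
  row? i = ℕ.allUpTo? (λ j → In? (i , j) →-dec P? (i , j)) (suc (hi last))

module TabulatedWeights (K : CommutativeRing 0ℓ 0ℓ) (q : CommutativeRing.Carrier K)
  (units : Units K q)
  (S : Region)
  (D E : List ℤ) (h : ℕ)  -- D E = [h + 1], which makes D invertible
  (B : Cell → List ℤ)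
  where
  open CommutativeRing K hiding (zero)
  open Algebra.Properties.Semiring.Exp semiring using (_^_)
  open Region S
  open IntegerCoefficients K
    using (Polynomial; con; var; _:+_; _:*_; _:-_; _:^_; ⟦_⟧; normalise;
      _≟N_; ⟦_⟧N-cong; correct; solve; _:=_)
  open Guards K S
  open import Relation.Binary.Reasoning.Setoid setoid

  private
    X one : Polynomial 1
    X   = var Fin.zero
    one = con 1ℤ

    horner : List ℤ → Polynomial 1
    horner = List.foldr (λ c p → con c :+ X :* p) (con 0ℤ)

    ev : Polynomial 1 → Carrier
    ev e = ⟦ e ⟧ (q ∷ [])

    -- Normal forms have integer coefficients, so this Boolean evaluates even though `K` and `q` are
    -- variables. Identities of the tables thus reduce to computation.
    agree : Polynomial 1 → Polynomial 1 → Bool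
    agree e f = Maybe.is-just (normalise e ≟N normalise f)

    agree-sound : ∀ e f → T (agree e f) → ev e ≈ ev f
    agree-sound e f _ with normalise e ≟N normalise f
    ... | just e≈f = trans (sym (correct e (q ∷ []))) (trans (⟦ e≈f ⟧N-cong (q ∷ [])) (correct f (q ∷ [])))

    when′ unless′ : Cell → Polynomial 1 → Polynomial 1
    when′   z e = if does (In? z) then e else con 0ℤ
    unless′ z e = if does (In? z) then con 0ℤ else e

    -- Syntactic copies of the weights and guards, on which `agree` can run. Defining `a′` as D - X
    -- `b′` builds in a + q b = d.
    a′ b′ below₁′ below₂′ above₁′ above₂′ : Cell → Polynomial 1
    b′ z = horner (B z)
    a′ z = horner D :- X :* b′ z
    below₁′ z = Maybe.maybe′ (λ w → when′ w (a′ w)) (con 0ℤ) (z ↓₁)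
    below₂′ z = Maybe.maybe′ (λ w → when′ w (a′ w)) (con 0ℤ) (z ↓₂)
    above₁′ z = when′ (z ↑₁) (Maybe.maybe′ (λ w → unless′ w (b′ (z ↑₁))) (b′ (z ↑₁)) (z ↑₁ ↓₂))
    above₂′ z = when′ (z ↑₂) (Maybe.maybe′ (λ w → unless′ w (b′ (z ↑₂))) (b′ (z ↑₂)) (z ↑₂ ↓₁))

    a b : Cell → Carrier
    a = ev ∘ a′
    b = ev ∘ b′

    ev-if : ∀ t e f → ev (if t then e else f) ≡ (if t then ev e else ev f)
    ev-if true  e f = ≡.refl
    ev-if false e f = ≡.refl

    ev-below : ∀ m → ev (Maybe.maybe′ (λ w → when′ w (a′ w)) (con 0ℤ) m) ≡ atM m a
    ev-below nothing  = ≡.refl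
    ev-below (just w) = ev-if (does (In? w)) _ _

    ev-above : ∀ z m e → ev (when′ z (Maybe.maybe′ (λ w → unless′ w e) e m)) ≡ when z (unlessM m (ev e))
    ev-above z nothing  e = ev-if (does (In? z)) _ _
    ev-above z (just w) e = ≡.trans (ev-if (does (In? z)) _ _)
      (cong (if does (In? z) then_else 0#) (ev-if (does (In? w)) _ _))

    balanced : Cell → Bool
    balanced z = agree (a′ z :+ (above₁′ z :+ above₂′ z)) (b′ z :+ (below₁′ z :+ below₂′ z))

  balanced? : Dec (∀ {z} → In z → T (balanced z))
  balanced? = allCells? S λ z → Bool.T? (balanced z)

  antidiagonal? : Dec (∀ {z} → In z → In (z ↑₁) → In (z ↑₂) → T (agree (a′ z :+ b′ (z ↑₁₂)) (con 0ℤ)))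
  antidiagonal? = allCells? S λ z → In? (z ↑₁) →-dec In? (z ↑₂) →-dec Bool.T? _

  divides? : Dec (T (agree (horner D :* (horner E :* (one :- X))) (one :- X :^ suc h)))
  divides? = Bool.T? _

  weights : True balanced? → True antidiagonal? → True divides? → Weights K q S
  weights bal anti div = record
    { a = a
    ; b = b
    ; d = ev (horner D)
    ; d⁻¹ = ev (horner E :* (one :- X)) * proj₁ (units h)
    ; inverse = trans (sym (*-assoc _ _ _)) (trans
        (*-congʳ (agree-sound (horner D :* (horner E :* (one :- X))) (one :- X :^ suc h) (toWitness {a? = divides?} div)))
        (proj₂ (units h)))
    ; a+qb = λ {z} _ → solve 3 (λ q d b → (d :- q :* b) :+ q :* b := d) refl q (ev (horner D)) (b z)
    ; balance = λ {z} z∈ → begin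
        a z + (above₁ b z + above₂ b z)
          ≡⟨ cong (λ t → a z + t) (cong₂ _+_ (ev-above (z ↑₁) (z ↑₁ ↓₂) (b′ (z ↑₁))) (ev-above (z ↑₂) (z ↑₂ ↓₁) (b′ (z ↑₂)))) ⟨
        ev (a′ z :+ (above₁′ z :+ above₂′ z))
          ≈⟨ agree-sound (a′ z :+ (above₁′ z :+ above₂′ z)) (b′ z :+ (below₁′ z :+ below₂′ z)) (toWitness {a? = balanced?} bal z∈) ⟩
        ev (b′ z :+ (below₁′ z :+ below₂′ z))
          ≡⟨ cong (λ t → b z + t) (cong₂ _+_ (ev-below (z ↓₁)) (ev-below (z ↓₂))) ⟩
        b z + (below₁ a z + below₂ a z) ∎
    ; antidiagonal = λ {z} z∈ z₁∈ z₂∈ → agree-sound (a′ z :+ b′ (z ↑₁₂)) (con 0ℤ) (toWitness {a? = antidiagonal?} anti z∈ z₁∈ z₂∈)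
    }

+2ℤ -2ℤ : ℤ
+2ℤ = + 2
-2ℤ = ℤ.- + 2

-- A cell, the root of the minuscule poset at that cell, and the coefficients of b there, which were
-- found by solving the linear equations of `Weights` over ℚ(q).
record Entry : Set where
  constructor _↦_&_
  field
    place  : Cell
    code   : ℕ
    weight : List ℤ
open Entry

infix 6 _↦_&_

-- Vectors with small entries are coded by decimal digits, the units digit being the first entry.
digits : ∀ {n} → ℕ → Vec ℤ n
digits {zero}  k = []
digits {suc n} k = + (k ℕ.% 10) ∷ digits (k ℕ./ 10)

module _ (last : ℕ) (los his : List ℕ) where
  private
    Lo Hi Over : ℕ → Set
    Lo i   = entry los i ≤ entry los (suc i)
    Hi i   = entry his i ≤ entry his (suc i)
    Over i = entry los (suc i) ≤ entry his i

    steps? : Dec (∀ {i} → i < last → Lo i × Hi i × Over i)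
    steps? = ℕ.allUpTo? (λ i → entry los i ≤? entry los (suc i) ×-dec entry his i ≤? entry his (suc i) ×-dec
      entry los (suc i) ≤? entry his i) last

  tabulatedRegion : True (entry los 0 ℕ.≟ 0) → True steps? → Region
  tabulatedRegion lo-0 steps = record
    { last = last ; lo = entry los ; hi = entry his ; lo-0 = toWitness lo-0
    ; lo-step  = λ i< → proj₁ (step i<)
    ; hi-step  = λ i< → proj₁ (proj₂ (step i<))
    ; overlaps = λ i< → proj₂ (proj₂ (step i<))
    }
    where
    step : ∀ {i} → i < last → Lo i × Hi i × Over i
    step = toWitness {a? = steps?} steps

module _ (S : Region) (σ : Cell → Cell) where
  open Region S
  private
    Good : Cell → Set
    Good z = In (σ z) × σ (σ z) ≡ z × height z ℕ.+ height (σ z) ≡ rank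
    good? : Dec (∀ {z} → In z → Good z)
    good? = allCells? S λ z → In? (σ z) ×-dec σ (σ z) ≟ᶜ z ×-dec height z ℕ.+ height (σ z) ℕ.≟ rank

  tabulatedSymmetry : True good? → Symmetry S
  tabulatedSymmetry good = record
    { σ = σ
    ; σ∈         = proj₁ ∘ toWitness {a? = good?} good
    ; involutive = proj₁ ∘ proj₂ ∘ toWitness {a? = good?} good
    ; complement = proj₂ ∘ proj₂ ∘ toWitness {a? = good?} good
    }

-- Identifying the roots with the cells of a region.

module RootPoset {n : ℕ} (edges : DynkinDiagram n) (m : Fin n) (S : Region)
  (table : List Entry)
  (others : List ℕ)  -- the positive roots with coefficient 0 at m
  where
  open RootSystem edges
  open Region S

  N : ℕ
  N = List.length table

  root : Fin N → RootVector
  root k = digits (code (List.lookup table k))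

  cellAt : Fin N → Cell
  cellAt k = place (List.lookup table k)

  infix 4 _≟ᵛ_
  _≟ᵛ_ : (β γ : RootVector) → Dec (β ≡ γ)
  _≟ᵛ_ = Vec.≡-dec ℤ._≟_

  positiveRoots roots : List RootVector
  positiveRoots = List.map (digits ∘ code) table ++ List.map digits others
  roots = positiveRoots ++ List.map (Vec.map λ c → ℤ.- c) positiveRoots

  -- A positive root that is not simple pairs positively with some simple root, whose reflection lowers it.
  isRoot? : (fuel : ℕ) (β : RootVector) → Maybe (IsRoot β)
  isRoot? zero       β = nothing
  isRoot? (suc fuel) β = case Fin.any? (λ j → β ≟ᵛ simpleRoot j) of λ where
    (yes (j , β≡)) → just (subst IsRoot (≡.sym β≡) (simple j))
    (no _) → case Fin.any? (λ j → 0ℤ ℤ.<? pairing β j) of λ where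
      (no _)        → nothing
      (yes (j , _)) → case reflect j (reflect j β) ≟ᵛ β of λ where
        (no _)  → nothing
        (yes e) → Maybe.map (subst IsRoot e ∘ reflected j) (isRoot? fuel (reflect j β))

  Simple Closed Listed : Set
  Simple = ∀ j → simpleRoot j ∈ roots
  Closed = All (λ β → ∀ j → reflect j β ∈ roots) roots
  Listed = All (λ β → 0ℤ ℤ.< Vec.lookup β m → ∃[ k ] root k ≡ β) roots

  _∈roots? : ∀ β → Dec (β ∈ roots)
  β ∈roots? = Any.any? (β ≟ᵛ_) roots

  simple? : Dec Simple
  simple? = Fin.all? λ j → simpleRoot j ∈roots?

  closed? : Dec Closed
  closed? = All.all? (λ β → Fin.all? λ j → reflect j β ∈roots?) roots

  listed? : Dec Listed
  listed? = All.all? (λ β → 0ℤ ℤ.<? Vec.lookup β m →-dec Fin.any? λ k → root k ≟ᵛ β) roots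

  -- The fuel `suc rank` is the height of the highest root: the poset starts at a simple root, of
  -- height 1, and each reflection in the descent lowers the height.
  isRoots? : Dec (∀ k → T (Maybe.is-just (isRoot? (suc rank) (root k))))
  isRoots? = Fin.all? λ k → Bool.T? _

  positive? : Dec (∀ k → (∀ i → 0ℤ ℤ.≤ Vec.lookup (root k) i) × 0ℤ ℤ.< Vec.lookup (root k) m)
  positive? = Fin.all? λ k → Fin.all? (λ i → 0ℤ ℤ.≤? Vec.lookup (root k) i) ×-dec 0ℤ ℤ.<? Vec.lookup (root k) m

  Below : RootVector → RootVector → Set
  Below = Pointwise.Pointwise ℤ._≤_

  order? : Dec (∀ k l → (Below (root k) (root l) → cellAt k ⊑ cellAt l) ×
                        (cellAt k ⊑ cellAt l → Below (root k) (root l)))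
  order? = Fin.all? λ k → Fin.all? λ l →
    let r? = Pointwise.decidable ℤ._≤?_ (root k) (root l)
        c? = proj₁ (cellAt k) ≤? proj₁ (cellAt l) ×-dec proj₂ (cellAt k) ≤? proj₂ (cellAt l)
    in (r? →-dec c?) ×-dec (c? →-dec r?)

  inside? : Dec (∀ k → In (cellAt k))
  inside? = Fin.all? λ k → In? (cellAt k)

  onto? : Dec (∀ {z} → In z → ∃[ k ] cellAt k ≡ z)
  onto? = allCells? S λ z → Fin.any? λ k → cellAt k ≟ᶜ z

  embedding : True simple? → True closed? → True listed? → True isRoots? → True positive? → True order? →
              True inside? → True onto? → Embedding (minusculePoset m) S
  embedding simp clo lis isr pos ord ins ont = record
    { cell     = λ (β , (β-root , _) , 0<βm) → cellAt (proj₁ (index β-root 0<βm))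
    ; monotone = λ {x} {y} x≤y → proj₁ (toWitness {a? = order?} ord _ _)
        (≡.subst₂ Below (≡.sym (found x)) (≡.sym (found y)) x≤y)
    ; reflects = λ {x} {y} c → ≡.subst₂ Below (found x) (found y) (proj₂ (toWitness {a? = order?} ord _ _) c)
    ; cell∈    = λ _ → toWitness {a? = inside?} ins _
    ; onto     = λ z∈ → let k , e = toWitness {a? = onto?} ont z∈
                            x = element k
                        in x , ≡.trans (⊑-antisym (same x k (found x)) (same⁻ x k (found x))) e
    }
    where
    -- A list that contains the simple roots and is closed under simple reflections contains their
    -- whole Weyl orbit.
    ∈roots : ∀ {β} → IsRoot β → β ∈ roots
    ∈roots (simple j)      = toWitness {a? = simple?} simp j
    ∈roots (reflected j r) = All.lookup (toWitness {a? = closed?} clo) (∈roots r) j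

    index : ∀ {β} → IsRoot β → 0ℤ ℤ.< Vec.lookup β m → ∃[ k ] root k ≡ β
    index r 0<βm = All.lookup (toWitness {a? = listed?} lis) (∈roots r) 0<βm

    Λ : Set
    Λ = ∃[ β ] IsPositiveRoot β × 0ℤ ℤ.< Vec.lookup β m

    indexΛ : Λ → Fin N
    indexΛ (β , (r , _) , 0<βm) = proj₁ (index r 0<βm)

    found : (x : Λ) → root (indexΛ x) ≡ proj₁ x
    found (β , (r , _) , 0<βm) = proj₂ (index r 0<βm)

    element : Fin N → Λ
    element k = let ≥0 , 0<m = toWitness {a? = positive?} pos k in
      root k , (extract (isRoot? (suc rank) (root k)) (toWitness {a? = isRoots?} isr k) , ≥0) , 0<m
      where
      extract : ∀ {A : Set} (r : Maybe A) → T (Maybe.is-just r) → A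
      extract (just a) _ = a

    below-refl : ∀ {β γ : RootVector} → β ≡ γ → Below β γ
    below-refl ≡.refl = Pointwise.refl ℤ.≤-refl

    -- The index found for a root depends on how it was derived as a root, so `indexΛ x` need not be
    -- k. The order check in both directions still gives equal cells.
    same : ∀ x k → root (indexΛ x) ≡ root k → cellAt (indexΛ x) ⊑ cellAt k
    same x k e = proj₁ (toWitness {a? = order?} ord (indexΛ x) k) (below-refl e)
    same⁻ : ∀ x k → root (indexΛ x) ≡ root k → cellAt k ⊑ cellAt (indexΛ x)
    same⁻ x k e = proj₁ (toWitness {a? = order?} ord k (indexΛ x)) (below-refl (≡.sym e))

weightAt : List Entry → Cell → List ℤ
weightAt []       z = []
weightAt (e ∷ es) z = if does (place e ≟ᶜ z) then weight e else weightAt es z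

module Λ₆ where
  region : Region
  region = tabulatedRegion 3 (0 ∷ 2 ∷ 2 ∷ 4 ∷ []) (3 ∷ 5 ∷ 5 ∷ 7 ∷ []) _ _

  table : List Entry
  table =
    (0 , 0) ↦ 1 & (1ℤ ∷ 1ℤ ∷ 0ℤ ∷ 0ℤ ∷ 1ℤ ∷ 1ℤ ∷ []) ∷
    (0 , 1) ↦ 101 & (0ℤ ∷ 1ℤ ∷ 1ℤ ∷ 1ℤ ∷ 1ℤ ∷ 1ℤ ∷ []) ∷
    (0 , 2) ↦ 1101 & (0ℤ ∷ 0ℤ ∷ 1ℤ ∷ +2ℤ ∷ +2ℤ ∷ 1ℤ ∷ []) ∷
    (0 , 3) ↦ 1111 & (0ℤ ∷ 0ℤ ∷ 0ℤ ∷ 1ℤ ∷ 1ℤ ∷ 1ℤ ∷ []) ∷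
    (1 , 2) ↦ 11101 & (0ℤ ∷ 0ℤ ∷ 0ℤ ∷ 1ℤ ∷ +2ℤ ∷ 1ℤ ∷ []) ∷
    (1 , 3) ↦ 11111 & (-1ℤ ∷ -1ℤ ∷ 0ℤ ∷ +2ℤ ∷ +2ℤ ∷ 1ℤ ∷ []) ∷
    (1 , 4) ↦ 12111 & (0ℤ ∷ -1ℤ ∷ -1ℤ ∷ 1ℤ ∷ +2ℤ ∷ 1ℤ ∷ []) ∷
    (1 , 5) ↦ 12211 & (0ℤ ∷ 0ℤ ∷ -1ℤ ∷ 0ℤ ∷ 1ℤ ∷ 1ℤ ∷ []) ∷
    (2 , 2) ↦ 111101 & (0ℤ ∷ 0ℤ ∷ 0ℤ ∷ 0ℤ ∷ 1ℤ ∷ 1ℤ ∷ []) ∷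
    (2 , 3) ↦ 111111 & (-1ℤ ∷ -1ℤ ∷ 0ℤ ∷ 1ℤ ∷ 1ℤ ∷ 1ℤ ∷ []) ∷
    (2 , 4) ↦ 112111 & (-1ℤ ∷ -2ℤ ∷ -1ℤ ∷ 1ℤ ∷ +2ℤ ∷ 1ℤ ∷ []) ∷
    (2 , 5) ↦ 112211 & (-1ℤ ∷ -1ℤ ∷ -1ℤ ∷ 0ℤ ∷ 1ℤ ∷ 1ℤ ∷ []) ∷
    (3 , 4) ↦ 122111 & (0ℤ ∷ -1ℤ ∷ -1ℤ ∷ 0ℤ ∷ 1ℤ ∷ 1ℤ ∷ []) ∷
    (3 , 5) ↦ 122211 & (-1ℤ ∷ -2ℤ ∷ -2ℤ ∷ 0ℤ ∷ 1ℤ ∷ 1ℤ ∷ []) ∷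
    (3 , 6) ↦ 123211 & (0ℤ ∷ -1ℤ ∷ -2ℤ ∷ -1ℤ ∷ 1ℤ ∷ 1ℤ ∷ []) ∷
    (3 , 7) ↦ 123221 & (0ℤ ∷ 0ℤ ∷ -1ℤ ∷ -1ℤ ∷ 0ℤ ∷ 1ℤ ∷ []) ∷
    []

  others : List ℕ
  others =
    100000 ∷ 10000 ∷ 1000 ∷ 100 ∷ 10 ∷ 110000 ∷ 11000 ∷ 1100 ∷
    1010 ∷ 111000 ∷ 11100 ∷ 11010 ∷ 1110 ∷ 111100 ∷ 111010 ∷ 11110 ∷
    111110 ∷ 12110 ∷ 112110 ∷ 122110 ∷
    []

  embedding : Embedding Λ-E₆ region
  embedding = RootPoset.embedding E₆ 0F region table others _ _ _ _ _ _ _ _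

  symmetry : Symmetry region
  symmetry = tabulatedSymmetry region (λ (i , j) → 3 ∸ i , 7 ∸ j) _

  -- In cyclotomic polynomials d = Φ₃ Φ₁₂ and e = Φ₂ Φ₄ Φ₆, with product [12]. Here e is the common
  -- factor of [12] and the rank generating function, so d is the denominator of the constant in
  -- lowest terms.
  d e : List ℤ
  d = 1ℤ ∷ 1ℤ ∷ 0ℤ ∷ -1ℤ ∷ 0ℤ ∷ 1ℤ ∷ 1ℤ ∷ []
  e = 1ℤ ∷ 0ℤ ∷ 1ℤ ∷ 1ℤ ∷ 0ℤ ∷ 1ℤ ∷ []

module Λ₇ where
  region : Region
  region = tabulatedRegion 8 (0 ∷ 3 ∷ 3 ∷ 5 ∷ 6 ∷ 6 ∷ 8 ∷ 8 ∷ 8 ∷ []) (4 ∷ 7 ∷ 7 ∷ 7 ∷ 8 ∷ 8 ∷ 8 ∷ 8 ∷ 8 ∷ []) _ _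

  table : List Entry
  table =
    (0 , 0) ↦ 1000000 & (1ℤ ∷ 1ℤ ∷ 0ℤ ∷ -1ℤ ∷ 0ℤ ∷ 1ℤ ∷ 1ℤ ∷ []) ∷
    (0 , 1) ↦ 1100000 & (0ℤ ∷ 1ℤ ∷ 1ℤ ∷ 0ℤ ∷ 0ℤ ∷ 1ℤ ∷ 1ℤ ∷ []) ∷
    (0 , 2) ↦ 1110000 & (0ℤ ∷ 0ℤ ∷ 1ℤ ∷ 1ℤ ∷ 1ℤ ∷ 1ℤ ∷ 1ℤ ∷ []) ∷
    (0 , 3) ↦ 1111000 & (0ℤ ∷ 0ℤ ∷ 0ℤ ∷ 1ℤ ∷ +2ℤ ∷ +2ℤ ∷ 1ℤ ∷ []) ∷
    (0 , 4) ↦ 1111010 & (0ℤ ∷ 0ℤ ∷ 0ℤ ∷ 0ℤ ∷ 1ℤ ∷ 1ℤ ∷ 1ℤ ∷ []) ∷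
    (1 , 3) ↦ 1111100 & (0ℤ ∷ 0ℤ ∷ 0ℤ ∷ 0ℤ ∷ 1ℤ ∷ +2ℤ ∷ 1ℤ ∷ []) ∷
    (1 , 4) ↦ 1111110 & (-1ℤ ∷ -1ℤ ∷ 0ℤ ∷ 1ℤ ∷ +2ℤ ∷ +2ℤ ∷ 1ℤ ∷ []) ∷
    (1 , 5) ↦ 1112110 & (0ℤ ∷ -1ℤ ∷ -1ℤ ∷ 0ℤ ∷ +2ℤ ∷ +2ℤ ∷ 1ℤ ∷ []) ∷
    (1 , 6) ↦ 1122110 & (0ℤ ∷ 0ℤ ∷ -1ℤ ∷ -1ℤ ∷ 1ℤ ∷ +2ℤ ∷ 1ℤ ∷ []) ∷
    (1 , 7) ↦ 1222110 & (0ℤ ∷ 0ℤ ∷ 0ℤ ∷ -1ℤ ∷ 0ℤ ∷ 1ℤ ∷ 1ℤ ∷ []) ∷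
    (2 , 3) ↦ 1111101 & (0ℤ ∷ 0ℤ ∷ 0ℤ ∷ 0ℤ ∷ 0ℤ ∷ 1ℤ ∷ 1ℤ ∷ []) ∷
    (2 , 4) ↦ 1111111 & (-1ℤ ∷ -1ℤ ∷ 0ℤ ∷ 1ℤ ∷ 1ℤ ∷ 1ℤ ∷ 1ℤ ∷ []) ∷
    (2 , 5) ↦ 1112111 & (-1ℤ ∷ -2ℤ ∷ -1ℤ ∷ 1ℤ ∷ +2ℤ ∷ +2ℤ ∷ 1ℤ ∷ []) ∷
    (2 , 6) ↦ 1122111 & (-1ℤ ∷ -1ℤ ∷ -1ℤ ∷ 0ℤ ∷ 1ℤ ∷ +2ℤ ∷ 1ℤ ∷ []) ∷
    (2 , 7) ↦ 1222111 & (-1ℤ ∷ -1ℤ ∷ 0ℤ ∷ 0ℤ ∷ 0ℤ ∷ 1ℤ ∷ 1ℤ ∷ []) ∷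
    (3 , 5) ↦ 1112211 & (0ℤ ∷ -1ℤ ∷ -1ℤ ∷ 0ℤ ∷ 1ℤ ∷ 1ℤ ∷ 1ℤ ∷ []) ∷
    (3 , 6) ↦ 1122211 & (-1ℤ ∷ -2ℤ ∷ -2ℤ ∷ 0ℤ ∷ +2ℤ ∷ +2ℤ ∷ 1ℤ ∷ []) ∷
    (3 , 7) ↦ 1222211 & (-1ℤ ∷ -2ℤ ∷ -1ℤ ∷ 0ℤ ∷ 1ℤ ∷ 1ℤ ∷ 1ℤ ∷ []) ∷
    (4 , 6) ↦ 1123211 & (0ℤ ∷ -1ℤ ∷ -2ℤ ∷ -1ℤ ∷ 1ℤ ∷ +2ℤ ∷ 1ℤ ∷ []) ∷
    (4 , 7) ↦ 1223211 & (-1ℤ ∷ -2ℤ ∷ -2ℤ ∷ -1ℤ ∷ 1ℤ ∷ +2ℤ ∷ 1ℤ ∷ []) ∷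
    (4 , 8) ↦ 1233211 & (0ℤ ∷ -1ℤ ∷ -1ℤ ∷ -1ℤ ∷ 0ℤ ∷ 1ℤ ∷ 1ℤ ∷ []) ∷
    (5 , 6) ↦ 1123221 & (0ℤ ∷ 0ℤ ∷ -1ℤ ∷ -1ℤ ∷ 0ℤ ∷ 1ℤ ∷ 1ℤ ∷ []) ∷
    (5 , 7) ↦ 1223221 & (-1ℤ ∷ -1ℤ ∷ -1ℤ ∷ -1ℤ ∷ 0ℤ ∷ 1ℤ ∷ 1ℤ ∷ []) ∷
    (5 , 8) ↦ 1233221 & (-1ℤ ∷ -2ℤ ∷ -2ℤ ∷ -1ℤ ∷ 0ℤ ∷ 1ℤ ∷ 1ℤ ∷ []) ∷
    (6 , 8) ↦ 1234221 & (0ℤ ∷ -1ℤ ∷ -2ℤ ∷ -2ℤ ∷ 0ℤ ∷ 1ℤ ∷ 1ℤ ∷ []) ∷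
    (7 , 8) ↦ 1234321 & (0ℤ ∷ 0ℤ ∷ -1ℤ ∷ -2ℤ ∷ -1ℤ ∷ 1ℤ ∷ 1ℤ ∷ []) ∷
    (8 , 8) ↦ 1234322 & (0ℤ ∷ 0ℤ ∷ 0ℤ ∷ -1ℤ ∷ -1ℤ ∷ 0ℤ ∷ 1ℤ ∷ []) ∷
    []

  others : List ℕ
  others =
    100000 ∷ 10000 ∷ 1000 ∷ 100 ∷ 10 ∷ 1 ∷ 110000 ∷ 11000 ∷
    1100 ∷ 1010 ∷ 101 ∷ 111000 ∷ 11100 ∷ 11010 ∷ 1110 ∷ 1101 ∷
    111100 ∷ 111010 ∷ 11110 ∷ 11101 ∷ 1111 ∷ 111110 ∷ 12110 ∷ 111101 ∷
    11111 ∷ 112110 ∷ 111111 ∷ 12111 ∷ 122110 ∷ 112111 ∷ 12211 ∷ 122111 ∷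
    112211 ∷ 122211 ∷ 123211 ∷ 123221 ∷
    []

  embedding : Embedding Λ-E₇ region
  embedding = RootPoset.embedding E₇ 6F region table others _ _ _ _ _ _ _ _

  symmetry : Symmetry region
  -- Unlike for E₆ a half turn does not preserve the shape; the reflection in the antidiagonal does.
  symmetry = tabulatedSymmetry region (λ (i , j) → 8 ∸ j , 8 ∸ i) _

  -- Here d = Φ₂ Φ₁₈ and e = Φ₃ Φ₆ Φ₉, with product [18]; again d is the reduced denominator of the
  -- constant.
  d e : List ℤ
  d = 1ℤ ∷ 1ℤ ∷ 0ℤ ∷ -1ℤ ∷ -1ℤ ∷ 0ℤ ∷ 1ℤ ∷ 1ℤ ∷ []
  e = 1ℤ ∷ 0ℤ ∷ 1ℤ ∷ 1ℤ ∷ 1ℤ ∷ 1ℤ ∷ 1ℤ ∷ 1ℤ ∷ 1ℤ ∷ 0ℤ ∷ 1ℤ ∷ []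

module ExceptionalWeights (K : CommutativeRing 0ℓ 0ℓ) (q : CommutativeRing.Carrier K)
  (units : Units K q)
  where

  weights-E₆ : Weights K q Λ₆.region
  -- The exponent 11 + 1 = 12, like 17 + 1 = 18 for E₇, is the Coxeter number, which equals rank +
  -- 2.
  weights-E₆ = TabulatedWeights.weights K q units Λ₆.region Λ₆.d Λ₆.e 11 (weightAt Λ₆.table) _ _ _

  weights-E₇ : Weights K q Λ₇.region
  weights-E₇ = TabulatedWeights.weights K q units Λ₇.region Λ₇.d Λ₇.e 17 (weightAt Λ₇.table) _ _ _

-- From an abstract ring to the field of fractions.

open FinitePoset using (Carrier; poset; IsRankFunction; maximum)

module FromDomain (D : CommutativeRing 0ℓ 0ℓ) (D-domain : IsStableDomain D) where
  private
    module D = CommutativeRing D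
    module F = FieldOfFractions D D-domain
    module K = CommutativeRing F.fractionRing
    module D-Exp = Algebra.Properties.Semiring.Exp D.semiring
    module K-Exp = Algebra.Properties.Semiring.Exp K.semiring
    module D-Sum = Algebra.Definitions.RawMonoid D.+-rawMonoid
    module K-Sum = Algebra.Definitions.RawMonoid K.+-rawMonoid
  open F using (fromDomain; cross)

  fromDomain-+ : ∀ x y → fromDomain (x D.+ y) K.≈ fromDomain x K.+ fromDomain y
  fromDomain-+ x y = cross (D.*-cong (D.sym (D.+-cong (D.*-identityʳ x) (D.*-identityʳ y))) (D.*-identityˡ D.1#))

  fromDomain-* : ∀ x y → fromDomain (x D.* y) K.≈ fromDomain x K.* fromDomain y
  fromDomain-* x y = cross (D.*-congˡ (D.*-identityˡ D.1#))

  fromDomain-^ : ∀ x n → fromDomain (x D-Exp.^ n) K.≈ fromDomain x K-Exp.^ n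
  fromDomain-^ x zero    = K.refl
  fromDomain-^ x (suc n) = K.trans (fromDomain-* x (x D-Exp.^ n)) (K.*-congˡ {fromDomain x} (fromDomain-^ x n))

  fromDomain-sum : ∀ {n} (f : Fin n → D.Carrier) → fromDomain (D-Sum.sum f) K.≈ K-Sum.sum (fromDomain ∘ f)
  fromDomain-sum {zero}  f = K.refl
  fromDomain-sum {suc n} f = K.trans (fromDomain-+ (f Fin.zero) (D-Sum.sum (f ∘ Fin.suc)))
    (K.+-congˡ {fromDomain (f Fin.zero)} (fromDomain-sum (f ∘ Fin.suc)))

  fromDomain-inverse : ∀ x (x≉0 : ¬ x D.≈ D.0#) → fromDomain x K.* (D.1# F./ x [ x≉0 ]) K.≈ K.1#
  fromDomain-inverse x x≉0 = cross (D.trans (D.*-identityʳ _)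
    (D.trans (D.*-comm x D.1#) (D.*-congˡ (D.sym (D.*-identityˡ x)))))

  cancel-den : ∀ x y (y≉0 : ¬ y D.≈ D.0#) → (x F./ y [ y≉0 ]) K.* fromDomain y K.≈ fromDomain x
  cancel-den x y y≉0 = cross (D.*-assoc x y D.1#)


module FractionField (D : CommutativeRing 0ℓ 0ℓ) (D-domain : IsStableDomain D)
  (X : CommutativeRing.Carrier D) where
  private
    module D = CommutativeRing D
    module F = FieldOfFractions D D-domain
    module K = CommutativeRing F.fractionRing
    module K-Exp = Algebra.Properties.Semiring.Exp K.semiring
  open FromDomain D D-domain
  open Algebra.Properties.Semiring.Exp D.semiring using (_^_)
  open Algebra.Definitions.RawMonoid D.+-rawMonoid using (sum)
  open F using (fromDomain; _/_[_])

  q : K.Carrier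
  q = fromDomain X

  module _ (1-X^≉0 : ∀ n → ¬ D.1# D.- X ^ suc n D.≈ D.0#) where

    units : Units F.fractionRing q
    units n = x , K.trans (K.*-congʳ {x = x} embedded) (fromDomain-inverse (D.1# D.- X ^ suc n) (1-X^≉0 n))
      where
      x : K.Carrier
      x = D.1# / D.1# D.- X ^ suc n [ 1-X^≉0 n ]
      embedded : K.1# K.- q K-Exp.^ suc n K.≈ fromDomain (D.1# D.- X ^ suc n)
      embedded = K.sym (K.trans (fromDomain-+ D.1# (D.- (X ^ suc n)))
        (K.+-congˡ {K.1#} (K.-‿cong (fromDomain-^ X (suc n)))))

    module _ (P : FinitePoset) (rk : Carrier P → ℕ) (isRank : IsRankFunction P rk) where
      open FinitePoset P using (element)
      open Toggleability P F.fractionRing q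

      R M : D.Carrier
      R = sum λ i → X ^ rk (element i)
      M = sum {2 ℕ.+ maximum P rk} λ s → X ^ toℕ s

      module _ (M≉0 : ¬ M D.≈ D.0#) where
        region-homomesy : ∀ {S} → Embedding (poset P) S → Symmetry S → Weights F.fractionRing q S →
                          ∑T⁻ ≡^q λ _ → R / M [ M≉0 ]
        region-homomesy {S} E symmetry W = Homomesy.homomesy P S E F.fractionRing q W symmetry rk isRank
          (R / M [ M≉0 ]) (D.1# / M [ M≉0 ])
          (K.trans (K.*-congʳ {x = D.1# / M [ M≉0 ]} (K.sym M≃)) (fromDomain-inverse M M≉0))
          (K.trans (K.*-congˡ {R / M [ M≉0 ]} (K.sym M≃)) (K.trans (cancel-den R M M≉0) R≃))
          where
          open Sums F.fractionRing using (sum-cong-≋) renaming (sum to sumᴷ)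
          M≃ : fromDomain M K.≈ sumᴷ {2 ℕ.+ maximum P rk} (λ s → q K-Exp.^ toℕ s)
          M≃ = K.trans (fromDomain-sum {2 ℕ.+ maximum P rk} (λ s → X ^ toℕ s))
            (sum-cong-≋ {2 ℕ.+ maximum P rk} λ s → fromDomain-^ X (toℕ s))
          R≃ : fromDomain R K.≈ sumᴷ (λ i → q K-Exp.^ rk (element i))
          R≃ = K.trans (fromDomain-sum (λ i → X ^ rk (element i)))
            (sum-cong-≋ λ i → fromDomain-^ X (rk (element i)))

        open ClassicalWeights F.fractionRing q units
        open ExceptionalWeights F.fractionRing q units

        minuscule-homomesy : IsMinuscule (poset P) → ∑T⁻ ≡^q λ _ → R / M [ M≉0 ]
        minuscule-homomesy (is-rectangle (suc m) (suc n) _ _ P≅) =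
          region-homomesy (transport P≅ (rectangle-embedding m n)) (rectangle-symmetry m n) (Rectangle.weights m n)
        minuscule-homomesy (is-shiftedStaircase (suc n) _ P≅) =
          region-homomesy (transport P≅ (staircase-embedding n)) (staircase-symmetry n) (Staircase.weights n)
        minuscule-homomesy (is-doubleTailedDiamond (suc zero) (s≤s ()) _)
        minuscule-homomesy (is-doubleTailedDiamond (suc (suc m)) _ P≅) =
          region-homomesy (transport P≅ (diamond-embedding m)) (diamond-symmetry m)
            (DiamondWeights.weights F.fractionRing q units m)
        minuscule-homomesy (is-Λ-E₆ P≅) = region-homomesy (transport P≅ Λ₆.embedding) Λ₆.symmetry weights-E₆
        minuscule-homomesy (is-Λ-E₇ P≅) = region-homomesy (transport P≅ Λ₇.embedding) Λ₇.symmetry weights-E₇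

module ConstantTerm (R : CommutativeRing 0ℓ 0ℓ) (R-domain : IsStableDomain R) where
  private
    module R = CommutativeRing R
    module R[X] = Polynomial R
    module Poly = CommutativeRing R[X].polynomialRing
  open R[X] using (X; coeff; _^_)
  open Algebra.Properties.Ring R.ring using (-0#≈0#)

  coeff-1-X* : ∀ p → coeff (Poly.1# Poly.- X Poly.* p) 0 R.≈ R.1#
  coeff-1-X* []      = R.trans (R.+-congˡ -0#≈0#) (R.+-identityʳ R.1#)
  coeff-1-X* (b ∷ p) = R.trans
    (R.+-congˡ (R.trans (R.-‿cong (R.trans (R.+-identityʳ _) (R.zeroˡ b))) -0#≈0#)) (R.+-identityʳ R.1#)

  -- The constant term of 1 - X p is 1 for every p, so vanishing would force 1 ≈ 0 in R.
  1-X^≉0 : ∀ n → ¬ Poly.1# Poly.- X ^ suc n Poly.≈ Poly.0#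
  1-X^≉0 n e = IsStableDomain.1≉0 R-domain (R.trans (R.sym (coeff-1-X* (X ^ n))) (R[X].at e 0))

open import Data.Nat.Base using (_+_)
open ℝ⟨q⟩ using (_/_[_])
open ℝ[q] using ([_]ₓ; [suc]ₓ≉0)

theorem5p16 : (P : FinitePoset) → IsMinuscule (poset P) →
    (rk : Carrier P → ℕ) → IsRankFunction P rk →
    let open Statistics P in
    ∑T⁻ ≡^q λ _ →
    rankGeneratingFunction rk / [ 2 + maximum P rk ]ₓ
    [ [suc]ₓ≉0 Real.ℝ-isStableDomain (1 + maximum P rk) ]
theorem5p16 P minuscule rk isRank =
  FractionField.minuscule-homomesy ℝ[q].polynomialRing (ℝ[q].polynomial-isStableDomain Real.ℝ-isStableDomain)
    ℝ[q].X (ConstantTerm.1-X^≉0 Real.ℝ-commutativeRing Real.ℝ-isStableDomain)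
    P rk isRank ([suc]ₓ≉0 Real.ℝ-isStableDomain (1 + maximum P rk)) minuscule
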